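{- The $\mathrm{Hyper^2LTL}$ satisfiability problem (given a $\mathrm{Hyper^2LTL}$ sentence $\varphi$, is there a set $T$ of traces with $T\models\varphi$?) is polynomial-time equivalent to truth in third-order arithmetic. The lower bound (i.e. the polynomial-time reduction from truth in third-order arithmetic to satisfiability) holds even for $X_a$-free sentences.
   Context: Syntax. Let $\mathrm{AP}$ be a nonempty finite set of atomic propositions. A trace over $\mathrm{AP}$ is an element $t=t(0)t(1)t(2)\cdots$ of $(2^{\mathrm{AP}})^\omega$. Let $\mathcal V_1$ be a set of trace variables $\pi$ and $\mathcal V_2$ a disjoint set of second-order variables $X$ (ranging over sets of traces), with two distinguished variables $X_a,X_d\in\mathcal V_2$. $\mathrm{Hyper^2LTL}$ formulas are given by $\varphi ::= \exists X.\,\varphi \mid \forall X.\,\varphi \mid \exists \pi\in X.\,\varphi \mid \forall\pi\in X.\,\varphi \mid \psi$ and $\psi ::= p_\pi \mid \neg\psi \mid \psi\vee\psi \mid \mathbf{X}\psi \mid \psi\,\mathbf{U}\,\psi$, with $p\in\mathrm{AP}$, $\pi\in\mathcal V_1$, $X\in\mathcal V_2$. A sentence is a formula in which at most $X_a,X_d$ are free. A sentence is $X_a$-free if $X_a$ does not occur in it. Standard semantics. A variable assignment $\Pi$ is a partial map sending trace variables to traces and second-order variables to sets of traces; $\Pi[\cdot\mapsto\cdot]$ denotes updating; $\Pi[j,\infty)$ maps each trace variable $\pi$ in the domain to the suffix of $\Pi(\pi)$ starting at position $j$. Define $\Pi\models p_\pi$ iff $p\in\Pi(\pi)(0)$; Boolean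 connectives as usual; $\Pi\models\mathbf{X}\psi$ iff $\Pi[1,\infty)\models\psi$; $\Pi\models\psi_1\mathbf{U}\psi_2$ iff there is $j\ge0$ with $\Pi[j,\infty)\models\psi_2$ and $\Pi[j',\infty)\models\psi_1$ for all $0\le j'<j$; $\Pi\models\exists\pi\in X.\varphi$ (resp. $\forall\pi\in X.\varphi$) iff for some (resp. all) $t\in\Pi(X)$, $\Pi[\pi\mapsto t]\models\varphi$; $\Pi\models\exists X.\varphi$ (resp. $\forall X.\varphi$) iff for some (resp. all) $T\subseteq(2^{\mathrm{AP}})^\omega$, $\Pi[X\mapsto T]\models\varphi$. For $T\subseteq(2^{\mathrm{AP}})^\omega$ and a sentence $\varphi$, $T\models\varphi$ means that the assignment with $X_a\mapsto(2^{\mathrm{AP}})^\omega$, $X_d\mapsto T$ (undefined elsewhere) satisfies $\varphi$. Arithmetic. Third-order arithmetic is predicate logic over the signature $(+,\cdot,<,\in)$ with quantification over natural numbers, sets of natural numbers, and sets of sets of natural numbers, evaluated in the structure $(\mathbb N,+,\cdot,<,\in)$. Truth in third-order arithmetic is the problem: given a sentence of third-order arithmetic, does $(\mathbb N,+,\cdot,<,\in)$ satisfy it? Two decision problems are polynomial-time equivalent if each is reducible to the other by a polynomial-time computable many-one reduction. -}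

module Defs where

open import Data.Bool using (Bool; true; false)
import Data.Bool.Properties as Bool
open import Data.Empty using (⊥)
open import Data.Fin using (Fin)
open import Data.Fin.Subset using (Subset) renaming (_∈_ to _∈ₛ_)
open import Data.List using (List; []; _∷_; _++_; map; length; allFin)
open import Data.List.Membership.Propositional using (_∈_)
open import Data.List.Membership.Propositional.Properties using (∈-map⁺; ∈-allFin)
open import Data.List.Properties using (≡-dec)
open import Data.List.Relation.Unary.Any using (here; there)
open import Data.Maybe as Maybe using (Maybe; just; nothing)
open import Data.Maybe.Relation.Unary.Any using (Any)
open import Data.Nat using (ℕ; zero; suc; _+_; _*_; _^_; _≤_; _<_)
open import Data.Product using (Σ; ∃-syntax; _×_; _,_; proj₁)
open import Data.Sum using (_⊎_)
open import Data.Vec as Vec using (Vec)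
open import Function using (_∘_; const)
open import Function.Bundles using (Func; _⇔_)
open import Relation.Binary.Definitions using (DecidableEquality)
open import Relation.Binary.PropositionalEquality using (_≡_; _≢_; refl; setoid; _→-setoid_)
open import Relation.Nullary using (¬_; yes; no)

------------------------------------------------------------------------
-- Variable names

-- Variables are named by binary words, so that a countable supply of them can
-- be written over a finite alphabet.
Name : Set
Name = List Bool

_≟ⁿ_ : DecidableEquality Name
_≟ⁿ_ = ≡-dec Bool._≟_

------------------------------------------------------------------------
-- Hyper²LTL over the propositions Fin n

data SOVar : Set where
  Xa Xd : SOVar
  var   : Name → SOVar

_≟ˢ_ : DecidableEquality SOVar
Xa    ≟ˢ Xa    = yes refl
Xa    ≟ˢ Xd    = no λ ()
Xa    ≟ˢ var _ = no λ ()
Xd    ≟ˢ Xa    = no λ ()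
Xd    ≟ˢ Xd    = yes refl
Xd    ≟ˢ var _ = no λ ()
var _ ≟ˢ Xa    = no λ ()
var _ ≟ˢ Xd    = no λ ()
var x ≟ˢ var y with x ≟ⁿ y
... | yes refl = yes refl
... | no  x≢y  = no λ { refl → x≢y refl }

module Hyper (n : ℕ) where

  infixr 6 _∨_
  infixr 7 _U_

  data QF : Set where
    _at_ : Fin n → Name → QF
    ¬′_  : QF → QF
    _∨_  : QF → QF → QF
    X_   : QF → QF
    _U_  : QF → QF → QF

  data Formula : Set where
    ∃X ∀X : SOVar → Formula → Formula
    ∃π ∀π : Name → SOVar → Formula → Formula
    qf    : QF → Formula

  FreeInQF : Name → QF → Set
  FreeInQF π (p at ρ)  = π ≡ ρ
  FreeInQF π (¬′ ψ)    = FreeInQF π ψ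
  FreeInQF π (ψ₁ ∨ ψ₂) = FreeInQF π ψ₁ ⊎ FreeInQF π ψ₂
  FreeInQF π (X ψ)     = FreeInQF π ψ
  FreeInQF π (ψ₁ U ψ₂) = FreeInQF π ψ₁ ⊎ FreeInQF π ψ₂

  TraceVarFree : Name → Formula → Set
  TraceVarFree π (∃X Y φ)   = TraceVarFree π φ
  TraceVarFree π (∀X Y φ)   = TraceVarFree π φ
  TraceVarFree π (∃π ρ Y φ) = π ≢ ρ × TraceVarFree π φ
  TraceVarFree π (∀π ρ Y φ) = π ≢ ρ × TraceVarFree π φ
  TraceVarFree π (qf ψ)     = FreeInQF π ψ

  SOVarFree : SOVar → Formula → Set
  SOVarFree Z (∃X Y φ)   = Z ≢ Y × SOVarFree Z φ
  SOVarFree Z (∀X Y φ)   = Z ≢ Y × SOVarFree Z φ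
  SOVarFree Z (∃π ρ Y φ) = Z ≡ Y ⊎ SOVarFree Z φ
  SOVarFree Z (∀π ρ Y φ) = Z ≡ Y ⊎ SOVarFree Z φ
  SOVarFree Z (qf ψ)     = ⊥

  -- Binding occurrences count as occurrences.
  OccursSO : SOVar → Formula → Set
  OccursSO Z (∃X Y φ)   = Z ≡ Y ⊎ OccursSO Z φ
  OccursSO Z (∀X Y φ)   = Z ≡ Y ⊎ OccursSO Z φ
  OccursSO Z (∃π ρ Y φ) = Z ≡ Y ⊎ OccursSO Z φ
  OccursSO Z (∀π ρ Y φ) = Z ≡ Y ⊎ OccursSO Z φ
  OccursSO Z (qf ψ)     = ⊥

  IsSentence : Formula → Set
  IsSentence φ = (∀ π → ¬ TraceVarFree π φ) × (∀ Y → SOVarFree Y φ → Y ≡ Xa ⊎ Y ≡ Xd)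

  Sentence : Set
  Sentence = Σ Formula IsSentence

  XaFree : Formula → Set
  XaFree φ = ¬ OccursSO Xa φ

  Trace : Set
  Trace = ℕ → Subset n

  -- Sets are given by their characteristic functions; in the presence of
  -- excluded middle these are all the subsets.  Since there is no function
  -- extensionality, characteristic functions on traces are required to respect
  -- pointwise equality of traces.
  TraceSet : Set
  TraceSet = Func (ℕ →-setoid Subset n) (setoid Bool)

  _∈ᵗ_ : Trace → TraceSet → Set
  t ∈ᵗ T = Func.to T t ≡ true

  allTraces : TraceSet
  allTraces = record { to = const true ; cong = const refl }

  suffix : ℕ → Trace → Trace
  suffix j t i = t (j + i)

  record Assignment : Set where
    constructor assignment
    field
      trace  : Name → Maybe Trace
      traces : SOVar → Maybe TraceSet
  open Assignment public

  _[_↦ᵗ_] : Assignment → Name → Trace → Assignment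
  trace  (Π [ π ↦ᵗ t ]) ρ with π ≟ⁿ ρ
  ... | yes _ = just t
  ... | no  _ = trace Π ρ
  traces (Π [ π ↦ᵗ t ]) = traces Π

  _[_↦ˢ_] : Assignment → SOVar → TraceSet → Assignment
  trace  (Π [ Y ↦ˢ T ]) = trace Π
  traces (Π [ Y ↦ˢ T ]) Z with Y ≟ˢ Z
  ... | yes _ = just T
  ... | no  _ = traces Π Z

  _from_ : Assignment → ℕ → Assignment
  trace  (Π from j) = Maybe.map (suffix j) ∘ trace Π
  traces (Π from j) = traces Π

  infix 4 _⊨ᵠ_ _⊨_ _⊨ˢ_

  _⊨ᵠ_ : Assignment → QF → Set
  Π ⊨ᵠ p at π  = Any (λ t → p ∈ₛ t 0) (trace Π π)
  Π ⊨ᵠ ¬′ ψ    = ¬ (Π ⊨ᵠ ψ)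
  Π ⊨ᵠ ψ₁ ∨ ψ₂ = Π ⊨ᵠ ψ₁ ⊎ Π ⊨ᵠ ψ₂
  Π ⊨ᵠ X ψ     = Π from 1 ⊨ᵠ ψ
  Π ⊨ᵠ ψ₁ U ψ₂ = ∃[ j ] (Π from j ⊨ᵠ ψ₂) × (∀ j′ → j′ < j → Π from j′ ⊨ᵠ ψ₁)

  -- Lookups of undefined variables are false; they never arise for sentences.
  _∈[_]_ : Trace → Assignment → SOVar → Set
  t ∈[ Π ] Y = Any (t ∈ᵗ_) (traces Π Y)

  _⊨_ : Assignment → Formula → Set
  Π ⊨ ∃X Y φ   = ∃[ T ] (Π [ Y ↦ˢ T ]) ⊨ φ
  Π ⊨ ∀X Y φ   = ∀ T → (Π [ Y ↦ˢ T ]) ⊨ φ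
  Π ⊨ ∃π π Y φ = ∃[ t ] t ∈[ Π ] Y × ((Π [ π ↦ᵗ t ]) ⊨ φ)
  Π ⊨ ∀π π Y φ = ∀ t → t ∈[ Π ] Y → (Π [ π ↦ᵗ t ]) ⊨ φ
  Π ⊨ qf ψ     = Π ⊨ᵠ ψ

  initial : TraceSet → Assignment
  trace  (initial T) _       = nothing
  traces (initial T) Xa      = just allTraces
  traces (initial T) Xd      = just T
  traces (initial T) (var _) = nothing

  _⊨ˢ_ : TraceSet → Sentence → Set
  T ⊨ˢ (φ , _) = initial T ⊨ φ

  Satisfiable : Sentence → Set
  Satisfiable φ = ∃[ T ] T ⊨ˢ φ

  data Token : Set where
    ‵∃X ‵∀X ‵∃π ‵∀π ‵Xa ‵Xd ‵¬ ‵∨ ‵X ‵U ‵end : Token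
    ‵bit  : Bool → Token
    ‵prop : Fin n → Token

  tokens : List Token
  tokens = ‵∃X ∷ ‵∀X ∷ ‵∃π ∷ ‵∀π ∷ ‵Xa ∷ ‵Xd ∷ ‵¬ ∷ ‵∨ ∷ ‵X ∷ ‵U ∷ ‵end
         ∷ ‵bit false ∷ ‵bit true ∷ map ‵prop (allFin n)

  ∈-tokens : ∀ s → s ∈ tokens
  ∈-tokens ‵∃X          = here refl
  ∈-tokens ‵∀X          = there (here refl)
  ∈-tokens ‵∃π          = there (there (here refl))
  ∈-tokens ‵∀π          = there (there (there (here refl)))
  ∈-tokens ‵Xa          = there (there (there (there (here refl))))
  ∈-tokens ‵Xd          = there (there (there (there (there (here refl)))))
  ∈-tokens ‵¬           = there (there (there (there (there (there (here refl))))))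
  ∈-tokens ‵∨           = there (there (there (there (there (there (there (here refl)))))))
  ∈-tokens ‵X           = there (there (there (there (there (there (there (there (here refl))))))))
  ∈-tokens ‵U           = there (there (there (there (there (there (there (there (there (here refl)))))))))
  ∈-tokens ‵end         = there (there (there (there (there (there (there (there (there (there (here refl))))))))))
  ∈-tokens (‵bit false) = there (there (there (there (there (there (there (there (there (there (there (here refl)))))))))))
  ∈-tokens (‵bit true)  = there (there (there (there (there (there (there (there (there (there (there (there (here refl))))))))))))
  ∈-tokens (‵prop p)    = there (there (there (there (there (there (there (there (there (there (there (there (there
                            (∈-map⁺ ‵prop (∈-allFin p))))))))))))))

  -- Prefix notation, which is uniquely readable without parentheses.
  encodeName : Name → List Token
  encodeName x = map ‵bit x ++ ‵end ∷ []

  encodeSOVar : SOVar → List Token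
  encodeSOVar Xa      = ‵Xa ∷ []
  encodeSOVar Xd      = ‵Xd ∷ []
  encodeSOVar (var x) = encodeName x

  encodeQF : QF → List Token
  encodeQF (p at π)  = ‵prop p ∷ encodeName π
  encodeQF (¬′ ψ)    = ‵¬ ∷ encodeQF ψ
  encodeQF (ψ₁ ∨ ψ₂) = ‵∨ ∷ encodeQF ψ₁ ++ encodeQF ψ₂
  encodeQF (X ψ)     = ‵X ∷ encodeQF ψ
  encodeQF (ψ₁ U ψ₂) = ‵U ∷ encodeQF ψ₁ ++ encodeQF ψ₂

  encode : Formula → List Token
  encode (∃X Y φ)   = ‵∃X ∷ encodeSOVar Y ++ encode φ
  encode (∀X Y φ)   = ‵∀X ∷ encodeSOVar Y ++ encode φ
  encode (∃π π Y φ) = ‵∃π ∷ encodeName π ++ encodeSOVar Y ++ encode φ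
  encode (∀π π Y φ) = ‵∀π ∷ encodeName π ++ encodeSOVar Y ++ encode φ
  encode (qf ψ)     = encodeQF ψ

------------------------------------------------------------------------
-- Third-order arithmetic

module Arithmetic where

  infix  5 _≐_ _≺_ _∈₁_ _∈₂_
  infixr 4 _∨_

  data Sort : Set where
    number set class : Sort

  data Term : Set where
    var     : Name → Term
    _⊕_ _⊗_ : Term → Term → Term

  -- Each sort has its own copy of the variables.  Equality of numbers is a
  -- logical symbol; equality of sets and of classes is definable.
  data Formula : Set where
    _≐_ _≺_ : Term → Term → Formula
    _∈₁_    : Term → Name → Formula
    _∈₂_    : Name → Name → Formula
    ¬′_     : Formula → Formula
    _∨_     : Formula → Formula → Formula
    ∃′ ∀′   : Sort → Name → Formula → Formula

  OccursIn : Name → Term → Set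
  OccursIn x (var y) = x ≡ y
  OccursIn x (t ⊕ u) = OccursIn x t ⊎ OccursIn x u
  OccursIn x (t ⊗ u) = OccursIn x t ⊎ OccursIn x u

  Free : Sort → Name → Formula → Set
  Free s x (t ≐ u)     = s ≡ number × (OccursIn x t ⊎ OccursIn x u)
  Free s x (t ≺ u)     = s ≡ number × (OccursIn x t ⊎ OccursIn x u)
  Free s x (t ∈₁ A)    = (s ≡ number × OccursIn x t) ⊎ (s ≡ set × x ≡ A)
  Free s x (A ∈₂ C)    = (s ≡ set × x ≡ A) ⊎ (s ≡ class × x ≡ C)
  Free s x (¬′ φ)      = Free s x φ
  Free s x (φ₁ ∨ φ₂)   = Free s x φ₁ ⊎ Free s x φ₂
  Free s x (∃′ s′ y φ) = ¬ (s ≡ s′ × x ≡ y) × Free s x φ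
  Free s x (∀′ s′ y φ) = ¬ (s ≡ s′ × x ≡ y) × Free s x φ

  Sentence : Set
  Sentence = Σ Formula λ φ → ∀ s x → ¬ Free s x φ

  ⟦_⟧ : Sort → Set
  ⟦ number ⟧ = ℕ
  ⟦ set    ⟧ = ℕ → Bool
  ⟦ class  ⟧ = Func (ℕ →-setoid Bool) (setoid Bool)

  record Valuation : Set where
    field
      num : Name → ⟦ number ⟧
      st  : Name → ⟦ set ⟧
      cls : Name → ⟦ class ⟧
  open Valuation public

  override : ∀ {A : Set} → (Name → A) → Name → A → Name → A
  override f x a y with x ≟ⁿ y
  ... | yes _ = a
  ... | no  _ = f y

  _[_,_↦_] : Valuation → (s : Sort) → Name → ⟦ s ⟧ → Valuation
  v [ number , x ↦ a ] = record v { num = override (num v) x a }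
  v [ set    , x ↦ a ] = record v { st  = override (st  v) x a }
  v [ class  , x ↦ a ] = record v { cls = override (cls v) x a }

  eval : Valuation → Term → ℕ
  eval v (var x) = num v x
  eval v (t ⊕ u) = eval v t + eval v u
  eval v (t ⊗ u) = eval v t * eval v u

  infix 3 _⊨_

  _⊨_ : Valuation → Formula → Set
  v ⊨ t ≐ u    = eval v t ≡ eval v u
  v ⊨ t ≺ u    = eval v t < eval v u
  v ⊨ t ∈₁ A   = st v A (eval v t) ≡ true
  v ⊨ A ∈₂ C   = Func.to (cls v C) (st v A) ≡ true
  v ⊨ ¬′ φ     = ¬ (v ⊨ φ)
  v ⊨ φ₁ ∨ φ₂  = (v ⊨ φ₁) ⊎ (v ⊨ φ₂)
  v ⊨ ∃′ s x φ = ∃[ a ] (v [ s , x ↦ a ] ⊨ φ)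
  v ⊨ ∀′ s x φ = ∀ a → v [ s , x ↦ a ] ⊨ φ

  -- The choice of valuation is immaterial for sentences.
  default : Valuation
  num default _ = 0
  st  default _ = const false
  cls default _ = record { to = const false ; cong = const refl }

  True : Sentence → Set
  True (φ , _) = default ⊨ φ

  data Token : Set where
    ‵⊕ ‵⊗ ‵≐ ‵≺ ‵∈₁ ‵∈₂ ‵¬ ‵∨ ‵end : Token
    ‵∃ ‵∀ : Sort → Token
    ‵bit  : Bool → Token

  tokens : List Token
  tokens = ‵⊕ ∷ ‵⊗ ∷ ‵≐ ∷ ‵≺ ∷ ‵∈₁ ∷ ‵∈₂ ∷ ‵¬ ∷ ‵∨ ∷ ‵end
         ∷ ‵∃ number ∷ ‵∃ set ∷ ‵∃ class ∷ ‵∀ number ∷ ‵∀ set ∷ ‵∀ class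
         ∷ ‵bit false ∷ ‵bit true ∷ []

  ∈-tokens : ∀ s → s ∈ tokens
  ∈-tokens ‵⊕           = here refl
  ∈-tokens ‵⊗           = there (here refl)
  ∈-tokens ‵≐           = there (there (here refl))
  ∈-tokens ‵≺           = there (there (there (here refl)))
  ∈-tokens ‵∈₁          = there (there (there (there (here refl))))
  ∈-tokens ‵∈₂          = there (there (there (there (there (here refl)))))
  ∈-tokens ‵¬           = there (there (there (there (there (there (here refl))))))
  ∈-tokens ‵∨           = there (there (there (there (there (there (there (here refl)))))))
  ∈-tokens ‵end         = there (there (there (there (there (there (there (there (here refl))))))))
  ∈-tokens (‵∃ number)  = there (there (there (there (there (there (there (there (there (here refl)))))))))
  ∈-tokens (‵∃ set)     = there (there (there (there (there (there (there (there (there (there (here refl))))))))))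
  ∈-tokens (‵∃ class)   = there (there (there (there (there (there (there (there (there (there (there (here refl)))))))))))
  ∈-tokens (‵∀ number)  = there (there (there (there (there (there (there (there (there (there (there (there (here refl))))))))))))
  ∈-tokens (‵∀ set)     = there (there (there (there (there (there (there (there (there (there (there (there (there (here refl)))))))))))))
  ∈-tokens (‵∀ class)   = there (there (there (there (there (there (there (there (there (there (there (there (there (there (here refl))))))))))))))
  ∈-tokens (‵bit false) = there (there (there (there (there (there (there (there (there (there (there (there (there (there (there (here refl)))))))))))))))
  ∈-tokens (‵bit true)  = there (there (there (there (there (there (there (there (there (there (there (there (there (there (there (there (here refl))))))))))))))))

  -- Prefix notation, as for Hyper²LTL.
  encodeName : Name → List Token
  encodeName x = map ‵bit x ++ ‵end ∷ []

  encodeTerm : Term → List Token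
  encodeTerm (var x) = encodeName x
  encodeTerm (t ⊕ u) = ‵⊕ ∷ encodeTerm t ++ encodeTerm u
  encodeTerm (t ⊗ u) = ‵⊗ ∷ encodeTerm t ++ encodeTerm u

  encode : Formula → List Token
  encode (t ≐ u)    = ‵≐ ∷ encodeTerm t ++ encodeTerm u
  encode (t ≺ u)    = ‵≺ ∷ encodeTerm t ++ encodeTerm u
  encode (t ∈₁ A)   = ‵∈₁ ∷ encodeTerm t ++ encodeName A
  encode (A ∈₂ C)   = ‵∈₂ ∷ encodeName A ++ encodeName C
  encode (¬′ φ)     = ‵¬ ∷ encode φ
  encode (φ₁ ∨ φ₂)  = ‵∨ ∷ encode φ₁ ++ encode φ₂
  encode (∃′ s x φ) = ‵∃ s ∷ encodeName x ++ encode φ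
  encode (∀′ s x φ) = ‵∀ s ∷ encodeName x ++ encode φ

------------------------------------------------------------------------
-- Deterministic multi-tape Turing machines

Finite : Set → Set
Finite A = ∃[ xs ] (∀ (a : A) → a ∈ xs)

data Cell (I O W : Set) : Set where
  blank  : Cell I O W
  input  : I → Cell I O W
  output : O → Cell I O W
  work   : W → Cell I O W

data Move : Set where
  left right stay : Move

-- A two-way infinite tape: the cells to the left of the head (nearest first),
-- the scanned cell, and the cells to its right.  All cells beyond the two lists
-- are blank.
record Tape (Γ : Set) : Set where
  constructor tape
  field
    lefts  : List Γ
    head   : Γ
    rights : List Γ

-- Input alphabet I, output alphabet O.  The machine halts when the transition
-- function is undefined.
record Machine (I O : Set) : Set₁ where
  field
    State       : Set
    stateFinite : Finite State
    Work        : Set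
    workFinite  : Finite Work
    extraTapes  : ℕ

  Γ : Set
  Γ = Cell I O Work

  field
    start : State
    δ     : State → Vec Γ (suc extraTapes) →
            Maybe (State × Vec (Γ × Move) (suc extraTapes))

module Run {I O : Set} (M : Machine I O) where
  open Machine M

  Config : Set
  Config = State × Vec (Tape Γ) (suc extraTapes)

  focus : List Γ → List Γ → Tape Γ
  focus ls []       = tape ls blank []
  focus ls (c ∷ rs) = tape ls c rs

  writeMove : Γ × Move → Tape Γ → Tape Γ
  writeMove (c , stay)  (tape ls       _ rs) = tape ls c rs
  writeMove (c , right) (tape ls       _ rs) = focus (c ∷ ls) rs
  writeMove (c , left)  (tape []       _ rs) = tape [] blank (c ∷ rs)
  writeMove (c , left)  (tape (l ∷ ls) _ rs) = tape ls l (c ∷ rs)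

  step : Config → Maybe Config
  step (q , ts) = Maybe.map (λ (q′ , acts) → q′ , Vec.zipWith writeMove acts ts)
                            (δ q (Vec.map Tape.head ts))

  infix 4 _⟶[_]_

  data _⟶[_]_ : Config → ℕ → Config → Set where
    done : ∀ {c} → c ⟶[ 0 ] c
    next : ∀ {c c′ c″ t} → step c ≡ just c′ → c′ ⟶[ t ] c″ → c ⟶[ suc t ] c″

  initial : List I → Config
  initial w = start , focus [] (map input w) Vec.∷ Vec.replicate extraTapes (focus [] [])

  readout : List Γ → List O
  readout (output o ∷ cs) = o ∷ readout cs
  readout _               = []

  -- The result is read off the first tape: it starts at the head and extends
  -- to the right up to the first cell that holds no output symbol.
  result : Config → List O
  result (_ , tape _ c rs Vec.∷ _) = readout (c ∷ rs)

  HaltsIn_On_With_ : ℕ → List I → List O → Set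
  HaltsIn t On w With v = ∃[ c ] (initial w ⟶[ t ] c) × step c ≡ nothing × result c ≡ v

------------------------------------------------------------------------
-- Decision problems and polynomial-time many-one reductions

record Problem : Set₁ where
  field
    Symbol       : Set
    symbolFinite : Finite Symbol
    Instance     : Set
    word         : Instance → List Symbol
    Yes          : Instance → Set
open Problem public

infix 4 _≤ₚ_ _≡ₚ_

record _≤ₚ_ (P Q : Problem) : Set₁ where
  field
    reduce   : Instance P → Instance Q
    correct  : ∀ x → Yes P x ⇔ Yes Q (reduce x)
    machine  : Machine (Symbol P) (Symbol Q)
    c k      : ℕ
    computes : ∀ x → ∃[ t ] t ≤ c * length (word P x) ^ k + c ×
                 Run.HaltsIn_On_With_ machine t (word P x) (word Q (reduce x))

_≡ₚ_ : Problem → Problem → Set₁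
P ≡ₚ Q = P ≤ₚ Q × Q ≤ₚ P

Hyper²LTL-SAT : ℕ → Problem
Hyper²LTL-SAT n = record
  { Symbol       = Token
  ; symbolFinite = tokens , ∈-tokens
  ; Instance     = Sentence
  ; word         = encode ∘ proj₁
  ; Yes          = Satisfiable
  } where open Hyper n

XaFree-Hyper²LTL-SAT : ℕ → Problem
XaFree-Hyper²LTL-SAT n = record
  { Symbol       = Token
  ; symbolFinite = tokens , ∈-tokens
  ; Instance     = Σ Sentence (XaFree ∘ proj₁)
  ; word         = encode ∘ proj₁ ∘ proj₁
  ; Yes          = Satisfiable ∘ proj₁
  } where open Hyper n

ThirdOrderTruth : Problem
ThirdOrderTruth = record
  { Symbol       = Token
  ; symbolFinite = tokens , ∈-tokens
  ; Instance     = Sentence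
  ; word         = encode ∘ proj₁
  ; Yes          = True
  } where open Arithmetic

{-# OPTIONS --safe #-}

-- Upper bound: a trace t is coded by the set of the numbers p + i n with
-- p ∈ t(i), so that sets of traces become sets of sets of numbers, and the
-- temporal operators are expressed through a variable for the current position.
--
-- Lower bound: sets of numbers are traces, sets of sets of numbers are sets of
-- traces, and numbers are the elements of a distinguished set of traces.  Such a
-- trace has five tracks, all of them singletons, with the values a, b, r, ab + r
-- and a + b + ab + r.  Sums and products are read off the fourth track.  A
-- quantifier-free formula forces the set to consist of exactly these tuples: it
-- contains the zero tuple and is closed under r ↦ r + 1, (a , b , b) ↦
-- (a + 1 , b , 0) and (0 , b , 0) ↦ (0 , b + 1 , 0), all of which increase the
-- last component by 1 and act locally on the others, and every other element
-- has a predecessor under one of these steps.  Since Hyper²LTL formulas are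
-- prenex, all quantifiers of an arithmetic formula, and one for the value of
-- every subterm, are pulled to the front, with variables named by paths in the
-- syntax tree.  That such a prefix is correct is shown by a strategy in the
-- evaluation game; a strategy for the negated prefix yields the converse.
--
-- Both translations print, for every node of a syntax tree, a constant number of
-- tokens, names and paths, so a three-tape machine with the input, a stack for
-- the path to the current node, and the output computes them in cubic time.
module Submission where

open import Defs
open import Axiom.ExcludedMiddle using (ExcludedMiddle)
open import Data.Bool using (Bool; true; false; not; if_then_else_)
open import Data.Bool.Properties as Bool using (⇔→≡)
open import Data.Empty using (⊥; ⊥-elim)
open import Data.Fin using (Fin; toℕ; fromℕ<)
open import Data.Fin.Properties using (toℕ<n; toℕ-fromℕ<; toℕ-injective)
open import Data.Fin.Subset using () renaming (_∈_ to _∈ₛ_)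
open import Data.List as List using (List; []; _∷_; _++_; map; length; concatMap; _ʳ++_; reverse)
open import Data.List.Membership.Propositional using (_∈_)
open import Data.List.Membership.Propositional.Properties using (∈-map⁺; ∈-++⁺ˡ; ∈-++⁺ʳ; ∈-concat⁺′)
open import Data.List.Properties
  using (++-assoc; ++-cancelʳ; ++-identityʳ; ++-ʳ++; ʳ++-ʳ++; length-++; length-map; length-reverse;
         length-ʳ++; reverse-injective; reverse-involutive; ∷-injectiveʳ; ∷ʳ-injectiveʳ)
open import Data.List.Relation.Unary.All using (All; []; _∷_)
open import Data.List.Relation.Unary.All.Properties using (++⁺)
open import Data.List.Relation.Unary.Any using (here; there)
open import Data.Maybe as Maybe using (Maybe; just; nothing)
open import Data.Maybe.Relation.Unary.Any using (Any; just)
open import Data.Nat hiding (equal; less; pred; compare)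
open import Data.Nat.DivMod using (_mod_; m≡m%n+[m/n]*n; [m+kn]%n≡m%n; m<n⇒m%n≡m; m<n⇒m/n≡0; m*n/n≡m; +-distrib-/-∣ʳ)
open import Data.Nat.Divisibility using (divides-refl)
open import Data.Nat.ListAction using (sum)
open import Data.Nat.Properties
open import Data.Nat.Tactic.RingSolver using (solve-∀)
open import Data.Product using (Σ; ∃-syntax; _×_; _,_; proj₁; proj₂)
open import Data.Sum using (_⊎_; inj₁; inj₂)
open import Data.Unit using (⊤; tt)
open import Data.Vec as Vec using (Vec; []; _∷_; lookup; tabulate; replicate)
open import Data.Vec.Properties
  using (lookup∘tabulate; tabulate∘lookup; tabulate-cong; lookup-replicate; []=⇒lookup; lookup⇒[]=)
open import Function using (_∘_; id; const; _⇔_; mk⇔; Equivalence; Func)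
open import Function.Properties.Equivalence using () renaming (refl to ⇔-refl; sym to ⇔-sym; trans to ⇔-trans)
open import Level using (0ℓ)
open import Relation.Binary.Definitions using (DecidableEquality; tri<; tri≈; tri>)
open import Relation.Binary.PropositionalEquality
open import Relation.Nullary using (¬_; Dec; yes; no; does; contradiction)
open import Relation.Nullary.Decidable using (dec-true; dec-false; decidable-stable)

-- The obstacle is the prenex form. The matrix is reached only after all quantifiers, so `lawful`,
-- the check that the distinguished set is as intended, cannot guard the quantifiers of the
-- arithmetic formula: these are played before anything is known about the set. Strategies are
-- therefore relative to a hypothesis `G`. Under `G` their outcome is correct; without it they only
-- need a legal move at every turn, so the sets quantified over must be nonempty, which is also why
-- classes are coded with filler traces. Duality is then used twice: with `G` empty it forces
-- `lawful`, a conjunct of the matrix about header variables only; with `G` true it forces the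
-- formula. The last track is a rank: a predecessor has rank one less, so following predecessors
-- ends in the zero tuple, and no foreign element can survive. Carrying at r = b leaves ab + r
-- unchanged, which turns local steps into a multiplication table. The matrix of a term states an
-- error instead of correctness. Hence one matrix fits both polarities, and only the quantifiers
-- change.

module A = Arithmetic
open A using (Sort; number; set; class; Valuation; num; st; cls; ⟦_⟧; _[_,_↦_])
open Equivalence using () renaming (to to fwd; from to bwd)

-- Finite types and bounds on running times

fin-⊎ : ∀ {A B : Set} → Finite A → Finite B → Finite (A ⊎ B)
fin-⊎ {A} {B} (xs , f) (ys , g) = map inj₁ xs ++ map inj₂ ys , mem
  where
  mem : (c : A ⊎ B) → c ∈ map inj₁ xs ++ map inj₂ ys
  mem (inj₁ a) = ∈-++⁺ˡ (∈-map⁺ inj₁ (f a))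
  mem (inj₂ b) = ∈-++⁺ʳ (map inj₁ xs) (∈-map⁺ inj₂ (g b))

fin-Σ : ∀ {A : Set} {B : A → Set} → Finite A → (∀ a → Finite (B a)) → Finite (Σ A B)
fin-Σ {A} {B} (xs , f) ys = concatMap sec xs , λ (a , b) → ∈-concat⁺′ (∈-map⁺ (a ,_) (proj₂ (ys a) b)) (∈-map⁺ sec (f a))
  where
  sec : (a : A) → List (Σ A B)
  sec a = map (a ,_) (proj₁ (ys a))

fin-onto : ∀ {A B : Set} (f : A → B) (g : B → A) → (∀ b → f (g b) ≡ b) → Finite A → Finite B
fin-onto f g fg (xs , m) = map f xs , λ b → subst (_∈ map f xs) (fg b) (∈-map⁺ f (m (g b)))

fin-⊤ : Finite ⊤
fin-⊤ = tt ∷ [] , λ _ → here refl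

fin-Bool : Finite Bool
fin-Bool = true ∷ false ∷ [] , λ { true → here refl ; false → there (here refl) }

fin-Sort : Finite Sort
fin-Sort = number ∷ set ∷ class ∷ []
         , λ { number → here refl ; set → there (here refl) ; class → there (there (here refl)) }

_≟ₛ_ : DecidableEquality Sort
number ≟ₛ number = yes refl
number ≟ₛ set    = no λ ()
number ≟ₛ class  = no λ ()
set    ≟ₛ number = no λ ()
set    ≟ₛ set    = yes refl
set    ≟ₛ class  = no λ ()
class  ≟ₛ number = no λ ()
class  ≟ₛ set    = no λ ()
class  ≟ₛ class  = yes refl

-- An inequality between polynomials is proved by naming the slack `k`, which leaves an identity for
-- the ring solver. The explicit polynomials in the cost bounds are such slacks.
≤-by : ∀ {m n} k → m + k ≡ n → m ≤ n
≤-by {m} k refl = m≤m+n m k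

abstract
  descend-cost : ∀ s m → suc (2 * s + suc m + 2) + 0 ≡ 2 * suc s + m + 2
  descend-cost = solve-∀

  match-cost : ∀ d → suc (suc d) + 1 ≡ d + 3
  match-cost = solve-∀

  surplus-cost : ∀ d y → suc (suc d + suc (suc y)) + 0 ≡ suc y + d + 3
  surplus-cost = solve-∀

  short-cost : ∀ d x → suc (suc d + 1) + suc x ≡ suc x + 0 + d + 3
  short-cost = solve-∀

  agree-cost : ∀ d x y → suc (x + y + suc d + 3) + 0 ≡ suc x + suc y + d + 3
  agree-cost = solve-∀

  differ-cost : ∀ d x y → suc (suc d + suc (suc y)) + suc x ≡ suc x + suc y + d + 3
  differ-cost = solve-∀

  frame-cost : ∀ x l m → suc (l * (x + 7) + suc m + 2) + (x + 5) ≡ suc l * (x + 7) + m + 2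
  frame-cost = solve-∀

  copy-cost : ∀ x → suc x + suc x + 0 ≡ 2 * x + 2
  copy-cost = solve-∀

  match-eq : ∀ x l m → suc (x + x + 0 + 3 + (2 * l + suc (x + suc m) + 2)) + (x + 8 + x * x + 5 * x + l * x + 5 * l)
                 ≡ suc (suc (x + l)) * (x + 7) + m + 2
  match-eq = solve-∀

  mismatch-eq : ∀ x y l m → suc (x + y + 0 + 3 + (l * (x + 7) + suc (y + suc m) + 2)) + (x + 8 + x * y + 5 * y)
                   ≡ suc (suc (y + l)) * (x + 7) + m + 2
  mismatch-eq = solve-∀

  other-eq : ∀ x y l m → suc (suc y + (l * (x + 7) + suc (y + suc m) + 2)) + (2 * x + 10 + x * y + 5 * y)
                   ≡ suc (suc (y + l)) * (x + 7) + m + 2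
  other-eq = solve-∀

abstract
  rearrange : ∀ a b c → suc (suc (a + (b + suc (suc (suc c))))) ≡ a + b + c + 5
  rearrange = solve-∀

  final-cost : ∀ m n s → (m * (s + (n + 4)) + s + (m * (s + (n + 4)) + (s + (n + 4))) + 5) + (2 * n + 3 + s) ≡ (2 * m + 3) * (s + (n + 4))
  final-cost = solve-∀

  size-cost : ∀ n → n + (64 + 15 * n + n * n) ≡ (n + 8) * (n + 8)
  size-cost = solve-∀

  emit-cost : ∀ n → 1 + (63 + 16 * n + n * n) ≡ (n + 8) * (n + 8)
  emit-cost = solve-∀

  path-cost : ∀ n → suc (2 * n + 0 + 2) + (61 + 14 * n + n * n) ≡ (n + 8) * (n + 8)
  path-cost = solve-∀

  res-cost : ∀ n → suc (n * (n + 7) + 0 + 2) + (61 + 9 * n) ≡ (n + 8) * (n + 8)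
  res-cost = solve-∀

  name-cost : ∀ n → suc (2 * n + 2) + (61 + 14 * n + n * n) ≡ (n + 8) * (n + 8)
  name-cost = solve-∀

resolve-match-cost : ∀ {x l m a b c} → a ≡ x → b ≡ suc (x + l) → c ≡ x + suc m →
  suc (a + a + 0 + 3 + (2 * l + suc c + 2)) ≤ suc b * (x + 7) + m + 2
resolve-match-cost {x} {l} {m} refl refl refl = ≤-by (x + 8 + x * x + 5 * x + l * x + 5 * l) (match-eq x l m)

resolve-mismatch-cost : ∀ {x y l m a b c d} → a ≡ x → b ≡ y → c ≡ suc (y + l) → d ≡ y + suc m →
  suc (a + b + 0 + 3 + (l * (x + 7) + suc d + 2)) ≤ suc c * (x + 7) + m + 2
resolve-mismatch-cost {x} {y} {l} {m} refl refl refl refl = ≤-by (x + 8 + x * y + 5 * y) (mismatch-eq x y l m)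

resolve-other-cost : ∀ {x y l m a b c} → a ≡ y → b ≡ suc (y + l) → c ≡ y + suc m →
  suc (suc a + (l * (x + 7) + suc c + 2)) ≤ suc b * (x + 7) + m + 2
resolve-other-cost {x} {y} {l} {m} refl refl refl = ≤-by (2 * x + 10 + x * y + 5 * y) (other-eq x y l m)

abstract
  cubic-eq : ∀ s a n → (2 * a + 19) * n * (s * (9 * n * (9 * n)) + 5 * n * n) ≡ (2 * a + 19) * (81 * s + 5) * (n * (n * (n * 1)))
  cubic-eq = solve-∀

  left-eq : ∀ a n → 2 * (8 * n + a * n) + 3 * n ≡ (2 * a + 19) * n
  left-eq = solve-∀

-- The left side is the number of control steps, linear in `n`, times the cost of one, quadratic in
-- `n`. For positive `n` the constants are absorbed by n + 8 ≤ 9n and n + 4 ≤ 5n²; for `n` zero the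
-- additive constant on the right does the work.
cubic : ∀ s a n → (2 * (8 * n + a) + 3) * (s * ((n + 8) * (n + 8)) + (n + 4))
      ≤ (2 * a + 19) * (81 * s + 5) * n ^ 3 + (2 * a + 19) * (81 * s + 5)
cubic s a zero = ≤-trans (*-mono-≤ (+-monoʳ-≤ (2 * a) {3} {19} (s≤s (s≤s (s≤s z≤n))))
    (≤-trans (≤-reflexive (cong (_+ 4) (*-comm s 64))) (+-mono-≤ (*-monoˡ-≤ s (64≤81)) (n≤1+n 4))))
  (m≤n+m _ ((2 * a + 19) * (81 * s + 5) * 0))
  where
  64≤81 : 64 ≤ 81
  64≤81 = m≤m+n 64 17
cubic s a n@(suc n′) = ≤-trans (*-mono-≤ linear (+-mono-≤ (*-monoʳ-≤ s (*-mono-≤ n+8 n+8)) n+4))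
  (≤-trans (≤-reflexive (cubic-eq s a n)) (m≤m+n _ _))
  where
  n+8 : n + 8 ≤ 9 * n
  n+8 = ≤-trans (+-monoʳ-≤ n (m≤m*n 8 n)) (≤-reflexive refl)
  n+4 : n + 4 ≤ 5 * n * n
  n+4 = ≤-trans (+-monoʳ-≤ n (m≤m*n 4 n)) (m≤m*n (5 * n) n)
  linear : 2 * (8 * n + a) + 3 ≤ (2 * a + 19) * n
  linear = ≤-trans (+-mono-≤ (*-monoʳ-≤ 2 (+-monoʳ-≤ (8 * n) (m≤m*n a n))) (m≤m*n 3 n)) (≤-reflexive (left-eq a n))

-- A three-tape machine driven by scripts

-- The program counter of a script, with one position for its end. It is part of the state of the
-- machine and so has to range over a finite type.
data Pos {A : Set} : List A → Set where
  here  : ∀ {xs} → Pos xs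
  there : ∀ {x xs} → Pos xs → Pos (x ∷ xs)

module _ {A : Set} where

  at : {xs : List A} → Pos xs → Maybe (A × Pos xs)
  at {[]}     here      = nothing
  at {x ∷ xs} here      = just (x , there here)
  at          (there p) = Maybe.map (λ (x , q) → x , there q) (at p)

  rest : {xs : List A} → Pos xs → List A
  rest {xs} here      = xs
  rest      (there p) = rest p

  at-[] : {xs : List A} (p : Pos xs) → rest p ≡ [] → at p ≡ nothing
  at-[] {[]} here      eq = refl
  at-[]      (there p) eq rewrite at-[] p eq = refl

  at-∷ : {xs : List A} (p : Pos xs) {y : A} {ys : List A} → rest p ≡ y ∷ ys →
         ∃[ q ] at p ≡ just (y , q) × rest q ≡ ys
  at-∷ {_ ∷ _} here      refl = there here , refl , refl
  at-∷         (there p) eq   with at-∷ p eq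
  ... | q , e , r rewrite e = there q , refl , r

  fin-Pos : (xs : List A) → Finite (Pos xs)
  fin-Pos []       = here ∷ [] , λ { here → here refl }
  fin-Pos (x ∷ xs) = here ∷ map there (proj₁ (fin-Pos xs))
                   , λ { here → here refl ; (there p) → there (∈-map⁺ there (proj₂ (fin-Pos xs) p)) }

map-ʳ++-++ : ∀ {A B : Set} (f : A → B) xs {ys zs} →
             map f xs ʳ++ (map f ys ++ zs) ≡ map f (xs ʳ++ ys) ++ zs
map-ʳ++-++ f []       = refl
map-ʳ++-++ f (x ∷ xs) {ys} = map-ʳ++-++ f xs {x ∷ ys}

-- The stack holds the path from the root to the current node of the syntax
-- tree: cL for a first of two children (with the polarity and the sort to be
-- resumed at the second one), cR for a last child, and cB with the name of the
-- bound variable, between cB and cdl, for the body of a quantifier.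
data StackCell : Set where
  cL   : Bool → Sort → StackCell
  cR   : StackCell
  cB   : Sort → StackCell
  cbit : Bool → StackCell
  cdl  : StackCell

-- `bot` and `top` delimit the stack: a walk down to read the path ends at the one and finds its way
-- back by the other.
data Work : Set where
  top bot : Work
  sc      : StackCell → Work

-- path stands for the path on the stack, as a string of bits; name for the
-- name that starts at the head of the input tape; res s for the path of the
-- innermost binder of sort s whose variable is the name that ends at the head.
data Item (O : Set) : Set where
  emit : O → Item O
  path : Item O
  res  : Sort → Item O
  name : Item O

data StackOp : Set where
  keep pop  : StackOp
  swap push : StackCell → StackOp

data Action (K : Set) : Set where
  go     : (advance : Bool) → StackOp → K → Action K
  rewind : K → Action K

data Frame : Set where
  lf : Bool → Sort → Frame
  rf : Frame
  bd : Sort → Name → Frame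

-- A name is pushed while it is read, so its last bit ends up on top. It is compared with a name on
-- the input from the last bits on, with the input head moving left and the stack head moving down.
cells : List Frame → List StackCell
cells []            = []
cells (lf b s ∷ fs) = cL b s ∷ cells fs
cells (rf ∷ fs)     = cR ∷ cells fs
cells (bd s x ∷ fs) = cB s ∷ map cbit (reverse x) ++ cdl ∷ cells fs

cellBit : StackCell → Maybe Bool
cellBit (cL _ _) = just false
cellBit cR       = just true
cellBit (cB _)   = just true
cellBit (cbit _) = nothing
cellBit cdl      = nothing

consMaybe : ∀ {A : Set} → Maybe A → List A → List A
consMaybe (just x) xs = x ∷ xs
consMaybe nothing  xs = xs

cellBits : List StackCell → List Bool
cellBits []       = []
cellBits (c ∷ cs) = consMaybe (cellBit c) (cellBits cs)

frameBit : Frame → Bool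
frameBit (lf _ _) = false
frameBit rf       = true
frameBit (bd _ _) = true

bits : List Frame → List Bool
bits = map frameBit

cellBits-cells : ∀ fs → cellBits (cells fs) ≡ bits fs
cellBits-cells []            = refl
cellBits-cells (lf _ _ ∷ fs) = cong (false ∷_) (cellBits-cells fs)
cellBits-cells (rf ∷ fs)     = cong (true ∷_) (cellBits-cells fs)
cellBits-cells (bd s x ∷ fs) = cong (true ∷_) (trans (skip (reverse x)) (cellBits-cells fs))
  where
  skip : ∀ y → cellBits (map cbit y ++ cdl ∷ cells fs) ≡ cellBits (cells fs)
  skip []      = refl
  skip (b ∷ y) = skip y

-- What lies below the innermost binder of `x` is the path to its quantifier node, and this path
-- names the chosen variable. The default `[]` for unbound variables does not arise for sentences.
look : Sort → Name → List Frame → List Frame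
look s x []            = []
look s x (lf _ _ ∷ fs) = look s x fs
look s x (rf ∷ fs)     = look s x fs
look s x (bd s′ y ∷ fs) with s ≟ₛ s′ | x ≟ⁿ y
... | yes _ | yes _ = fs
... | yes _ | no  _ = look s x fs
... | no  _ | _     = look s x fs

module Scripted
  {I O : Set} (inb : Bool → I) (ibit : I → Maybe Bool) (ibit-inb : ∀ b → ibit (inb b) ≡ just b)
  (obit : Bool → O) {K : Set} (K-finite : Finite K) (k₀ : K) (script : K → List (Item O))
  (decide : K → Maybe I → Maybe StackCell → Maybe (Action K)) where

  -- `down` and `up` print a path and return; `name₁` and `name₂` do the same for a name on the
  -- input. To resolve a name, `scan` looks for a binder of the right sort, `cmp` compares the
  -- names, and `back` restores the input head, after which a match continues with `down` and a
  -- mismatch with `scan`.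
  data Phase : Set where
    run down up name₁ name₂ : Phase
    scan cmp : Sort → Phase
    back : Bool → Sort → Phase

  data State : Set where
    init₀ init₁ flush halt : State
    on : (k : K) → Pos (script k) → Phase → State
    dec rew push₂ : K → State
    push₁ : StackCell → K → State

  Phase-finite : Finite Phase
  Phase-finite = fin-onto
    (λ { (inj₁ tt) → run ; (inj₂ (inj₁ tt)) → down ; (inj₂ (inj₂ (inj₁ tt))) → up
       ; (inj₂ (inj₂ (inj₂ (inj₁ tt)))) → name₁ ; (inj₂ (inj₂ (inj₂ (inj₂ (inj₁ tt))))) → name₂
       ; (inj₂ (inj₂ (inj₂ (inj₂ (inj₂ (inj₁ s)))))) → scan s
       ; (inj₂ (inj₂ (inj₂ (inj₂ (inj₂ (inj₂ (inj₁ s))))))) → cmp s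
       ; (inj₂ (inj₂ (inj₂ (inj₂ (inj₂ (inj₂ (inj₂ (b , s)))))))) → back b s })
    (λ { run → inj₁ tt ; down → inj₂ (inj₁ tt) ; up → inj₂ (inj₂ (inj₁ tt))
       ; name₁ → inj₂ (inj₂ (inj₂ (inj₁ tt))) ; name₂ → inj₂ (inj₂ (inj₂ (inj₂ (inj₁ tt))))
       ; (scan s) → inj₂ (inj₂ (inj₂ (inj₂ (inj₂ (inj₁ s)))))
       ; (cmp s) → inj₂ (inj₂ (inj₂ (inj₂ (inj₂ (inj₂ (inj₁ s))))))
       ; (back b s) → inj₂ (inj₂ (inj₂ (inj₂ (inj₂ (inj₂ (inj₂ (b , s))))))) })
    (λ { run → refl ; down → refl ; up → refl ; name₁ → refl ; name₂ → refl
       ; (scan s) → refl ; (cmp s) → refl ; (back b s) → refl })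
    (fin-⊎ fin-⊤ (fin-⊎ fin-⊤ (fin-⊎ fin-⊤ (fin-⊎ fin-⊤ (fin-⊎ fin-⊤
      (fin-⊎ fin-Sort (fin-⊎ fin-Sort (fin-Σ fin-Bool λ _ → fin-Sort))))))))

  Cell-finite : Finite StackCell
  Cell-finite = fin-onto
    (λ { (inj₁ (b , s)) → cL b s ; (inj₂ (inj₁ tt)) → cR ; (inj₂ (inj₂ (inj₁ s))) → cB s
       ; (inj₂ (inj₂ (inj₂ (inj₁ b)))) → cbit b ; (inj₂ (inj₂ (inj₂ (inj₂ tt)))) → cdl })
    (λ { (cL b s) → inj₁ (b , s) ; cR → inj₂ (inj₁ tt) ; (cB s) → inj₂ (inj₂ (inj₁ s))
       ; (cbit b) → inj₂ (inj₂ (inj₂ (inj₁ b))) ; cdl → inj₂ (inj₂ (inj₂ (inj₂ tt))) })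
    (λ { (cL b s) → refl ; cR → refl ; (cB s) → refl ; (cbit b) → refl ; cdl → refl })
    (fin-⊎ (fin-Σ fin-Bool λ _ → fin-Sort) (fin-⊎ fin-⊤ (fin-⊎ fin-Sort (fin-⊎ fin-Bool fin-⊤))))

  Work-finite : Finite Work
  Work-finite = fin-onto
    (λ { (inj₁ true) → top ; (inj₁ false) → bot ; (inj₂ c) → sc c })
    (λ { top → inj₁ true ; bot → inj₁ false ; (sc c) → inj₂ c })
    (λ { top → refl ; bot → refl ; (sc c) → refl })
    (fin-⊎ fin-Bool Cell-finite)

  State-finite : Finite State
  State-finite = fin-onto
    (λ { (inj₁ (true , true)) → init₀ ; (inj₁ (true , false)) → init₁
       ; (inj₁ (false , true)) → flush ; (inj₁ (false , false)) → halt
       ; (inj₂ (inj₁ (k , q , p))) → on k q p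
       ; (inj₂ (inj₂ (inj₁ k))) → dec k ; (inj₂ (inj₂ (inj₂ (inj₁ k)))) → rew k
       ; (inj₂ (inj₂ (inj₂ (inj₂ (inj₁ k))))) → push₂ k
       ; (inj₂ (inj₂ (inj₂ (inj₂ (inj₂ (c , k)))))) → push₁ c k })
    (λ { init₀ → inj₁ (true , true) ; init₁ → inj₁ (true , false)
       ; flush → inj₁ (false , true) ; halt → inj₁ (false , false)
       ; (on k q p) → inj₂ (inj₁ (k , q , p))
       ; (dec k) → inj₂ (inj₂ (inj₁ k)) ; (rew k) → inj₂ (inj₂ (inj₂ (inj₁ k)))
       ; (push₂ k) → inj₂ (inj₂ (inj₂ (inj₂ (inj₁ k))))
       ; (push₁ c k) → inj₂ (inj₂ (inj₂ (inj₂ (inj₂ (c , k))))) })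
    (λ { init₀ → refl ; init₁ → refl ; flush → refl ; halt → refl ; (on k q p) → refl
       ; (dec k) → refl ; (rew k) → refl ; (push₂ k) → refl ; (push₁ c k) → refl })
    (fin-⊎ (fin-Σ fin-Bool λ _ → fin-Bool)
    (fin-⊎ (fin-Σ K-finite λ k → fin-Σ (fin-Pos (script k)) λ _ → Phase-finite)
    (fin-⊎ K-finite (fin-⊎ K-finite (fin-⊎ K-finite (fin-Σ Cell-finite λ _ → K-finite))))))

  Γ′ : Set
  Γ′ = Cell I O Work

  Actions : Set
  Actions = Maybe (State × Vec (Γ′ × Move) 3)

  to : State → Γ′ × Move → Γ′ × Move → Γ′ × Move → Actions
  to s a b o = just (s , a ∷ b ∷ o ∷ [])

  bitAt : Γ′ → Maybe Bool
  bitAt (input i) = ibit i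
  bitAt _         = nothing

  inputAt : Γ′ → Maybe I
  inputAt (input i) = just i
  inputAt _         = nothing

  cellAt : Γ′ → Maybe StackCell
  cellAt (work (sc c)) = just c
  cellAt _             = nothing

  data Verdict : Set where
    continue match mismatch : Verdict

  verdict : Maybe Bool → Γ′ → Verdict
  verdict (just x) (work (sc (cbit y))) = if does (x Bool.≟ y) then continue else mismatch
  verdict nothing  (work (sc cdl))      = match
  verdict _        _                    = mismatch

  δ-run : (k : K) → Pos (script k) → Maybe (Item O × Pos (script k)) → (a b o : Γ′) → Actions
  δ-run k q (just (emit x , q′)) a b o = to (on k q′ run)      (a , stay) (b , stay) (output x , right)
  δ-run k q (just (path   , q′)) a b o = to (on k q′ down)     (a , stay) (b , left) (o , stay)
  δ-run k q (just (res s  , q′)) a b o = to (on k q′ (scan s)) (a , stay) (b , left) (o , stay)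
  δ-run k q (just (name   , q′)) a b o = to (on k q′ name₁)    (a , stay) (b , stay) (o , stay)
  δ-run k q nothing              a b o = to (dec k)            (a , stay) (b , left) (o , stay)

  δ-print : State → Maybe Bool → (a b : Γ′ × Move) (o : Γ′) → Actions
  δ-print s (just x) a b o = to s a b (output (obit x) , right)
  δ-print s nothing  a b o = to s a b (o , stay)

  δ-cmp : (k : K) → Pos (script k) → Sort → Verdict → (a b o : Γ′) → Actions
  δ-cmp k q s continue a b o = to (on k q (cmp s))        (a , left)  (b , left) (o , stay)
  -- The stack head steps below the delimiter of the matched binder, so that `down` prints precisely
  -- the path to that binder.
  δ-cmp k q s match    a b o = to (on k q (back true s))  (a , right) (b , left) (o , stay)
  δ-cmp k q s mismatch a b o = to (on k q (back false s)) (a , right) (b , stay) (o , stay)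

  δ-back : (k : K) → Pos (script k) → Bool → Sort → Maybe Bool → (a b o : Γ′) → Actions
  δ-back k q m     s (just _) a b o = to (on k q (back m s)) (a , right) (b , stay) (o , stay)
  δ-back k q true  s nothing  a b o = to (on k q down)       (a , stay)  (b , stay) (o , stay)
  δ-back k q false s nothing  a b o = to (on k q (scan s))   (a , stay)  (b , stay) (o , stay)

  δ-name₁ : (k : K) → Pos (script k) → Maybe Bool → (a b o : Γ′) → Actions
  δ-name₁ k q (just x) a b o = to (on k q name₁) (a , right) (b , stay) (output (obit x) , right)
  δ-name₁ k q nothing  a b o = to (on k q name₂) (a , left)  (b , stay) (o , stay)

  δ-name₂ : (k : K) → Pos (script k) → Maybe Bool → (a b o : Γ′) → Actions
  δ-name₂ k q (just x) a b o = to (on k q name₂) (a , left)  (b , stay) (o , stay)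
  δ-name₂ k q nothing  a b o = to (on k q run)   (a , right) (b , stay) (o , stay)

  δ-dec : Maybe (Action K) → (a b o : Γ′) → Actions
  δ-dec nothing                    a b o = to flush         (a , stay) (b , stay)             (o , left)
  δ-dec (just (rewind k))          a b o = to (rew k)       (a , left) (b , right)            (o , stay)
  δ-dec (just (go m keep k))       a b o = to (on k here run) (a , (if m then right else stay)) (b , right) (o , stay)
  -- The popped cell becomes the new end marker; the old marker stays above it as garbage.
  δ-dec (just (go m pop k))        a b o = to (on k here run) (a , (if m then right else stay)) (work top , stay) (o , stay)
  δ-dec (just (go m (swap c) k))   a b o = to (on k here run) (a , (if m then right else stay)) (work (sc c) , right) (o , stay)
  δ-dec (just (go m (push c) k))   a b o = to (push₁ c k)   (a , (if m then right else stay)) (b , right) (o , stay)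

  δ-on : (k : K) → Pos (script k) → Phase → (a b o : Γ′) → Actions
  δ-on k q run   a b o = δ-run k q (at q) a b o
  δ-on k q down a (work (sc c)) o = δ-print (on k q down) (cellBit c) (a , stay) (work (sc c) , left) o
  δ-on k q down a b o = to (on k q up) (a , stay) (b , right) (o , stay)
  δ-on k q up a (work top) o = to (on k q run) (a , stay) (work top , stay) (o , stay)
  δ-on k q up a b o = to (on k q up) (a , stay) (b , right) (o , stay)
  δ-on k q name₁ a b o = δ-name₁ k q (bitAt a) a b o
  δ-on k q name₂ a b o = δ-name₂ k q (bitAt a) a b o
  δ-on k q (scan s) a (work (sc (cB s′))) o =
    if does (s ≟ₛ s′) then to (on k q (cmp s)) (a , left) (work (sc (cB s′)) , left) (o , stay)
                      else to (on k q (scan s)) (a , stay) (work (sc (cB s′)) , left) (o , stay)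
  δ-on k q (scan s) a (work bot) o = to (on k q up) (a , stay) (work bot , right) (o , stay)
  δ-on k q (scan s) a b o = to (on k q (scan s)) (a , stay) (b , left) (o , stay)
  δ-on k q (cmp s) a b o = δ-cmp k q s (verdict (bitAt a) b) a b o
  δ-on k q (back m s) a b o = δ-back k q m s (bitAt a) a b o

  δ : State → Vec Γ′ 3 → Actions
  δ init₀ (a ∷ b ∷ o ∷ []) = to init₁ (a , stay) (work bot , right) (o , stay)
  δ init₁ (a ∷ b ∷ o ∷ []) = to (on k₀ here run) (a , stay) (work top , stay) (o , stay)
  -- The result is read off the first tape, so the output is finally copied there from right to
  -- left, over the input.
  δ flush (a ∷ b ∷ output x ∷ []) = to flush (output x , left) (b , stay) (output x , left)
  δ flush (a ∷ b ∷ o ∷ []) = to halt (a , right) (b , stay) (o , stay)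
  δ halt _ = nothing
  δ (on k q p) (a ∷ b ∷ o ∷ []) = δ-on k q p a b o
  δ (dec k) (a ∷ b ∷ o ∷ []) = δ-dec (decide k (inputAt a) (cellAt b)) a b o
  δ (rew k) (input i ∷ b ∷ o ∷ []) = to (rew k) (input i , left) (b , stay) (o , stay)
  δ (rew k) (a ∷ b ∷ o ∷ []) = to (on k here run) (a , right) (b , stay) (o , stay)
  δ (push₁ c k) (a ∷ b ∷ o ∷ []) = to (push₂ k) (a , stay) (work (sc c) , right) (o , stay)
  δ (push₂ k) (a ∷ b ∷ o ∷ []) = to (on k here run) (a , stay) (work top , stay) (o , stay)

  machine : Machine I O
  machine = record
    { State = State ; stateFinite = State-finite ; Work = Work ; workFinite = Work-finite
    ; extraTapes = 2 ; start = init₀ ; δ = δ }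

  open Run machine using (Config; step; focus; writeMove; _⟶[_]_; next; readout; result; HaltsIn_On_With_) renaming (initial to initialConfig; done to finished)

  -- Runs of the single phases

  infix 4 _⟶≤[_]_

  _⟶≤[_]_ : Config → ℕ → Config → Set
  c ⟶≤[ n ] c′ = ∃[ t ] t ≤ n × (c ⟶[ t ] c′)

  stop : ∀ {c n} → c ⟶≤[ n ] c
  stop = 0 , z≤n , finished

  _◂_ : ∀ {c c′ c″ n} → step c ≡ just c′ → c′ ⟶≤[ n ] c″ → c ⟶≤[ suc n ] c″
  e ◂ (t , t≤n , r) = suc t , s≤s t≤n , next e r

  infixr 5 _◂_ _▸_

  _▸_ : ∀ {c c′ c″ m n} → c ⟶≤[ m ] c′ → c′ ⟶≤[ n ] c″ → c ⟶≤[ m + n ] c″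
  (_ , p , r) ▸ (_ , q , s) = _ , +-mono-≤ p q , append r s
    where
    append : ∀ {c c′ c″ m n} → c ⟶[ m ] c′ → c′ ⟶[ n ] c″ → c ⟶[ m + n ] c″
    append finished   s = s
    append (next e r) s = next e (append r s)

  within : ∀ {c c′ m n} → m ≤ n → c ⟶≤[ m ] c′ → c ⟶≤[ n ] c′
  within m≤n (t , t≤m , r) = t , ≤-trans t≤m m≤n , r

  ending : ∀ {c c′ c″ n} → c′ ≡ c″ → c ⟶≤[ n ] c′ → c ⟶≤[ n ] c″
  ending refl r = r

  begins : ∀ {c c′ c″ n} → c ≡ c′ → c′ ⟶≤[ n ] c″ → c ⟶≤[ n ] c″
  begins refl r = r

  cfg : State → Tape Γ′ → Tape Γ′ → List O → Config
  cfg s a b out = s , a ∷ b ∷ tape (map output out) blank [] ∷ []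

  wk : StackCell → Γ′
  wk c = work (sc c)

  inputs : List I → List Γ′
  inputs = map input

  floor : List StackCell → List Γ′
  floor st = map wk st ++ work bot ∷ []

  ceiling : List StackCell → List Γ′ → List Γ′
  ceiling ms g = map wk ms ++ work top ∷ g

  onto : List Γ′ → List Γ′ → Tape Γ′
  onto []       r = tape [] blank r
  onto (c ∷ cs) r = tape cs c r

  move-left : ∀ c ls h r → writeMove (c , left) (tape ls h r) ≡ onto ls (c ∷ r)
  move-left c []      h r = refl
  move-left c (_ ∷ _) h r = refl

  stackTape : List StackCell → List Γ′ → Tape Γ′
  stackTape st g = tape (floor st) (work top) g

  inTape : List Γ′ → List Γ′ → List I → List I → Tape Γ′
  inTape base tail ls rs = focus (inputs ls ++ base) (inputs rs ++ tail)

  module _ {k : K} {q : Pos (script k)} where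

    ascend : ∀ a st ms g out →
      cfg (on k q up) a (focus (floor st) (ceiling ms g)) out ⟶≤[ suc (length ms) ]
      cfg (on k q run) a (stackTape (ms ʳ++ st) g) out
    ascend a st []       g out = refl ◂ stop
    ascend a st (m ∷ ms) g out = refl ◂ ascend a (m ∷ st) ms g out

    step-down : ∀ c a st r out →
      step (cfg (on k q down) a (tape (floor st) (wk c) r) out) ≡
      just (cfg (on k q down) a (onto (floor st) (wk c ∷ r)) (map obit (consMaybe (cellBit c) []) ++ out))
    step-down (cL _ _) a []      r out = refl
    step-down (cL _ _) a (_ ∷ _) r out = refl
    step-down cR       a []      r out = refl
    step-down cR       a (_ ∷ _) r out = refl
    step-down (cB _)   a []      r out = refl
    step-down (cB _)   a (_ ∷ _) r out = refl
    step-down (cbit _) a []      r out = refl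
    step-down (cbit _) a (_ ∷ _) r out = refl
    step-down cdl      a []      r out = refl
    step-down cdl      a (_ ∷ _) r out = refl

    -- The cells of `st` are crossed twice, on the way down and on the way up; those of `ms`, which
    -- were passed before, are crossed only on the way up.
    descend : ∀ a st ms g out →
      cfg (on k q down) a (onto (floor st) (ceiling ms g)) out ⟶≤[ 2 * length st + length ms + 2 ]
      cfg (on k q run) a (stackTape (ms ʳ++ st) g) (map obit (cellBits st) ʳ++ out)
    descend a []       ms g out = within (≤-reflexive (+-comm 2 (length ms))) (refl ◂ ascend a [] ms g out)
    descend a (c ∷ st) ms g out = within (≤-by 0 (descend-cost (length st) (length ms)))
      (step-down c a st (ceiling ms g) out ◂ ending (cong (cfg _ a _) (fix (cellBit c)))
        (descend a st (c ∷ ms) g (map obit (consMaybe (cellBit c) []) ++ out)))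
      where
      fix : ∀ b → map obit (cellBits st) ʳ++ (map obit (consMaybe b []) ++ out) ≡ map obit (consMaybe b (cellBits st)) ʳ++ out
      fix (just _) = refl
      fix nothing  = refl

    after : Bool → Sort → Phase
    after true  s = down
    after false s = scan s

    step-back : ∀ m s L i d R b out → ibit i ≡ just d →
      step (cfg (on k q (back m s)) (tape L (input i) R) b out) ≡
      just (cfg (on k q (back m s)) (focus (input i ∷ L) R) b out)
    step-back m s L i d R b out eq rewrite eq = refl

    step-returned : ∀ m s L i R b out → ibit i ≡ nothing →
      step (cfg (on k q (back m s)) (tape L (input i) R) b out) ≡
      just (cfg (on k q (after m s)) (tape L (input i) R) b out)
    step-returned true  s L i R b out eq rewrite eq = refl
    step-returned false s L i R b out eq rewrite eq = refl

    return : ∀ m s L xs {E} R b out → ibit E ≡ nothing →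
      cfg (on k q (back m s)) (focus L (map (input ∘ inb) xs ++ input E ∷ R)) b out ⟶≤[ suc (length xs) ]
      cfg (on k q (after m s)) (tape (map (input ∘ inb) xs ʳ++ L) (input E) R) b out
    return m s L []       R b out nb = step-returned m s L _ R b out nb ◂ stop
    return m s L (x ∷ xs) R b out nb =
      step-back m s L (inb x) x _ b out (ibit-inb x) ◂ return m s (input (inb x) ∷ L) xs R b out nb

    skip : ∀ s a ys st ms g out →
      cfg (on k q (scan s)) a (onto (floor (map cbit ys ++ cdl ∷ st)) (ceiling ms g)) out ⟶≤[ suc (length ys) ]
      cfg (on k q (scan s)) a (onto (floor st) (ceiling (cdl ∷ (map cbit ys ʳ++ ms)) g)) out
    skip s a []       st ms g out =
      cong (λ t → just (cfg _ a t out)) (move-left _ (floor st) _ _) ◂ stop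
    skip s a (y ∷ ys) st ms g out =
      cong (λ t → just (cfg _ a t out)) (move-left _ (floor (map cbit ys ++ cdl ∷ st)) _ _)
        ◂ skip s a ys st (cbit y ∷ ms) g out

    equal : List Bool → List Bool → Bool
    equal []       []       = true
    equal []       (_ ∷ _)  = false
    equal (_ ∷ _)  []       = false
    equal (x ∷ xs) (y ∷ ys) = if does (x Bool.≟ y) then equal xs ys else false

    module _ (s : Sort) {T E : I} (T-end : ibit T ≡ nothing) (E-end : ibit E ≡ nothing)
             (ls : List I) (base rs : List Γ′) where

      leftOf : List Bool → List Γ′
      leftOf xs = inputs (map inb xs ++ T ∷ ls) ++ base

      rightOf : List Bool → List Γ′
      rightOf xs = map (input ∘ inb) xs ++ input E ∷ rs

      restored : List Bool → Tape Γ′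
      restored xs = tape (leftOf xs) (input E) rs

      leftOf-ʳ++ : ∀ xs ys → map (input ∘ inb) xs ʳ++ leftOf ys ≡ leftOf (xs ʳ++ ys)
      leftOf-ʳ++ []       ys = refl
      leftOf-ʳ++ (x ∷ xs) ys = leftOf-ʳ++ xs (x ∷ ys)

      goBack : ∀ m xs ys b out →
        cfg (on k q (back m s)) (focus (leftOf ys) (rightOf xs)) b out ⟶≤[ suc (length xs) ]
        cfg (on k q (after m s)) (restored (xs ʳ++ ys)) b out
      goBack m xs ys b out = ending (cong (λ l → cfg _ (tape l _ _) b out) (leftOf-ʳ++ xs ys))
        (return m s (leftOf ys) xs rs b out E-end)

      step-match : ∀ R st r out →
        step (cfg (on k q (cmp s)) (onto (leftOf []) R) (tape (floor st) (wk cdl) r) out) ≡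
        just (cfg (on k q (back true s)) (focus (leftOf []) R) (onto (floor st) (wk cdl ∷ r)) out)
      step-match R []      r out rewrite T-end = refl
      step-match R (_ ∷ _) r out rewrite T-end = refl

      step-surplus : ∀ R y L r out →
        step (cfg (on k q (cmp s)) (onto (leftOf []) R) (tape L (wk (cbit y)) r) out) ≡
        just (cfg (on k q (back false s)) (focus (leftOf []) R) (tape L (wk (cbit y)) r) out)
      step-surplus R y L r out rewrite T-end = refl

      step-short : ∀ x xs R L r out →
        step (cfg (on k q (cmp s)) (onto (leftOf (x ∷ xs)) R) (tape L (wk cdl) r) out) ≡
        just (cfg (on k q (back false s)) (focus (leftOf (x ∷ xs)) R) (tape L (wk cdl) r) out)
      step-short x xs R L r out rewrite ibit-inb x = refl

      step-differ : ∀ x xs y R L r out → x ≢ y →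
        step (cfg (on k q (cmp s)) (onto (leftOf (x ∷ xs)) R) (tape L (wk (cbit y)) r) out) ≡
        just (cfg (on k q (back false s)) (focus (leftOf (x ∷ xs)) R) (tape L (wk (cbit y)) r) out)
      step-differ x xs y R L r out x≢y rewrite ibit-inb x | dec-false (x Bool.≟ y) x≢y = refl

      step-agree : ∀ x xs R L r out →
        step (cfg (on k q (cmp s)) (onto (leftOf (x ∷ xs)) R) (tape L (wk (cbit x)) r) out) ≡
        just (cfg (on k q (cmp s)) (onto (leftOf xs) (input (inb x) ∷ R)) (onto L (wk (cbit x) ∷ r)) out)
      step-agree x xs R L r out
        rewrite ibit-inb x | dec-true (x Bool.≟ x) refl
              | move-left (input (inb x)) (leftOf xs) (input (inb x)) R
              | move-left (wk (cbit x)) L (wk (cbit x)) r = refl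

      -- `done` collects the bits that have already agreed. They must be crossed again to bring the
      -- input head back to `E`, whereas the stack head never turns round: whatever the verdict, it
      -- ends below the whole name.
      compare : ∀ xs ys done st ms g out →
        cfg (on k q (cmp s)) (onto (leftOf xs) (rightOf done)) (onto (floor (map cbit ys ++ cdl ∷ st)) (ceiling ms g)) out
          ⟶≤[ length xs + length ys + length done + 3 ]
        cfg (on k q (after (equal xs ys) s)) (restored (done ʳ++ xs))
            (onto (floor st) (ceiling (cdl ∷ (map cbit ys ʳ++ ms)) g)) out
      compare [] [] done st ms g out = within (≤-by 1 (match-cost (length done)))
        (step-match _ st _ out ◂ goBack true done [] _ out)
      compare [] (y ∷ ys) done st ms g out = within (≤-by 0 (surplus-cost (length done) (length ys)))
        (step-surplus _ y _ _ out ◂ goBack false done [] _ out ▸ skip s _ (y ∷ ys) st ms g out)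
      compare (x ∷ xs) [] done st ms g out = within (≤-by (suc (length xs)) (short-cost (length done) (length xs)))
        (step-short x xs _ _ _ out ◂ goBack false done (x ∷ xs) _ out ▸ skip s _ [] st ms g out)
      compare (x ∷ xs) (y ∷ ys) done st ms g out with x Bool.≟ y
      ... | yes refl = within (≤-by 0 (agree-cost (length done) (length xs) (length ys)))
        (step-agree x xs _ _ _ out ◂ compare xs ys (x ∷ done) st (cbit x ∷ ms) g out)
      ... | no x≢y = within (≤-by (suc (length xs)) (differ-cost (length done) (length xs) (length ys)))
        (step-differ x xs y _ _ _ out x≢y ◂ goBack false done (x ∷ xs) _ out ▸ skip s _ (y ∷ ys) st ms g out)

      step-binder : ∀ x R ys st ms g out →
        step (cfg (on k q (scan s)) (tape (leftOf x) (input E) R)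
               (onto (wk (cB s) ∷ floor (map cbit ys ++ cdl ∷ st)) (ceiling ms g)) out) ≡
        just (cfg (on k q (cmp s)) (onto (leftOf x) (input E ∷ R))
               (onto (floor (map cbit ys ++ cdl ∷ st)) (ceiling (cB s ∷ ms) g)) out)
      step-binder x R ys st ms g out
        rewrite dec-true (s ≟ₛ s) refl
              | move-left (input E) (leftOf x) (input E) R
              | move-left (wk (cB s)) (floor (map cbit ys ++ cdl ∷ st)) (wk (cB s)) (ceiling ms g) = refl

      step-other : ∀ s′ a ys st ms g out → s ≢ s′ →
        step (cfg (on k q (scan s)) a
               (onto (wk (cB s′) ∷ floor (map cbit ys ++ cdl ∷ st)) (ceiling ms g)) out) ≡
        just (cfg (on k q (scan s)) a
               (onto (floor (map cbit ys ++ cdl ∷ st)) (ceiling (cB s′ ∷ ms) g)) out)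
      step-other s′ a ys st ms g out s≢
        rewrite dec-false (s ≟ₛ s′) s≢
              | move-left (wk (cB s′)) (floor (map cbit ys ++ cdl ∷ st)) (wk (cB s′)) (ceiling ms g) = refl

      equal-refl : ∀ xs → equal xs xs ≡ true
      equal-refl []       = refl
      equal-refl (x ∷ xs) rewrite dec-true (x Bool.≟ x) refl = equal-refl xs

      equal-≢ : ∀ xs ys → xs ≢ ys → equal xs ys ≡ false
      equal-≢ []       []       ne = contradiction refl ne
      equal-≢ []       (y ∷ ys) ne = refl
      equal-≢ (x ∷ xs) []       ne = refl
      equal-≢ (x ∷ xs) (y ∷ ys) ne with x Bool.≟ y
      ... | yes refl = equal-≢ xs ys λ e → ne (cong (x ∷_) e)
      ... | no  _    = refl

      module _ (x : Name) where

        scanCost : ℕ → ℕ → ℕ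
        scanCost l m = l * (length x + 7) + m + 2

        afterBinder : ∀ y (s′ : Sort) fs ms →
          (cdl ∷ (map cbit (reverse y) ʳ++ (cB s′ ∷ ms))) ʳ++ cells fs ≡ ms ʳ++ cells (bd s′ y ∷ fs)
        afterBinder y s′ fs ms = ʳ++-ʳ++ (map cbit (reverse y))

        lengths : ∀ y fs → length (map cbit (reverse y) ++ cdl ∷ cells fs) ≡ suc (length y + length (cells fs))
        lengths y fs = trans (length-++ (map cbit (reverse y)))
          (trans (cong (_+ suc (length (cells fs))) (trans (length-map cbit (reverse y)) (length-reverse y)))
                 (+-suc (length y) _))

        lengths′ : ∀ y (ms : List StackCell) → length (map cbit (reverse y) ʳ++ ms) ≡ length y + length ms
        lengths′ y ms = trans (length-ʳ++ (map cbit (reverse y)))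
          (cong (_+ length ms) (trans (length-map cbit (reverse y)) (length-reverse y)))

        -- Every stack cell is charged |x| + 7 steps. A comparison with a binder of `y` takes |x| +
        -- |y| steps up to a constant, and this is covered by the |y| + 2 cells that the binder
        -- occupies.
        resolve : ∀ fs ms g out →
          cfg (on k q (scan s)) (restored (reverse x)) (onto (floor (cells fs)) (ceiling ms g)) out
            ⟶≤[ scanCost (length (cells fs)) (length ms) ]
          cfg (on k q run) (restored (reverse x)) (stackTape (ms ʳ++ cells fs) g) (map obit (bits (look s x fs)) ʳ++ out)
        resolve [] ms g out = within (≤-reflexive (+-comm 2 (length ms))) (refl ◂ ascend _ [] ms g out)
        resolve (lf b s′ ∷ fs) ms g out = within (≤-by (length x + 5) (frame-cost (length x) (length (cells fs)) (length ms)))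
          (cong (λ t → just (cfg _ _ t out)) (move-left _ (floor (cells fs)) _ _) ◂ resolve fs (cL b s′ ∷ ms) g out)
        resolve (rf ∷ fs) ms g out = within (≤-by (length x + 5) (frame-cost (length x) (length (cells fs)) (length ms)))
          (cong (λ t → just (cfg _ _ t out)) (move-left _ (floor (cells fs)) _ _) ◂ resolve fs (cR ∷ ms) g out)
        resolve (bd s′ y ∷ fs) ms g out with s ≟ₛ s′ | x ≟ⁿ y
        ... | yes refl | yes refl = within (resolve-match-cost {m = length ms} (length-reverse x) (lengths x fs) (lengths′ x (cB s ∷ ms)))
          (step-binder (reverse x) _ (reverse x) (cells fs) ms g out
            ◂ compare (reverse x) (reverse x) [] (cells fs) (cB s ∷ ms) g out
            ▸ begins (cong (λ b → cfg (on k q (after b s)) (restored (reverse x)) _ out) (equal-refl (reverse x)))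
                (ending (cong₂ (λ st o → cfg (on k q run) _ (stackTape st g) o)
                               (afterBinder x s fs ms) (cong (λ b → map obit b ʳ++ out) (cellBits-cells fs)))
                  (descend _ (cells fs) (cdl ∷ (map cbit (reverse x) ʳ++ (cB s ∷ ms))) g out)))
        ... | yes refl | no x≢y = within (resolve-mismatch-cost {m = length ms} (length-reverse x) (length-reverse y) (lengths y fs) (lengths′ y (cB s ∷ ms)))
          (step-binder (reverse x) _ (reverse y) (cells fs) ms g out
            ◂ compare (reverse x) (reverse y) [] (cells fs) (cB s ∷ ms) g out
            ▸ begins (cong (λ b → cfg (on k q (after b s)) (restored (reverse x)) _ out) (equal-≢ (reverse x) (reverse y) (x≢y ∘ reverse-injective)))
                (ending (cong (λ st → cfg (on k q run) _ (stackTape st g) _) (afterBinder y s fs ms))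
                  (resolve fs (cdl ∷ (map cbit (reverse y) ʳ++ (cB s ∷ ms))) g out)))
        ... | no s≢s′ | _ = within (resolve-other-cost {x = length x} {m = length ms} (length-reverse y) (lengths y fs) (lengths′ y (cB s′ ∷ ms)))
          (step-other s′ _ (reverse y) (cells fs) ms g out s≢s′
            ◂ skip s _ (reverse y) (cells fs) (cB s′ ∷ ms) g out
            ▸ (ending (cong (λ st → cfg (on k q run) _ (stackTape st g) _) (afterBinder y s′ fs ms))
                (resolve fs (cdl ∷ (map cbit (reverse y) ʳ++ (cB s′ ∷ ms))) g out)))

    step-name₁ : ∀ L x R b out →
      step (cfg (on k q name₁) (tape L (input (inb x)) R) b out) ≡
      just (cfg (on k q name₁) (focus (input (inb x) ∷ L) R) b (obit x ∷ out))
    step-name₁ L x R b out rewrite ibit-inb x = refl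

    step-name₁-end : ∀ L E R b out → ibit E ≡ nothing →
      step (cfg (on k q name₁) (tape L (input E) R) b out) ≡
      just (cfg (on k q name₂) (onto L (input E ∷ R)) b out)
    step-name₁-end L E R b out E-end rewrite E-end | move-left (input E) L (input E) R = refl

    printName : ∀ L xs E R b out → ibit E ≡ nothing →
      cfg (on k q name₁) (focus L (map (input ∘ inb) xs ++ input E ∷ R)) b out ⟶≤[ suc (length xs) ]
      cfg (on k q name₂) (onto (map (input ∘ inb) xs ʳ++ L) (input E ∷ R)) b (map obit xs ʳ++ out)
    printName L []       E R b out E-end = step-name₁-end L E R b out E-end ◂ stop
    printName L (x ∷ xs) E R b out E-end =
      step-name₁ L x _ b out ◂ printName (input (inb x) ∷ L) xs E R b (obit x ∷ out) E-end

    step-name₂ : ∀ L x R b out →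
      step (cfg (on k q name₂) (tape L (input (inb x)) R) b out) ≡
      just (cfg (on k q name₂) (onto L (input (inb x) ∷ R)) b out)
    step-name₂ L x R b out rewrite ibit-inb x | move-left (input (inb x)) L (input (inb x)) R = refl

    step-name₂-end : ∀ L T R b out → ibit T ≡ nothing →
      step (cfg (on k q name₂) (tape L (input T) R) b out) ≡ just (cfg (on k q run) (focus (input T ∷ L) R) b out)
    step-name₂-end L T R b out T-end rewrite T-end = refl

    rereadName : ∀ L T xs R b out → ibit T ≡ nothing →
      cfg (on k q name₂) (onto (map (input ∘ inb) xs ++ input T ∷ L) R) b out ⟶≤[ suc (length xs) ]
      cfg (on k q run) (focus (input T ∷ L) (map (input ∘ inb) xs ʳ++ R)) b out
    rereadName L T []       R b out T-end = step-name₂-end L T R b out T-end ◂ stop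
    rereadName L T (x ∷ xs) R b out T-end =
      step-name₂ (map (input ∘ inb) xs ++ input T ∷ L) x R b out ◂ rereadName L T xs (input (inb x) ∷ R) b out T-end

    -- The head returns to the beginning of the name, so that the same name can be printed again or
    -- skipped afterwards.
    copyName : ∀ L T x E R b out → ibit T ≡ nothing → ibit E ≡ nothing →
      cfg (on k q name₁) (focus (input T ∷ L) (map (input ∘ inb) x ++ input E ∷ R)) b out ⟶≤[ 2 * length x + 2 ]
      cfg (on k q run) (focus (input T ∷ L) (map (input ∘ inb) x ++ input E ∷ R)) b (map obit x ʳ++ out)
    copyName L T x E R b out T-end E-end = within bound
      (printName (input T ∷ L) x E R b out E-end
        ▸ begins (cong (λ l → cfg _ (onto l _) b _) turn)
            (ending (cong (λ r → cfg _ (focus (input T ∷ L) r) b _) unturn)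
              (rereadName L T (reverse x) (input E ∷ R) b (map obit x ʳ++ out) T-end)))
      where
      turn : map (input ∘ inb) x ʳ++ (input T ∷ L) ≡ map (input ∘ inb) (reverse x) ++ input T ∷ L
      turn = map-ʳ++-++ (input ∘ inb) x
      unturn : map (input ∘ inb) (reverse x) ʳ++ (input E ∷ R) ≡ map (input ∘ inb) x ++ input E ∷ R
      unturn = trans (map-ʳ++-++ (input ∘ inb) (reverse x))
        (cong (λ y → map (input ∘ inb) y ++ input E ∷ R) (reverse-involutive x))
      bound : suc (length x) + suc (length (reverse x)) ≤ 2 * length x + 2
      bound rewrite length-reverse x = ≤-by 0 (copy-cost (length x))

  -- The output of an item depends on the input to the left and to the right of
  -- the head and on the stack; N bounds the cost of printing it.
  data Emits (N : ℕ) : Item O → (ls rs : List I) → List StackCell → List O → Set where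
    emit : ∀ {o ls rs st} → Emits N (emit o) ls rs st (o ∷ [])
    path : ∀ {ls rs st} → length st ≤ N → Emits N path ls rs st (map obit (cellBits st))
    res  : ∀ {s T E ls rs} fs x → ibit T ≡ nothing → ibit E ≡ nothing →
           length (cells fs) ≤ N → length x ≤ N →
           Emits N (res s) (map inb (reverse x) ++ T ∷ ls) (E ∷ rs) (cells fs) (map obit (bits (look s x fs)))
    name : ∀ {T E ls rs st} x → ibit T ≡ nothing → ibit E ≡ nothing → length x ≤ N →
           Emits N name (T ∷ ls) (map inb x ++ E ∷ rs) st (map obit x)

  infixr 5 _∷_

  data EmitsAll (N : ℕ) : List (Item O) → (ls rs : List I) → List StackCell → List O → Set where
    []  : ∀ {ls rs st} → EmitsAll N [] ls rs st []
    _∷_ : ∀ {it is ls rs st o os} → Emits N it ls rs st o → EmitsAll N is ls rs st os →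
          EmitsAll N (it ∷ is) ls rs st (o ++ os)

  -- One bound for all kinds of items. Resolving a name dominates: up to `N` stack cells at a charge
  -- of N + 7 each.
  itemCost : ℕ → ℕ
  itemCost N = (N + 8) * (N + 8)

  step-emit : ∀ {k o} (q q′ : Pos (script k)) a b out → at q ≡ just (emit o , q′) →
    step (cfg (on k q run) a b out) ≡ just (cfg (on k q′ run) a b (o ∷ out))
  step-emit q q′ a b out eq rewrite eq = refl

  step-path : ∀ {k} (q q′ : Pos (script k)) a st g out → at q ≡ just (path , q′) →
    step (cfg (on k q run) a (stackTape st g) out) ≡
    just (cfg (on k q′ down) a (onto (floor st) (ceiling [] g)) out)
  step-path q q′ a st g out eq rewrite eq | move-left (work top) (floor st) (work top) g = refl

  step-res : ∀ {k s} (q q′ : Pos (script k)) a st g out → at q ≡ just (res s , q′) →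
    step (cfg (on k q run) a (stackTape st g) out) ≡
    just (cfg (on k q′ (scan s)) a (onto (floor st) (ceiling [] g)) out)
  step-res q q′ a st g out eq rewrite eq | move-left (work top) (floor st) (work top) g = refl

  step-name : ∀ {k} (q q′ : Pos (script k)) a b out → at q ≡ just (name , q′) →
    step (cfg (on k q run) a b out) ≡ just (cfg (on k q′ name₁) a b out)
  step-name q q′ a b out eq rewrite eq = refl

  inputs-++ : ∀ x E rs tail → inputs (map inb x ++ E ∷ rs) ++ tail ≡ map (input ∘ inb) x ++ input E ∷ (inputs rs ++ tail)
  inputs-++ []      E rs tail = refl
  inputs-++ (b ∷ x) E rs tail = cong (input (inb b) ∷_) (inputs-++ x E rs tail)

  printItem : ∀ {N k it ls rs st o} (q q′ : Pos (script k)) base tail g out →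
    at q ≡ just (it , q′) → Emits N it ls rs st o →
    cfg (on k q run) (inTape base tail ls rs) (stackTape st g) out ⟶≤[ itemCost N ]
    cfg (on k q′ run) (inTape base tail ls rs) (stackTape st g) (o ʳ++ out)
  printItem {N} q q′ base tail g out eq emit = within (≤-by (63 + 16 * N + N * N) (emit-cost N))
    (step-emit q q′ _ _ out eq ◂ stop {n = 0})
  printItem {N} q q′ base tail g out eq (path {st = st} st≤N) =
    within (≤-trans (s≤s (+-monoˡ-≤ 2 (+-monoˡ-≤ 0 (*-monoʳ-≤ 2 st≤N)))) (≤-by (61 + 14 * N + N * N) (path-cost N)))
      (step-path q q′ _ st g out eq ◂ descend _ st [] g out)
  printItem {N} q q′ base tail g out eq (res {s} {T} {E} {ls} {rs} fs x T-end E-end fs≤N x≤N) =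
    within (≤-trans (s≤s (+-monoˡ-≤ 2 (+-monoˡ-≤ 0 (*-mono-≤ fs≤N (+-monoˡ-≤ 7 x≤N))))) (≤-by (61 + 9 * N) (res-cost N)))
      (step-res q q′ _ (cells fs) g out eq ◂ resolve s T-end E-end ls base (inputs rs ++ tail) x fs [] g out)
  printItem {N} q q′ base tail g out eq (name {T} {E} {ls} {rs} {st} x T-end E-end x≤N) =
    within (≤-trans (s≤s (+-monoˡ-≤ 2 (*-monoʳ-≤ 2 x≤N))) (≤-by (61 + 14 * N + N * N) (name-cost N)))
      (step-name q q′ _ _ out eq
        ◂ begins (cong (λ r → cfg _ (focus (inputs (T ∷ ls) ++ base) r) (stackTape st g) out) (inputs-++ x E rs tail))
            (ending (cong (λ r → cfg _ (focus (inputs (T ∷ ls) ++ base) r) (stackTape st g) _) (sym (inputs-++ x E rs tail)))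
              (copyName (inputs ls ++ base) T x E (inputs rs ++ tail) _ out T-end E-end)))

  printAll : ∀ {N k ls rs st o is} (q : Pos (script k)) base tail g out →
    rest q ≡ is → EmitsAll N is ls rs st o →
    ∃[ q′ ] at q′ ≡ nothing ×
      (cfg (on k q run) (inTape base tail ls rs) (stackTape st g) out ⟶≤[ length is * itemCost N ]
       cfg (on k q′ run) (inTape base tail ls rs) (stackTape st g) (o ʳ++ out))
  printAll q base tail g out eq [] = q , at-[] q eq , stop
  printAll q base tail g out eq (_∷_ {o = o} e es) with at-∷ q eq
  ... | q₁ , at-eq , rest-eq with printAll q₁ base tail g (o ʳ++ out) rest-eq es
  ... | q₂ , at-eq′ , r = q₂ , at-eq′ ,
    printItem q q₁ base tail g out at-eq e ▸ ending (cong (cfg _ _ _) (sym (++-ʳ++ o))) r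

  -- Abstract runs from script to script

  data Adjusts : StackOp → List StackCell → List StackCell → Set where
    keep : ∀ {st} → Adjusts keep st st
    pop  : ∀ {c st} → Adjusts pop (c ∷ st) st
    swap : ∀ {c c′ st} → Adjusts (swap c′) (c ∷ st) (c′ ∷ st)
    push : ∀ {c st} → Adjusts (push c) st (c ∷ st)

  data Advances : Bool → (ls rs ls′ rs′ : List I) → Set where
    stay  : ∀ {ls rs} → Advances false ls rs ls rs
    right : ∀ {ls i rs} → Advances true ls (i ∷ rs) (i ∷ ls) rs

  -- What matters of a configuration between two scripts, without markers, garbage and blanks. The
  -- lists `behind` and `printed` have their latest element first.
  record Control : Set where
    constructor ⟨_,_,_,_,_⟩
    field
      control      : K
      behind ahead : List I
      stack        : List StackCell
      printed      : List O

  infix 4 _⊢_⇒_ _⊢_⇒*[_]_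

  data _⊢_⇒_ (N : ℕ) : Control → Control → Set where
    goes : ∀ {k ls rs st out o m op k′ ls′ rs′ st′} →
      EmitsAll N (script k) ls rs st o →
      decide k (List.head rs) (List.head st) ≡ just (go m op k′) →
      Advances m ls rs ls′ rs′ → Adjusts op st st′ →
      N ⊢ ⟨ k , ls , rs , st , out ⟩ ⇒ ⟨ k′ , ls′ , rs′ , st′ , o ʳ++ out ⟩
    rewinds : ∀ {k ls rs st out o k′} →
      EmitsAll N (script k) ls rs st o → length ls ≤ N →
      decide k (List.head rs) (List.head st) ≡ just (rewind k′) →
      N ⊢ ⟨ k , ls , rs , st , out ⟩ ⇒ ⟨ k′ , [] , ls ʳ++ rs , st , o ʳ++ out ⟩

  data _⊢_⇒*[_]_ (N : ℕ) : Control → ℕ → Control → Set where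
    []  : ∀ {c} → N ⊢ c ⇒*[ 0 ] c
    _∷_ : ∀ {c c′ c″ n} → N ⊢ c ⇒ c′ → N ⊢ c′ ⇒*[ n ] c″ → N ⊢ c ⇒*[ suc n ] c″

  infixr 5 _⊕⊕_

  _⊕⊕_ : ∀ {N c c′ c″ m n} → N ⊢ c ⇒*[ m ] c′ → N ⊢ c′ ⇒*[ n ] c″ → N ⊢ c ⇒*[ m + n ] c″
  []       ⊕⊕ s = s
  (e ∷ r) ⊕⊕ s = e ∷ (r ⊕⊕ s)

  scriptLength : ℕ
  scriptLength = sum (map (length ∘ script) (proj₁ K-finite))

  ≤-sum : ∀ (f : K → ℕ) {k ks} → k ∈ ks → f k ≤ sum (map f ks)
  ≤-sum f (here refl)          = m≤m+n _ _
  ≤-sum f {ks = k′ ∷ ks} (there m) = ≤-trans (≤-sum f m) (m≤n+m _ (f k′))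

  script≤ : ∀ k → length (script k) ≤ scriptLength
  script≤ k = ≤-sum (length ∘ script) (proj₂ K-finite k)

  stepCost : ℕ → ℕ
  stepCost N = scriptLength * itemCost N + (N + 4)

  data Blank : List Γ′ → Set where
    []    : Blank []
    blank : Blank (blank ∷ [])

  -- `g` is the garbage that pops have left above the marker; `base` and `tail` are blank cells
  -- visited beyond the two ends of the input.
  data Represents : Control → Config → Set where
    represents : ∀ {k ls rs st out base tail} g → Blank base → Blank tail →
      Represents ⟨ k , ls , rs , st , out ⟩ (cfg (on k here run) (inTape base tail ls rs) (stackTape st g) out)

  inputAt-head : ∀ ls rs {tail} → Blank tail → inputAt (Tape.head (focus ls (inputs rs ++ tail))) ≡ List.head rs
  inputAt-head ls []      []        = refl
  inputAt-head ls []      blank     = refl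
  inputAt-head ls (_ ∷ _) _         = refl

  cellAt-head : ∀ st r → cellAt (Tape.head (onto (floor st) r)) ≡ List.head st
  cellAt-head []      r = refl
  cellAt-head (_ ∷ _) r = refl

  step-look : ∀ {k} (q : Pos (script k)) a st g out → at q ≡ nothing →
    step (cfg (on k q run) a (stackTape st g) out) ≡ just (cfg (dec k) a (onto (floor st) (ceiling [] g)) out)
  step-look q a st g out eq rewrite eq | move-left (work top) (floor st) (work top) g = refl

  decided : ∀ k base tail ls rs st g out {x} → Blank tail → decide k (List.head rs) (List.head st) ≡ x →
    step (cfg (dec k) (inTape base tail ls rs) (onto (floor st) (ceiling [] g)) out) ≡
    Maybe.map (λ (q′ , acts) → q′ , Vec.zipWith writeMove acts (inTape base tail ls rs ∷ onto (floor st) (ceiling [] g) ∷ tape (map output out) blank [] ∷ []))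
      (δ-dec x (Tape.head (inTape base tail ls rs)) (Tape.head (onto (floor st) (ceiling [] g))) blank)
  decided k base tail ls rs st g out bl eq
    rewrite inputAt-head (inputs ls ++ base) rs bl | cellAt-head st (ceiling [] g) | eq = refl

  moveOf : Bool → Move
  moveOf m = if m then right else stay

  advance : ∀ {m ls rs ls′ rs′} base {tail} → Blank tail → Advances m ls rs ls′ rs′ →
    ∃[ tail′ ] Blank tail′ ×
      writeMove (Tape.head (inTape base tail ls rs) , moveOf m) (inTape base tail ls rs) ≡ inTape base tail′ ls′ rs′
  advance base []        (stay {rs = []})    = _ , [] , refl
  advance base blank     (stay {rs = []})    = _ , blank , refl
  advance base bl        (stay {rs = _ ∷ _}) = _ , bl , refl
  advance base bl        right               = _ , bl , refl

  ascends : ∀ st g → writeMove (Tape.head (onto (floor st) (ceiling [] g)) , right) (onto (floor st) (ceiling [] g)) ≡ stackTape st g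
  ascends []      g = refl
  ascends (_ ∷ _) g = refl

  rewindInput : ∀ {k} base → Blank base → ∀ ls R b out →
    ∃[ base′ ] Blank base′ ×
      (cfg (rew k) (onto (inputs ls ++ base) R) b out ⟶≤[ suc (length ls) ]
       cfg (on k here run) (focus base′ (inputs ls ʳ++ R)) b out)
  rewindInput .[]           []           []       R b out = _ , blank , refl ◂ stop
  rewindInput .(blank ∷ []) blank        []       R b out = _ , blank , refl ◂ stop
  rewindInput base          bl           (i ∷ ls) R b out with rewindInput base bl ls (input i ∷ R) b out
  ... | base′ , bl′ , r = base′ , bl′ , cong (λ t → just (cfg _ t b out)) (move-left (input i) (inputs ls ++ base) _ R) ◂ r

  simulate : ∀ {N c c′ x} → N ⊢ c ⇒ c′ → Represents c x → ∃[ x′ ] Represents c′ x′ × (x ⟶≤[ stepCost N ] x′)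
  simulate {N} (goes {k} {ls} {rs} {st} {out} {o} {m} {op} {k′} {ls′} {rs′} es eq adv adj)
               (represents {base = base} {tail} g bl bl-tail)
    with printAll here base tail g out refl es | advance base bl-tail adv
  ... | q , at-eq , r | tail′ , bl′ , moved = let x′ , rep , t = adjust adj eq in
    x′ , rep , within (+-mono-≤ (*-monoˡ-≤ (itemCost N) (script≤ k)) (m≤n+m 4 N))
      (r ▸ step-look q _ st g _ at-eq ◂ t)
    where
    out′ = o ʳ++ out
    adjust : ∀ {op st′} → Adjusts op st st′ → decide k (List.head rs) (List.head st) ≡ just (go m op k′) →
      ∃[ x ] Represents ⟨ k′ , ls′ , rs′ , st′ , out′ ⟩ x ×
        (cfg (dec k) (inTape base tail ls rs) (onto (floor st) (ceiling [] g)) out′ ⟶≤[ 3 ] x)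
    adjust keep eq = _ , represents g bl bl′ ,
      trans (decided k base tail ls rs st g out′ bl-tail eq)
        (cong₂ (λ a b → just (cfg (on k′ here run) a b out′)) moved (ascends st g)) ◂ stop
    adjust {st′ = st′} pop eq = _ , represents (work top ∷ g) bl bl′ ,
      trans (decided k base tail ls rs st g out′ bl-tail eq)
        (cong (λ a → just (cfg (on k′ here run) a (stackTape st′ (work top ∷ g)) out′)) moved) ◂ stop
    adjust {st′ = st′} swap eq = _ , represents g bl bl′ ,
      trans (decided k base tail ls rs st g out′ bl-tail eq)
        (cong (λ a → just (cfg (on k′ here run) a (stackTape st′ g) out′)) moved) ◂ stop
    -- The new cell takes the place of the marker, which moves up and overwrites the first cell of
    -- garbage.
    adjust {st′ = c ∷ _} push eq = _ , represents (List.drop 1 g) bl bl′ ,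
      trans (decided k base tail ls rs st g out′ bl-tail eq)
        (cong₂ (λ a b → just (cfg (push₁ c k′) a b out′)) moved (ascends st g)) ◂ refl ◂ overwrite g ◂ stop
      where
      overwrite : ∀ g → step (cfg (push₂ k′) (inTape base tail′ ls′ rs′) (focus (floor (c ∷ st)) g) out′) ≡
        just (cfg (on k′ here run) (inTape base tail′ ls′ rs′) (stackTape (c ∷ st) (List.drop 1 g)) out′)
      overwrite []      = refl
      overwrite (_ ∷ _) = refl
  simulate {N} (rewinds {k} {ls} {rs} {st} {out} {o} {k′} es ls≤N eq)
               (represents {base = base} {tail} g bl bl-tail)
    with printAll here base tail g out refl es | retreat rs bl-tail
    where
    retreat : ∀ rs {tail} → Blank tail → ∃[ tail′ ] Blank tail′ ×
      (∀ L → writeMove (Tape.head (focus L (inputs rs ++ tail)) , left) (focus L (inputs rs ++ tail)) ≡ onto L (inputs rs ++ tail′))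
    retreat []       []    = _ , blank , λ L → move-left blank L blank []
    retreat []       blank = _ , blank , λ L → move-left blank L blank []
    retreat (i ∷ rs) {tail} bl = _ , bl , λ L → move-left (input i) L (input i) (inputs rs ++ tail)
  ... | q , at-eq , r | tail′ , bl-tail′ , moved
    with rewindInput {k′} base bl ls (inputs rs ++ tail′) (stackTape st g) (o ʳ++ out)
  ... | base′ , bl′ , r′ = _ , represents g bl′ bl-tail′ ,
    within (+-mono-≤ (*-monoˡ-≤ (itemCost N) (script≤ k))
             (≤-trans (s≤s (s≤s (s≤s ls≤N))) (≤-trans (≤-reflexive (+-comm 3 N)) (+-monoʳ-≤ N (n≤1+n 3)))))
      (r ▸ step-look q _ st g _ at-eq
         ◂ trans (decided k base tail ls rs st g (o ʳ++ out) bl-tail eq)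
             (cong₂ (λ a b → just (cfg (rew k′) a b (o ʳ++ out))) (moved _) (ascends st g))
         ◂ ending (cong (λ t → cfg _ (focus base′ t) _ _) (map-ʳ++-++ input ls)) r′)

  -- `os` is reversed, and copying runs from right to left, so the symbols end up in reading order.
  -- Whatever lay to the right of the input head would be read next, hence the last summand of the
  -- result.
  flushes : ∀ os a b r → ∃[ c ] ((flush , a ∷ b ∷ onto (map output os) r ∷ []) ⟶≤[ suc (length os) ] c)
    × step c ≡ nothing × result c ≡ os ʳ++ readout (Tape.rights a)
  flushes [] (tape l h rs) b r = _ , refl ◂ stop , refl , shown rs
    where
    shown : ∀ rs → result (halt , focus (h ∷ l) rs ∷ b ∷ onto [] r ∷ []) ≡ readout rs
    shown []      = refl
    shown (_ ∷ _) = refl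
  flushes (x ∷ os) a b r with flushes os (writeMove (output x , left) a) b (output x ∷ r)
  ... | c , run′ , halted , res′ = c ,
    cong (λ t → just (flush , writeMove (output x , left) a ∷ b ∷ t ∷ [])) (move-left _ (map output os) _ r) ◂ run′ ,
    halted , trans res′ (cong (λ z → os ʳ++ readout z) (rights-left a))
    where
    rights-left : ∀ a → Tape.rights (writeMove (output x , left) a) ≡ output x ∷ Tape.rights a
    rights-left (tape []      _ _) = refl
    rights-left (tape (_ ∷ _) _ _) = refl

  -- Needed for the time of the final copying, which is proportional to the length of the output.
  emits-length : ∀ {N it ls rs st o} → Emits N it ls rs st o → length o ≤ itemCost N
  emits-length {N} emit = ≤-by (63 + 16 * N + N * N) (emit-cost N)
  emits-length {N} (path {st = st} st≤N) =
    ≤-trans (≤-reflexive (length-map obit (cellBits st))) (≤-trans (shrinks st) (≤-trans st≤N (≤-by _ (size-cost N))))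
    where
    shrinks : ∀ st → length (cellBits st) ≤ length st
    shrinks []            = z≤n
    shrinks (cL _ _ ∷ st) = s≤s (shrinks st)
    shrinks (cR     ∷ st) = s≤s (shrinks st)
    shrinks (cB _   ∷ st) = s≤s (shrinks st)
    shrinks (cbit _ ∷ st) = m≤n⇒m≤1+n (shrinks st)
    shrinks (cdl    ∷ st) = m≤n⇒m≤1+n (shrinks st)
  emits-length {N} (res {s} fs x _ _ fs≤N _) =
    ≤-trans (≤-reflexive (trans (length-map obit (bits (look s x fs))) (length-map frameBit (look s x fs))))
      (≤-trans (look-shorter fs) (≤-trans (frames≤cells fs) (≤-trans fs≤N (≤-by _ (size-cost N)))))
    where
    look-shorter : ∀ fs → length (look s x fs) ≤ length fs
    look-shorter []            = z≤n
    look-shorter (lf _ _ ∷ fs) = m≤n⇒m≤1+n (look-shorter fs)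
    look-shorter (rf ∷ fs)     = m≤n⇒m≤1+n (look-shorter fs)
    look-shorter (bd s′ y ∷ fs) with s ≟ₛ s′ | x ≟ⁿ y
    ... | yes _ | yes _ = n≤1+n _
    ... | yes _ | no  _ = m≤n⇒m≤1+n (look-shorter fs)
    ... | no  _ | _     = m≤n⇒m≤1+n (look-shorter fs)
    frames≤cells : ∀ fs → length fs ≤ length (cells fs)
    frames≤cells []            = z≤n
    frames≤cells (lf _ _ ∷ fs) = s≤s (frames≤cells fs)
    frames≤cells (rf ∷ fs)     = s≤s (frames≤cells fs)
    frames≤cells (bd s y ∷ fs) = s≤s (≤-trans (frames≤cells fs) (≤-trans (n≤1+n _)
      (≤-trans (m≤n+m _ _) (≤-reflexive (sym (length-++ (map cbit (reverse y))))))))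
  emits-length {N} (name x _ _ x≤N) =
    ≤-trans (≤-reflexive (length-map obit x)) (≤-trans x≤N (≤-by _ (size-cost N)))

  emitsAll-length : ∀ {N is ls rs st o} → EmitsAll N is ls rs st o → length o ≤ length is * itemCost N
  emitsAll-length []                  = z≤n
  emitsAll-length (_∷_ {o = o} e es) = ≤-trans (≤-reflexive (length-++ o)) (+-mono-≤ (emits-length e) (emitsAll-length es))

  scriptOutput≤ : ∀ {N k ls rs st o} → EmitsAll N (script k) ls rs st o → length o ≤ stepCost N
  scriptOutput≤ {N} {k} es = ≤-trans (emitsAll-length es) (≤-trans (*-monoˡ-≤ (itemCost N) (script≤ k)) (m≤m+n _ _))

  grows : ∀ {N k ls rs st o} (out : List O) → EmitsAll N (script k) ls rs st o → length (o ʳ++ out) ≤ length out + stepCost N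
  grows {o = o} out es = ≤-trans (≤-reflexive (trans (length-ʳ++ o) (+-comm (length o) (length out))))
    (+-monoʳ-≤ (length out) (scriptOutput≤ es))

  outputOf : Control → List O
  outputOf = Control.printed

  step-grows : ∀ {N c c′} → N ⊢ c ⇒ c′ → length (outputOf c′) ≤ length (outputOf c) + stepCost N
  step-grows (goes es _ _ _)    = grows _ es
  step-grows (rewinds es _ _) = grows _ es

  runs : ∀ {N c c′ m x} → N ⊢ c ⇒*[ m ] c′ → Represents c x →
    ∃[ x′ ] Represents c′ x′ × (x ⟶≤[ m * stepCost N ] x′) × length (outputOf c′) ≤ length (outputOf c) + m * stepCost N
  runs [] rep = _ , rep , stop , ≤-reflexive (sym (+-identityʳ _))
  runs {N} {c} {m = suc m} (e ∷ es) rep with simulate e rep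
  ... | x₁ , rep₁ , r₁ with runs es rep₁
  ... | x₂ , rep₂ , r₂ , l₂ = x₂ , rep₂ , r₁ ▸ r₂ ,
    ≤-trans l₂ (≤-trans (+-monoˡ-≤ _ (step-grows e)) (≤-reflexive (+-assoc (length (outputOf c)) (stepCost N) (m * stepCost N))))

  -- The `m` control steps are paid twice, once for their time and once for copying what they print;
  -- the remaining summand covers the last script and the constant overhead.
  halts : ∀ {N m w k ls rs st out o} →
    N ⊢ ⟨ k₀ , [] , w , [] , [] ⟩ ⇒*[ m ] ⟨ k , ls , rs , st , out ⟩ →
    EmitsAll N (script k) ls rs st o → decide k (List.head rs) (List.head st) ≡ nothing →
    ∃[ t ] t ≤ (2 * m + 3) * stepCost N × HaltsIn t On w With (reverse (o ʳ++ out))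
  halts {N} {m} {w} {k} {ls} {rs} {st} {out} {o} run* es eq
    with runs run* (represents {base = []} {[]} [] [] [])
  ... | _ , represents {base = base} {tail} g bl bl-tail , (t₁ , t₁≤ , r₁) , out≤
    with printAll here base tail g out refl es
  ... | q , at-eq , r₂
    with flushes (o ʳ++ out) (inTape base tail ls rs) (onto (floor st) (ceiling [] g)) (blank ∷ [])
  ... | c , r₃ , halted , shown = total
    where
    out′ = o ʳ++ out
    whole : initialConfig w ⟶≤[ suc (suc (m * stepCost N + (length (script k) * itemCost N + suc (suc (suc (length out′)))))) ] c
    whole = refl ◂ refl ◂ begins (cong (λ l → cfg _ (focus [] l) _ []) (sym (++-identityʳ (inputs w))))
      ((t₁ , t₁≤ , r₁) ▸ r₂ ▸ step-look q _ st g out′ at-eq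
        ◂ trans (decided k base tail ls rs st g out′ bl-tail eq)
            (cong (λ t → just (flush , inTape base tail ls rs ∷ onto (floor st) (ceiling [] g) ∷ t ∷ []))
                  (move-left blank (map output out′) blank []))
        ◂ r₃)
    -- To the right of the copied output there are only input symbols and blanks, and either of them
    -- ends the readout.
    no-output : ∀ L rs {tail} → Blank tail → readout (Tape.rights (focus L (inputs rs ++ tail))) ≡ []
    no-output L []           []    = refl
    no-output L []           blank = refl
    no-output L (_ ∷ [])     []    = refl
    no-output L (_ ∷ [])     blank = refl
    no-output L (_ ∷ _ ∷ rs) _     = refl
    bound : suc (suc (m * stepCost N + (length (script k) * itemCost N + suc (suc (suc (length out′)))))) ≤ (2 * m + 3) * stepCost N
    bound = ≤-trans (≤-reflexive (rearrange (m * stepCost N) (length (script k) * itemCost N) (length out′)))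
      (≤-trans (+-mono-≤ (+-mono-≤ (+-monoʳ-≤ (m * stepCost N) (*-monoˡ-≤ (itemCost N) (script≤ k)))
                 (≤-trans (grows out es) (+-monoˡ-≤ (stepCost N) out≤))) ≤-refl)
        (≤-trans (≤-by (2 * N + 3 + scriptLength * itemCost N) (final-cost m N (scriptLength * itemCost N))) ≤-refl))
    total : ∃[ t ] t ≤ (2 * m + 3) * stepCost N × HaltsIn t On w With (reverse out′)
    total with within bound whole
    ... | t , t≤ , r = t , t≤ , c , r , halted ,
      trans shown (cong (out′ ʳ++_) (no-output (inputs ls ++ base) rs bl-tail))

  infix 4 _⊢_⇒≤[_]_
  infixr 5 _then_

  _⊢_⇒≤[_]_ : ℕ → Control → ℕ → Control → Set
  N ⊢ c ⇒≤[ n ] c′ = ∃[ m ] m ≤ n × (N ⊢ c ⇒*[ m ] c′)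

  _then_ : ∀ {N c c′ c″ m n} → N ⊢ c ⇒≤[ m ] c′ → N ⊢ c′ ⇒≤[ n ] c″ → N ⊢ c ⇒≤[ m + n ] c″
  (_ , p , r) then (_ , q , s) = _ , +-mono-≤ p q , r ⊕⊕ s

  one : ∀ {N c c′} → N ⊢ c ⇒ c′ → N ⊢ c ⇒≤[ 1 ] c′
  one e = 1 , ≤-refl , e ∷ []

  atMost : ∀ {N c c′ m n} → m ≤ n → N ⊢ c ⇒≤[ m ] c′ → N ⊢ c ⇒≤[ n ] c′
  atMost m≤n (m , p , r) = m , ≤-trans p m≤n , r

  source : ∀ {N c c′ c″ n} → c ≡ c′ → N ⊢ c′ ⇒≤[ n ] c″ → N ⊢ c ⇒≤[ n ] c″
  source refl r = r

  target : ∀ {N c c′ c″ n} → c′ ≡ c″ → N ⊢ c ⇒≤[ n ] c′ → N ⊢ c ⇒≤[ n ] c″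
  target refl r = r

  emits-map : ∀ {N ls rs st} os → EmitsAll N (map emit os) ls rs st os
  emits-map []       = []
  emits-map (o ∷ os) = emit ∷ emits-map os

  emits-++ : ∀ {N is is′ ls rs st os os′} → EmitsAll N is ls rs st os → EmitsAll N is′ ls rs st os′ →
             EmitsAll N (is ++ is′) ls rs st (os ++ os′)
  emits-++ []                 es′ = es′
  emits-++ {os′ = os′} (_∷_ {o = o} {os} e es) es′ =
    subst (EmitsAll _ _ _ _ _) (sym (++-assoc o os os′)) (e ∷ emits-++ es es′)

  -- Kept abstract, since evaluating scriptLength is expensive.
  abstract
    coefficient : ℕ → ℕ
    coefficient a = (2 * a + 19) * (81 * scriptLength + 5)

    computesIn : ∀ a {w k ls rs st out} →
      length w ⊢ ⟨ k₀ , [] , w , [] , [] ⟩ ⇒≤[ 8 * length w + a ] ⟨ k , ls , rs , st , out ⟩ →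
      script k ≡ [] → decide k (List.head rs) (List.head st) ≡ nothing →
      ∃[ t ] t ≤ coefficient a * length w ^ 3 + coefficient a × HaltsIn t On w With reverse out
    computesIn a {w} {k} {ls} {rs} {st} (m , m≤ , r) silent eq
      with halts r (subst (λ is → EmitsAll (length w) is ls rs st []) (sym silent) []) eq
    ... | t , t≤ , h = t , ≤-trans t≤ (≤-trans (*-monoˡ-≤ (stepCost (length w)) (+-monoˡ-≤ 3 (*-monoʳ-≤ 2 m≤)))
                                               (cubic scriptLength a (length w))) , h

infixr 4 _⇔⊎_ _⇔×_

-- Classical equivalences and congruence of satisfaction

_⇔⊎_ : ∀ {A B C D : Set} → A ⇔ B → C ⇔ D → (A ⊎ C) ⇔ (B ⊎ D)
f ⇔⊎ g = mk⇔ (λ { (inj₁ a) → inj₁ (fwd f a) ; (inj₂ c) → inj₂ (fwd g c) })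
             (λ { (inj₁ b) → inj₁ (bwd f b) ; (inj₂ d) → inj₂ (bwd g d) })

_⇔×_ : ∀ {A B C D : Set} → A ⇔ B → C ⇔ D → (A × C) ⇔ (B × D)
f ⇔× g = mk⇔ (λ (a , c) → fwd f a , fwd g c) (λ (b , d) → bwd f b , bwd g d)

⇔¬ : ∀ {A B : Set} → A ⇔ B → (¬ A) ⇔ (¬ B)
⇔¬ f = mk⇔ (λ na b → na (bwd f b)) (λ nb a → nb (fwd f a))

⇔Σ : ∀ {A : Set} {B C : A → Set} → (∀ a → B a ⇔ C a) → Σ A B ⇔ Σ A C
⇔Σ f = mk⇔ (λ (a , b) → a , fwd (f a) b) (λ (a , c) → a , bwd (f a) c)

⇔Π : ∀ {A : Set} {B C : A → Set} → (∀ a → B a ⇔ C a) → (∀ a → B a) ⇔ (∀ a → C a)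
⇔Π f = mk⇔ (λ g a → fwd (f a) (g a)) (λ g a → bwd (f a) (g a))

⇔→ : ∀ {A B C : Set} → B ⇔ C → (A → B) ⇔ (A → C)
⇔→ f = mk⇔ (λ g a → fwd f (g a)) (λ g a → bwd f (g a))

≡⇒⇔ : ∀ {A B : Set} → A ≡ B → A ⇔ B
≡⇒⇔ refl = ⇔-refl

just⇔ : ∀ {A : Set} {P : A → Set} {a} → Any P (just a) ⇔ P a
just⇔ = mk⇔ (λ { (just p) → p }) just

does⇔ : ∀ {P : Set} (d : Dec P) → (does d ≡ true) ⇔ P
does⇔ (yes p) = mk⇔ (λ _ → p) (λ _ → refl)
does⇔ (no np) = mk⇔ (λ ()) (λ p → contradiction p np)

module Classical (em : ExcludedMiddle 0ℓ) where

  stable : ∀ {P : Set} → ¬ ¬ P → P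
  stable = decidable-stable em

  conj : ∀ {P Q : Set} → (¬ (¬ P ⊎ ¬ Q)) ⇔ (P × Q)
  conj = mk⇔ (λ k → stable (k ∘ inj₁) , stable (k ∘ inj₂)) λ { (a , b) (inj₁ na) → na a ; (a , b) (inj₂ nb) → nb b }

  impl : ∀ {P Q : Set} → (¬ P ⊎ Q) ⇔ (P → Q)
  impl {P} {Q} = mk⇔ (λ { (inj₁ na) a → contradiction a na ; (inj₂ b) _ → b }) λ f → case em f
    where
    case : Dec P → (P → Q) → ¬ P ⊎ Q
    case (yes a) f = inj₂ (f a)
    case (no na) f = inj₁ na

  iff : ∀ {P Q : Set} → (¬ (¬ (¬ P ⊎ Q) ⊎ ¬ (¬ Q ⊎ P))) ⇔ (P ⇔ Q)
  iff = mk⇔ (λ k → let f , g = fwd conj k in mk⇔ (fwd impl f) (fwd impl g))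
            (λ e → bwd conj (bwd impl (fwd e) , bwd impl (bwd e)))

override-same : ∀ {B : Set} (f : Name → B) x b → A.override f x b x ≡ b
override-same f x b with x ≟ⁿ x
... | yes _ = refl
... | no ne = contradiction refl ne

override-other : ∀ {B : Set} (f : Name → B) {x y} b → y ≢ x → A.override f x b y ≡ f y
override-other f {x} {y} b ne with x ≟ⁿ y
... | yes x≡y = contradiction (sym x≡y) ne
... | no _    = refl

module Satisfaction (n : ℕ) where
  open Hyper n

  Table : Set₁
  Table = Fin n → Name → ℕ → Set

  -- Satisfaction at absolute positions: the shifting of assignments becomes addition of positions,
  -- and only the truth values of the atoms are left of the assignment.
  sat : Table → ℕ → QF → Set
  sat B i (p at π)  = B p π i
  sat B i (¬′ ψ)    = ¬ sat B i ψ
  sat B i (ψ ∨ χ)   = sat B i ψ ⊎ sat B i χ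
  sat B i (X ψ)     = sat B (suc i) ψ
  sat B i (ψ U χ)   = ∃[ j ] sat B (i + j) χ × (∀ j′ → j′ < j → sat B (i + j′) ψ)

  table : Assignment → Table
  table Π p π i = Any (λ t → p ∈ₛ t i) (trace Π π)

  table-from : ∀ Π j p π i → table (Π from j) p π i ⇔ table Π p π (j + i)
  table-from Π j p π i with trace Π π
  ... | just t  = mk⇔ (λ { (just a) → just a }) (λ { (just a) → just a })
  ... | nothing = mk⇔ (λ ()) (λ ())

  -- The invariant is that `Π` is the table `B` read from position `i` on; a suffix by `j` merely
  -- replaces `i` by i + j.
  shifted : ∀ {B} Π i → (∀ p π m → table Π p π m ⇔ B p π (i + m)) →
            ∀ ψ → Π ⊨ᵠ ψ ⇔ sat B i ψ
  shifted-from : ∀ {B} Π i j → (∀ p π m → table Π p π m ⇔ B p π (i + m)) →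
                 ∀ ψ → (Π from j ⊨ᵠ ψ) ⇔ sat B (i + j) ψ
  shifted {B} Π i R (p at π) = ⇔-trans (R p π 0) (≡⇒⇔ (cong (B p π) (+-identityʳ i)))
  shifted Π i R (¬′ ψ)       = ⇔¬ (shifted Π i R ψ)
  shifted Π i R (ψ ∨ χ)      = shifted Π i R ψ ⇔⊎ shifted Π i R χ
  shifted {B} Π i R (X ψ)    = ⇔-trans (shifted-from Π i 1 R ψ) (≡⇒⇔ (cong (λ k → sat B k ψ) (+-comm i 1)))
  shifted Π i R (ψ U χ)      = ⇔Σ λ j → shifted-from Π i j R χ ⇔× ⇔Π λ j′ → ⇔→ (shifted-from Π i j′ R ψ)
  shifted-from {B} Π i j R = shifted (Π from j) (i + j) λ p π m →
    ⇔-trans (table-from Π j p π m) (⇔-trans (R p π (j + m)) (≡⇒⇔ (cong (B p π) (sym (+-assoc i j m)))))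

  ⊨ᵠ⇔sat : ∀ Π ψ → Π ⊨ᵠ ψ ⇔ sat (table Π) 0 ψ
  ⊨ᵠ⇔sat Π = shifted Π 0 λ _ _ _ → ⇔-refl

-- From Hyper²LTL to arithmetic

module HyperToArithmetic (n : ℕ) .{{_ : NonZero n}} where

  module H = Hyper n
  open A using (var; _⊕_; _⊗_; _≐_; _≺_; _∈₁_; _∈₂_; ¬′_; _∨_; ∃′; ∀′; _⊨_)
  open Satisfaction n
  open H using (TraceSet; Trace; Assignment; _∈[_]_; _at_; _U_; X_; ∃X; ∀X; ∃π; ∀π; qf)

  -- x is the current position, o and y are auxiliary positions.
  x o y zero′ one′ : Name
  x     = []
  o     = false ∷ []
  y     = true ∷ []
  zero′ = false ∷ false ∷ []
  one′  = true ∷ true ∷ []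

  -- There are no numerals in the language, so 0 and 1 are variables that `closing` pins down. The
  -- factor `n` in p + x n is fixed and can be written out as `n` summands.
  multiple : ℕ → A.Term
  multiple zero    = var zero′
  multiple (suc k) = var x ⊕ multiple k

  offset : ℕ → A.Term → A.Term
  offset zero    t = t
  offset (suc k) t = var one′ ⊕ offset k t

  position : Fin n → A.Term
  position p = offset (toℕ p) (multiple n)

  className : SOVar → Name
  className Xd      = []
  className Xa      = false ∷ []
  className (var z) = true ∷ z

  -- ψ U χ holds at x iff for some y ≥ x every w with x ≤ w ≤ y satisfies
  -- (w < y and ψ) or χ.  In this form ψ and χ are in prefix notation
  -- translated one directly after the other.
  arithQF : H.QF → A.Formula
  arithQF (p at π)  = position p ∈₁ π
  arithQF (H.¬′ ψ)  = ¬′ arithQF ψ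
  arithQF (ψ H.∨ χ) = arithQF ψ ∨ arithQF χ
  arithQF (X ψ)     = ∀′ number o (¬′ (var o ≐ var x) ∨ ∀′ number x (¬′ (var x ≐ var one′ ⊕ var o) ∨ arithQF ψ))
  arithQF (ψ U χ)   = ∀′ number o (¬′ (var o ≐ var x) ∨ ∃′ number y (¬′ (var y ≺ var o ∨ ¬′ ∀′ number x
    (var x ≺ var o ∨ var y ≺ var x ∨ ¬′ (¬′ (var x ≺ var y) ∨ ¬′ arithQF ψ) ∨ arithQF χ))))

  arith : H.Formula → A.Formula
  arith (∃X Y φ)   = ∃′ class (className Y) (arith φ)
  arith (∀X Y φ)   = ∀′ class (className Y) (arith φ)
  arith (∃π π Y φ) = ∃′ set π (¬′ (¬′ (π ∈₂ className Y) ∨ ¬′ arith φ))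
  arith (∀π π Y φ) = ∀′ set π (¬′ (π ∈₂ className Y) ∨ arith φ)
  arith (qf ψ)     = arithQF ψ

  -- The existential class is the model demanded by satisfiability, and `Xa` is pinned to the class
  -- of all sets. Zero is the solution of z + z = z, one the solution of w w = w other than zero,
  -- and evaluation starts at position zero.
  closing : A.Formula → A.Formula
  closing φ = ∃′ class (className Xd) (∃′ class (className Xa) (¬′ (¬′ ∀′ set [] ([] ∈₂ className Xa) ∨ ¬′
    ∃′ number zero′ (¬′ (¬′ (var zero′ ⊕ var zero′ ≐ var zero′) ∨ ¬′
    ∃′ number one′ (¬′ (¬′ (var one′ ⊗ var one′ ≐ var one′) ∨ (var one′ ≐ var zero′ ∨ ¬′
    ∃′ number x (¬′ (¬′ (var x ≐ var zero′) ∨ ¬′ φ))))))))))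

  className-injective : ∀ {Y Z} → className Y ≡ className Z → Y ≡ Z
  className-injective {Xa}    {Xa}    _    = refl
  className-injective {Xd}    {Xd}    _    = refl
  className-injective {var _} {var _} refl = refl

  at-position : ∀ (p : Fin n) i → (toℕ p + i * n) mod n ≡ p × (toℕ p + i * n) / n ≡ i
  at-position p i = toℕ-injective (trans (toℕ-fromℕ< _) (trans ([m+kn]%n≡m%n (toℕ p) i n) (m<n⇒m%n≡m (toℕ<n p))))
    , trans (+-distrib-/-∣ʳ (toℕ p) (divides-refl i)) (cong₂ _+_ (m<n⇒m/n≡0 (toℕ<n p)) (m*n/n≡m i n))

  position-of : ∀ m → toℕ (m mod n) + (m / n) * n ≡ m
  position-of m = trans (cong (_+ (m / n) * n) (toℕ-fromℕ< _)) (sym (m≡m%n+[m/n]*n m n))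

  ∈⇔ : ∀ (p : Fin n) s → p ∈ₛ s ⇔ (lookup s p ≡ true)
  ∈⇔ p s = mk⇔ []=⇒lookup (lookup⇒[]= p s)

  toSet : Trace → ℕ → Bool
  toSet t m = lookup (t (m / n)) (m mod n)

  toTrace : (ℕ → Bool) → Trace
  toTrace A i = tabulate λ p → A (toℕ p + i * n)

  -- A relation and not a function, because sets and traces are identified only up to pointwise
  -- equality; the classes on both sides respect it.
  Codes : (ℕ → Bool) → Trace → Set
  Codes A t = ∀ p i → A (toℕ p + i * n) ≡ lookup (t i) p

  codes-toSet : ∀ t → Codes (toSet t) t
  codes-toSet t p i = cong₂ (λ j q → lookup (t j) q) (proj₂ (at-position p i)) (proj₁ (at-position p i))

  codes-toTrace : ∀ A → Codes A (toTrace A)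
  codes-toTrace A p i = sym (lookup∘tabulate _ p)

  set-unique : ∀ {A A′ t} → Codes A t → Codes A′ t → A ≗ A′
  set-unique {A} {A′} c c′ m = trans (cong A (sym (position-of m)))
    (trans (trans (c (m mod n) (m / n)) (sym (c′ (m mod n) (m / n)))) (cong A′ (position-of m)))

  trace-unique : ∀ {A t t′} → Codes A t → Codes A t′ → t ≗ t′
  trace-unique c c′ i = trans (sym (tabulate∘lookup _))
    (trans (tabulate-cong λ p → trans (sym (c p i)) (c′ p i)) (tabulate∘lookup _))

  record Pointed (v : Valuation) (i : ℕ) : Set where
    constructor pointed
    field
      at-x : num v x ≡ i
      at-0 : num v zero′ ≡ 0
      at-1 : num v one′ ≡ 1

  eval-multiple : ∀ {v i} → Pointed v i → ∀ k → A.eval v (multiple k) ≡ k * i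
  eval-multiple (pointed _ at-0 _) zero    = at-0
  eval-multiple pt@(pointed at-x _ _) (suc k) = cong₂ _+_ at-x (eval-multiple pt k)

  eval-position : ∀ {v i} → Pointed v i → ∀ p → A.eval v (position p) ≡ toℕ p + i * n
  eval-position {v} {i} pt p = trans (eval-offset (toℕ p)) (cong (toℕ p +_) (*-comm n i))
    where
    eval-offset : ∀ k → A.eval v (offset k (multiple n)) ≡ k + n * i
    eval-offset zero    = eval-multiple pt n
    eval-offset (suc k) = cong₂ _+_ (Pointed.at-1 pt) (eval-offset k)

  module _ (em : ExcludedMiddle 0ℓ) where

    open Classical em

    -- The sets are held fixed by `S` while `v` varies: the translated temporal operators rebind
    -- number variables only.
    satisfied : ∀ {B} (S : Name → ℕ → Bool) → (∀ π p i → (S π (toℕ p + i * n) ≡ true) ⇔ B p π i) →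
      ∀ ψ v i → Pointed v i → (∀ π → st v π ≗ S π) → (v ⊨ arithQF ψ) ⇔ sat B i ψ
    satisfied S R (p at π) v i pt e =
      ⇔-trans (≡⇒⇔ (cong (_≡ true) (trans (e π _) (cong (S π) (eval-position pt p))))) (R π p i)
    satisfied S R (H.¬′ ψ) v i pt e = ⇔¬ (satisfied S R ψ v i pt e)
    satisfied S R (ψ H.∨ χ) v i pt e = satisfied S R ψ v i pt e ⇔⊎ satisfied S R χ v i pt e
    -- `o` keeps the old position while `x` is rebound to its successor, so that every subformula
    -- can refer to the current position as `x`. The universal quantifiers with their equations act
    -- as definitions.
    satisfied {B} S R (X ψ) v i pt@(pointed at-x at-0 at-1) e = mk⇔ to′ from′
      where
      here′ : ∀ k → Valuation
      here′ k = v [ number , o ↦ i ] [ number , x ↦ k ]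
      next-position : ∀ {k} → k ≡ num v one′ + i → (here′ k ⊨ arithQF ψ) ⇔ sat B (suc i) ψ
      next-position {k} eq = satisfied S R ψ (here′ k) (suc i) (pointed (trans eq (cong (_+ i) at-1)) at-0 at-1) e
      to′ : v ⊨ arithQF (X ψ) → sat B (suc i) ψ
      to′ f with f i
      ... | inj₁ ne = contradiction (sym at-x) ne
      ... | inj₂ g with g (num v one′ + i)
      ... | inj₁ ne = contradiction refl ne
      ... | inj₂ h  = fwd (next-position refl) h
      from′ : sat B (suc i) ψ → v ⊨ arithQF (X ψ)
      from′ s j with j ≟ num v x
      ... | no ne = inj₁ ne
      ... | yes eq with trans eq at-x
      ... | refl = inj₂ λ k → after k
        where
        after : ∀ k → ¬ (k ≡ num v one′ + i) ⊎ (here′ k ⊨ arithQF ψ)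
        after k with k ≟ num v one′ + i
        ... | no ne  = inj₁ ne
        ... | yes eq = inj₂ (bwd (next-position eq) s)
    satisfied {B} S R (ψ U χ) v i pt@(pointed at-x at-0 at-1) e = mk⇔ to′ from′
      where
      here′ : ℕ → ℕ → Valuation
      here′ j k = v [ number , o ↦ i ] [ number , y ↦ j ] [ number , x ↦ k ]
      ψ-at : ∀ j k → (here′ j k ⊨ arithQF ψ) ⇔ sat B k ψ
      ψ-at j k = satisfied S R ψ (here′ j k) k (pointed refl at-0 at-1) e
      χ-at : ∀ j k → (here′ j k ⊨ arithQF χ) ⇔ sat B k χ
      χ-at j k = satisfied S R χ (here′ j k) k (pointed refl at-0 at-1) e
      Step : ℕ → ℕ → Set
      Step j k = k < i ⊎ j < k ⊎ (¬ (¬ (k < j) ⊎ ¬ (here′ j k ⊨ arithQF ψ))) ⊎ (here′ j k ⊨ arithQF χ)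
      -- The walk from `i` towards `j` has `d` positions to go. At each one either χ holds and the
      -- walk is over, or ψ holds and `j` lies strictly ahead; as the latter fails at `j` itself, χ
      -- is met there at the latest.
      search : ∀ j → (∀ k → Step j k) → ∀ d c → i + c + d ≡ j → (∀ c′ → c′ < c → sat B (i + c′) ψ) →
        ∃[ c ] sat B (i + c) χ × (∀ c′ → c′ < c → sat B (i + c′) ψ)
      search j f d c eq before with f (i + c)
      ... | inj₁ lt = contradiction (m≤m+n i c) (<⇒≱ lt)
      ... | inj₂ (inj₁ gt) = contradiction (≤-trans (m≤m+n (i + c) d) (≤-reflexive eq)) (<⇒≱ gt)
      ... | inj₂ (inj₂ (inj₂ h)) = c , fwd (χ-at j (i + c)) h , before
      ... | inj₂ (inj₂ (inj₁ h)) with fwd conj h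
      search j f zero c eq before | inj₂ (inj₂ (inj₁ h)) | lt , _ =
        contradiction (trans (sym (+-identityʳ (i + c))) eq) (<⇒≢ lt)
      search j f (suc d) c eq before | inj₂ (inj₂ (inj₁ h)) | _ , p =
        search j f d (suc c) (trans (trans (cong (_+ d) (+-suc i c)) (sym (+-suc (i + c) d))) eq) before′
        where
        before′ : ∀ c′ → c′ < suc c → sat B (i + c′) ψ
        before′ c′ c′< with m≤n⇒m<n∨m≡n (≤-pred c′<)
        ... | inj₁ lt   = before c′ lt
        ... | inj₂ refl = fwd (ψ-at j (i + c)) p
      to′ : v ⊨ arithQF (ψ U χ) → sat B i (ψ U χ)
      to′ f with f i
      ... | inj₁ ne = contradiction (sym at-x) ne
      ... | inj₂ (j , g) with ≮⇒≥ (g ∘ inj₁) | stable (g ∘ inj₂)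
      ... | i≤j | h = search j h (j ∸ i) 0 (trans (cong (_+ (j ∸ i)) (+-identityʳ i)) (m+[n∸m]≡n i≤j)) λ _ ()
      from′ : sat B i (ψ U χ) → v ⊨ arithQF (ψ U χ)
      from′ (c , sχ , sψ) k with k ≟ num v x
      ... | no ne = inj₁ ne
      ... | yes eq with trans eq at-x
      ... | refl = inj₂ (i + c , λ { (inj₁ lt) → <⇒≱ lt (m≤m+n i c) ; (inj₂ nf) → nf steps })
        where
        steps : ∀ k → Step (i + c) k
        steps k with k <? i
        ... | yes lt = inj₁ lt
        ... | no nlt with <-cmp k (i + c)
        ... | tri> _ _ gt = inj₂ (inj₁ gt)
        ... | tri≈ _ refl _ = inj₂ (inj₂ (inj₂ (bwd (χ-at (i + c) k) sχ)))
        ... | tri< lt _ _ = inj₂ (inj₂ (inj₁ (bwd conj (lt ,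
          bwd (ψ-at (i + c) k) (subst (λ m → sat B m ψ) (m+[n∸m]≡n (≮⇒≥ nlt))
            (sψ (k ∸ i) (+-cancelˡ-< i _ _ (subst (_< i + c) (sym (m+[n∸m]≡n (≮⇒≥ nlt))) lt))))))))

    record Simulates (Π : Assignment) (v : Valuation) : Set where
      field
        sets    : ∀ π p i → (st v π (toℕ p + i * n) ≡ true) ⇔ table Π p π i
        classes : ∀ Y {A t} → Codes A t → (Func.to (cls v (className Y)) A ≡ true) ⇔ (t ∈[ Π ] Y)
    open Simulates

    Agree : A.⟦ class ⟧ → TraceSet → Set
    Agree C T = ∀ A t → Codes A t → Func.to C A ≡ Func.to T t

    toClass : TraceSet → A.⟦ class ⟧
    toClass T = record
      { to   = λ A → Func.to T (toTrace A)
      ; cong = λ e → Func.cong T λ i → tabulate-cong λ p → e _ }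

    toTraceSet : A.⟦ class ⟧ → TraceSet
    toTraceSet C = record
      { to   = λ t → Func.to C (toSet t)
      ; cong = λ e → Func.cong C λ m → cong (λ s → lookup s _) (e _) }

    agree-toClass : ∀ T → Agree (toClass T) T
    agree-toClass T A t c = Func.cong T (trace-unique {A} {toTrace A} {t} (codes-toTrace A) c)

    agree-toTraceSet : ∀ C → Agree C (toTraceSet C)
    agree-toTraceSet C A t c = Func.cong C (set-unique {A} {toSet t} {t} c (codes-toSet t))

    simulates-class : ∀ {Π v C T} Y → Agree C T → Simulates Π v →
      Simulates (Π H.[ Y ↦ˢ T ]) (v [ class , className Y ↦ C ])
    sets (simulates-class Y ag sim) = sets sim
    classes (simulates-class {Π} {v} {C} {T} Y ag sim) Z {A} {t} c with Y ≟ˢ Z | className Y ≟ⁿ className Z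
    ... | yes _    | yes _  = ⇔-trans (≡⇒⇔ (cong (_≡ true) (ag A t c))) (⇔-sym just⇔)
    ... | yes refl | no ne  = contradiction refl ne
    ... | no ne    | yes eq = contradiction (className-injective eq) ne
    ... | no _     | no _   = classes sim Z {A} {t} c

    simulates-set : ∀ {Π v A t} π → Codes A t → Simulates Π v →
      Simulates (Π H.[ π ↦ᵗ t ]) (v [ set , π ↦ A ])
    sets (simulates-set {Π} {v} {A} {t} π c sim) ρ p i with π ≟ⁿ ρ
    ... | yes _ = ⇔-trans (≡⇒⇔ (cong (_≡ true) (c p i))) (⇔-trans (⇔-sym (∈⇔ p (t i))) (⇔-sym just⇔))
    ... | no _  = sets sim ρ p i
    classes (simulates-set π c sim) Y {A} {t} = classes sim Y {A} {t}

    member : ∀ {Π v A t} π Y → Codes A t → Simulates Π v →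
      (v [ set , π ↦ A ] ⊨ π ∈₂ className Y) ⇔ (t ∈[ Π ] Y)
    member {v = v} {A} {t} π Y c sim = ⇔-trans (≡⇒⇔ (cong (λ B → Func.to (cls v (className Y)) B ≡ true) (override-same (st v) π A))) (classes sim Y {A} {t} c)

    translates : ∀ φ {Π v} → Simulates Π v → Pointed v 0 → (v ⊨ arith φ) ⇔ (Π H.⊨ φ)
    translates (∃X Y φ) sim (pointed a b c) = mk⇔
      (λ (C , h) → toTraceSet C , fwd (translates φ (simulates-class Y (agree-toTraceSet C) sim) (pointed a b c)) h)
      (λ (T , h) → toClass T , bwd (translates φ (simulates-class Y (agree-toClass T) sim) (pointed a b c)) h)
    translates (∀X Y φ) sim (pointed a b c) = mk⇔
      (λ h T → fwd (translates φ (simulates-class Y (agree-toClass T) sim) (pointed a b c)) (h (toClass T)))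
      (λ h C → bwd (translates φ (simulates-class Y (agree-toTraceSet C) sim) (pointed a b c)) (h (toTraceSet C)))
    translates (∃π π Y φ) sim (pointed a b c) = mk⇔
      (λ (A , h) → let m , k = fwd conj h in toTrace A , fwd (member {A = A} π Y (codes-toTrace A) sim) m
        , fwd (translates φ (simulates-set {A = A} π (codes-toTrace A) sim) (pointed a b c)) k)
      (λ (t , m , h) → toSet t , bwd conj (bwd (member {t = t} π Y (codes-toSet t) sim) m
        , bwd (translates φ (simulates-set {t = t} π (codes-toSet t) sim) (pointed a b c)) h))
    translates (∀π π Y φ) sim (pointed a b c) = mk⇔
      (λ h t m → fwd (translates φ (simulates-set {t = t} π (codes-toSet t) sim) (pointed a b c))
        (fwd impl (h (toSet t)) (bwd (member {t = t} π Y (codes-toSet t) sim) m)))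
      (λ h A → bwd impl λ m → bwd (translates φ (simulates-set {A = A} π (codes-toTrace A) sim) (pointed a b c))
        (h (toTrace A) (fwd (member {A = A} π Y (codes-toTrace A) sim) m)))
    translates (qf ψ) {Π} {v} sim pt =
      ⇔-trans (satisfied (st v) (sets sim) ψ v 0 pt λ _ _ → refl) (⇔-sym (⊨ᵠ⇔sat Π ψ))

    double≡0 : ∀ {m} → m + m ≡ m → m ≡ 0
    double≡0 {m} e = +-cancelˡ-≡ m m 0 (trans e (sym (+-identityʳ m)))

    square≡1 : ∀ {m} → m * m ≡ m → m ≢ 0 → m ≡ 1
    square≡1 {zero}  e ne = contradiction refl ne
    square≡1 {suc m} e ne = *-cancelˡ-≡ (suc m) 1 (suc m) (trans e (sym (*-identityʳ (suc m))))

    allSets : A.⟦ class ⟧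
    allSets = record { to = const true ; cong = const refl }

    closing-correct : ∀ φ → (A.default ⊨ closing (arith φ)) ⇔ (∃[ T ] H.initial T H.⊨ φ)
    closing-correct φ = mk⇔ to′ from′
      where
      started : ∀ C D → Valuation
      started C D = A.default [ class , className Xd ↦ C ] [ class , className Xa ↦ D ]
      based : ∀ {C D T z w q} → Agree C T → (∀ A → Func.to D A ≡ true) →
        Simulates (H.initial T) (started C D [ number , zero′ ↦ z ] [ number , one′ ↦ w ] [ number , x ↦ q ])
      -- Undefined variables are false and the default sets and classes are empty, so both sides
      -- agree already before anything is bound.
      sets (based ag all) π p i = mk⇔ (λ ()) (λ ())
      classes (based ag all) Xa {A} c      = mk⇔ (λ _ → just refl) (λ _ → all A)
      classes (based ag all) Xd {A} {t} c    = ⇔-trans (≡⇒⇔ (cong (_≡ true) (ag A t c))) (⇔-sym just⇔)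
      classes (based ag all) (var z) c = mk⇔ (λ ()) (λ ())
      to′ : A.default ⊨ closing (arith φ) → ∃[ T ] H.initial T H.⊨ φ
      to′ (C , D , h₀) with fwd conj h₀
      ... | all , z , h₁ with fwd conj h₁
      ... | z≡0 , w , h₂ with stable (h₂ ∘ inj₁) | stable (h₂ ∘ inj₂ ∘ inj₂)
      ... | w≡1 | q , h₃ with fwd conj h₃
      ... | q≡0 , h = toTraceSet C , fwd (translates φ (based (agree-toTraceSet C) all)
        (pointed (trans q≡0 (double≡0 z≡0)) (double≡0 z≡0)
          (square≡1 w≡1 λ w≡0 → h₂ (inj₂ (inj₁ (trans w≡0 (sym (double≡0 z≡0)))))))) h
      from′ : ∃[ T ] H.initial T H.⊨ φ → A.default ⊨ closing (arith φ)
      from′ (T , h) = toClass T , allSets , bwd conj ((λ A → refl) , 0 , bwd conj (refl , 1 ,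
        λ { (inj₁ ne) → ne refl ; (inj₂ (inj₂ nh)) → nh (0 , bwd conj (refl ,
          bwd (translates φ (based (agree-toClass T) λ _ → refl) (pointed refl refl refl)) h)) }))

  -- Free variables of the translation into arithmetic

  Constant : Name → Set
  Constant z = z ≡ x ⊎ z ≡ zero′ ⊎ z ≡ one′

  occurs-multiple : ∀ {z} k → A.OccursIn z (multiple k) → Constant z
  occurs-multiple zero    refl        = inj₂ (inj₁ refl)
  occurs-multiple (suc k) (inj₁ refl) = inj₁ refl
  occurs-multiple (suc k) (inj₂ h)    = occurs-multiple k h

  occurs-position : ∀ {z} k → A.OccursIn z (offset k (multiple n)) → Constant z
  occurs-position zero    h           = occurs-multiple n h
  occurs-position (suc k) (inj₁ refl) = inj₂ (inj₂ refl)
  occurs-position (suc k) (inj₂ h)    = occurs-position k h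

  FreeQF : A.Sort → Name → H.QF → Set
  FreeQF s z ψ = (s ≡ number × Constant z) ⊎ (s ≡ set × H.FreeInQF z ψ)

  weakenQF : ∀ {s z ψ χ} → (H.FreeInQF z ψ → H.FreeInQF z χ) → FreeQF s z ψ → FreeQF s z χ
  weakenQF f (inj₁ c)       = inj₁ c
  weakenQF f (inj₂ (e , h)) = inj₂ (e , f h)

  free-arithQF : ∀ {s z} ψ → A.Free s z (arithQF ψ) → FreeQF s z ψ
  free-arithQF (p at π)  (inj₁ (e , h)) = inj₁ (e , occurs-position (toℕ p) h)
  free-arithQF (p at π)  (inj₂ (e , h)) = inj₂ (e , h)
  free-arithQF (H.¬′ ψ)  h              = weakenQF {ψ = ψ} {H.¬′ ψ} id (free-arithQF ψ h)
  free-arithQF (ψ H.∨ χ) (inj₁ h)       = weakenQF {ψ = ψ} {ψ H.∨ χ} inj₁ (free-arithQF ψ h)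
  free-arithQF (ψ H.∨ χ) (inj₂ h)       = weakenQF {ψ = χ} {ψ H.∨ χ} inj₂ (free-arithQF χ h)
  free-arithQF (X ψ) (z≢o , inj₁ (e , inj₁ eq)) = contradiction (e , eq) z≢o
  free-arithQF (X ψ) (z≢o , inj₁ (e , inj₂ eq)) = inj₁ (e , inj₁ eq)
  free-arithQF (X ψ) (z≢o , inj₂ (z≢x , inj₁ (e , inj₁ eq)))        = contradiction (e , eq) z≢x
  free-arithQF (X ψ) (z≢o , inj₂ (z≢x , inj₁ (e , inj₂ (inj₁ eq)))) = inj₁ (e , inj₂ (inj₂ eq))
  free-arithQF (X ψ) (z≢o , inj₂ (z≢x , inj₁ (e , inj₂ (inj₂ eq)))) = contradiction (e , eq) z≢o
  free-arithQF (X ψ) (z≢o , inj₂ (z≢x , inj₂ h)) = weakenQF {ψ = ψ} {X ψ} id (free-arithQF ψ h)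
  free-arithQF (ψ U χ) (z≢o , inj₁ (e , inj₁ eq)) = contradiction (e , eq) z≢o
  free-arithQF (ψ U χ) (z≢o , inj₁ (e , inj₂ eq)) = inj₁ (e , inj₁ eq)
  free-arithQF (ψ U χ) (z≢o , inj₂ (z≢y , inj₁ (e , inj₁ eq))) = contradiction (e , eq) z≢y
  free-arithQF (ψ U χ) (z≢o , inj₂ (z≢y , inj₁ (e , inj₂ eq))) = contradiction (e , eq) z≢o
  free-arithQF {s} {z} (ψ U χ) (z≢o , inj₂ (z≢y , inj₂ (z≢x , h))) = inside h
    where
    inside : A.Free s z (var x ≺ var o ∨ var y ≺ var x ∨ ¬′ (¬′ (var x ≺ var y) ∨ ¬′ arithQF ψ) ∨ arithQF χ) → FreeQF s z (ψ U χ)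
    inside (inj₁ (e , inj₁ eq)) = contradiction (e , eq) z≢x
    inside (inj₁ (e , inj₂ eq)) = contradiction (e , eq) z≢o
    inside (inj₂ (inj₁ (e , inj₁ eq))) = contradiction (e , eq) z≢y
    inside (inj₂ (inj₁ (e , inj₂ eq))) = contradiction (e , eq) z≢x
    inside (inj₂ (inj₂ (inj₁ (inj₁ (e , inj₁ eq))))) = contradiction (e , eq) z≢x
    inside (inj₂ (inj₂ (inj₁ (inj₁ (e , inj₂ eq))))) = contradiction (e , eq) z≢y
    inside (inj₂ (inj₂ (inj₁ (inj₂ h)))) = weakenQF {ψ = ψ} {ψ U χ} inj₁ (free-arithQF ψ h)
    inside (inj₂ (inj₂ (inj₂ h)))        = weakenQF {ψ = χ} {ψ U χ} inj₂ (free-arithQF χ h)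

  FreeIn : A.Sort → Name → H.Formula → Set
  FreeIn s z φ = (s ≡ number × Constant z) ⊎ (s ≡ set × H.TraceVarFree z φ) ⊎ (s ≡ class × ∃[ Y ] z ≡ className Y × H.SOVarFree Y φ)

  weaken : ∀ {s z φ χ} → (s ≡ set → H.TraceVarFree z φ → H.TraceVarFree z χ) →
    (s ≡ class → ∀ Y → z ≡ className Y → H.SOVarFree Y φ → H.SOVarFree Y χ) → FreeIn s z φ → FreeIn s z χ
  weaken f g (inj₁ c)                           = inj₁ c
  weaken f g (inj₂ (inj₁ (refl , h)))           = inj₂ (inj₁ (refl , f refl h))
  weaken f g (inj₂ (inj₂ (refl , Y , eq , h))) = inj₂ (inj₂ (refl , Y , eq , g refl Y eq h))

  free-arith : ∀ {s z} φ → A.Free s z (arith φ) → FreeIn s z φ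
  free-arith (∃X Y φ) (ne , h) = weaken {φ = φ} {∃X Y φ} (λ _ → id)
    (λ { refl Z refl h → (λ Z≡Y → ne (refl , cong className Z≡Y)) , h }) (free-arith φ h)
  free-arith (∀X Y φ) (ne , h) = weaken {φ = φ} {∀X Y φ} (λ _ → id)
    (λ { refl Z refl h → (λ Z≡Y → ne (refl , cong className Z≡Y)) , h }) (free-arith φ h)
  free-arith (∃π π Y φ) (ne , inj₁ (inj₁ eqs))          = contradiction eqs ne
  free-arith (∃π π Y φ) (ne , inj₁ (inj₂ (refl , refl))) = inj₂ (inj₂ (refl , Y , refl , inj₁ refl))
  free-arith (∃π π Y φ) (ne , inj₂ h) = weaken {φ = φ} {∃π π Y φ}
    (λ { refl h → (λ eq → ne (refl , eq)) , h }) (λ _ _ _ → inj₂) (free-arith φ h)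
  free-arith (∀π π Y φ) (ne , inj₁ (inj₁ eqs))          = contradiction eqs ne
  free-arith (∀π π Y φ) (ne , inj₁ (inj₂ (refl , refl))) = inj₂ (inj₂ (refl , Y , refl , inj₁ refl))
  free-arith (∀π π Y φ) (ne , inj₂ h) = weaken {φ = φ} {∀π π Y φ}
    (λ { refl h → (λ eq → ne (refl , eq)) , h }) (λ _ _ _ → inj₂) (free-arith φ h)
  free-arith (qf ψ) h with free-arithQF ψ h
  ... | inj₁ c = inj₁ c
  ... | inj₂ h = inj₂ (inj₁ h)

  closed : ∀ φ → H.IsSentence φ → ∀ s z → ¬ A.Free s z (closing (arith φ))
  closed φ (noTraces , noSets) s z (≢Xd , ≢Xa , inj₁ (≢[] , inj₁ eq)) = ≢[] eq
  closed φ (noTraces , noSets) s z (≢Xd , ≢Xa , inj₁ (≢[] , inj₂ eq)) = ≢Xa eq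
  closed φ (noTraces , noSets) s z (≢Xd , ≢Xa , inj₂ (≢0 , inj₁ (e , inj₁ (inj₁ eq)))) = ≢0 (e , eq)
  closed φ (noTraces , noSets) s z (≢Xd , ≢Xa , inj₂ (≢0 , inj₁ (e , inj₁ (inj₂ eq)))) = ≢0 (e , eq)
  closed φ (noTraces , noSets) s z (≢Xd , ≢Xa , inj₂ (≢0 , inj₁ (e , inj₂ eq))) = ≢0 (e , eq)
  closed φ (noTraces , noSets) s z (≢Xd , ≢Xa , inj₂ (≢0 , inj₂ (≢1 , h))) = inside h
    where
    inside : ¬ (((s ≡ number × ((z ≡ one′ ⊎ z ≡ one′) ⊎ z ≡ one′)) ⊎ (s ≡ number × (z ≡ one′ ⊎ z ≡ zero′)) ⊎
      (¬ (s ≡ number × z ≡ x)) × ((s ≡ number × (z ≡ x ⊎ z ≡ zero′)) ⊎ A.Free s z (arith φ))))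
    inside (inj₁ (e , inj₁ (inj₁ eq))) = ≢1 (e , eq)
    inside (inj₁ (e , inj₁ (inj₂ eq))) = ≢1 (e , eq)
    inside (inj₁ (e , inj₂ eq)) = ≢1 (e , eq)
    inside (inj₂ (inj₁ (e , inj₁ eq))) = ≢1 (e , eq)
    inside (inj₂ (inj₁ (e , inj₂ eq))) = ≢0 (e , eq)
    inside (inj₂ (inj₂ (≢x , inj₁ (e , inj₁ eq)))) = ≢x (e , eq)
    inside (inj₂ (inj₂ (≢x , inj₁ (e , inj₂ eq)))) = ≢0 (e , eq)
    inside (inj₂ (inj₂ (≢x , inj₂ h))) with free-arith φ h
    ... | inj₁ (e , inj₁ eq)        = ≢x (e , eq)
    ... | inj₁ (e , inj₂ (inj₁ eq)) = ≢0 (e , eq)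
    ... | inj₁ (e , inj₂ (inj₂ eq)) = ≢1 (e , eq)
    ... | inj₂ (inj₁ (_ , h))       = noTraces z h
    ... | inj₂ (inj₂ (refl , Y , refl , h)) with noSets Y h
    ... | inj₁ refl = ≢Xa (refl , refl)
    ... | inj₂ refl = ≢Xd (refl , refl)

  reduceA : H.Sentence → A.Sentence
  reduceA (φ , sentence) = closing (arith φ) , closed φ sentence

-- A machine for the translation into arithmetic

abstract
  prop-cost : ∀ a → (2 + a) + (2 + 3 * a) ≡ 4 * suc a
  prop-cost = solve-∀

  unary-cost : ∀ a → (2 + 4 * a) + 2 ≡ 4 * suc a
  unary-cost = solve-∀

  binary-cost : ∀ a b → (2 + (4 * a + 4 * b)) + 2 ≡ 4 * suc (a + b)
  binary-cost = solve-∀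

  setQuantifier-cost : ∀ a b → (2 + ((2 + b) + 4 * a)) + 3 * b ≡ 4 * suc (b + a)
  setQuantifier-cost = solve-∀

  traceQuantifier-cost : ∀ p a b → (2 + (p + ((2 + b) + 4 * a))) + (3 * p + 3 * b) ≡ 4 * suc (p + (b + a))
  traceQuantifier-cost = solve-∀

name-++ : ∀ {A : Set} (bit : Bool → A) (e : A) x (rest : List A) → (map bit x ++ e ∷ []) ++ rest ≡ map bit x ++ e ∷ rest
name-++ bit e x rest = ++-assoc (map bit x) (e ∷ []) rest

length-name : ∀ {A : Set} (bit : Bool → A) (e : A) x → length (map bit x ++ e ∷ []) ≡ suc (length x)
length-name bit e x = trans (length-++ (map bit x)) (trans (+-comm _ 1) (cong suc (length-map bit x)))

module HyperToArithmeticMachine (n : ℕ) .{{_ : NonZero n}} where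

  open HyperToArithmetic n
  open H using (_at_; _U_; X_; ∃X; ∀X; ∃π; ∀π; qf; Token; encodeQF; encodeSOVar; encodeName)
  open A using (var; _⊕_; _⊗_; _≐_; _≺_; _∈₂_; ¬′_; _∨_; ∀′)

  header nextTokens untilTokens : List A.Token
  header =
    A.‵∃ class ∷ A.encodeName (className Xd) ++ A.‵∃ class ∷ A.encodeName (className Xa) ++
    A.‵¬ ∷ A.‵∨ ∷ A.‵¬ ∷ A.encode (∀′ set [] ([] ∈₂ className Xa)) ++ A.‵¬ ∷
    A.‵∃ number ∷ A.encodeName zero′ ++ A.‵¬ ∷ A.‵∨ ∷ A.‵¬ ∷ A.encode (var zero′ ⊕ var zero′ ≐ var zero′) ++ A.‵¬ ∷
    A.‵∃ number ∷ A.encodeName one′ ++ A.‵¬ ∷ A.‵∨ ∷ A.‵¬ ∷ A.encode (var one′ ⊗ var one′ ≐ var one′) ++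
    A.‵∨ ∷ A.encode (var one′ ≐ var zero′) ++ A.‵¬ ∷
    A.‵∃ number ∷ A.encodeName x ++ A.‵¬ ∷ A.‵∨ ∷ A.‵¬ ∷ A.encode (var x ≐ var zero′) ++ A.‵¬ ∷ []
  nextTokens =
    A.‵∀ number ∷ A.encodeName o ++ A.‵∨ ∷ A.encode (¬′ (var o ≐ var x)) ++
    A.‵∀ number ∷ A.encodeName x ++ A.‵∨ ∷ A.encode (¬′ (var x ≐ var one′ ⊕ var o))
  untilTokens =
    A.‵∀ number ∷ A.encodeName o ++ A.‵∨ ∷ A.encode (¬′ (var o ≐ var x)) ++
    A.‵∃ number ∷ A.encodeName y ++ A.‵¬ ∷ A.‵∨ ∷ A.encode (var y ≺ var o) ++
    A.‵¬ ∷ A.‵∀ number ∷ A.encodeName x ++ A.‵∨ ∷ A.encode (var x ≺ var o) ++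
    A.‵∨ ∷ A.encode (var y ≺ var x) ++ A.‵∨ ∷ A.‵¬ ∷ A.‵∨ ∷ A.encode (¬′ (var x ≺ var y)) ++ A.‵¬ ∷ []

  -- The output follows the order of the input tokens, so this machine never uses its stack. In `so`
  -- and its variants the Boolean tells whether the guard belongs to an existential trace quantifier
  -- and is therefore followed by a negation.
  data K : Set where
    start rd : K
    act      : Token → K
    so soXa soXd soVar : Bool → K
    skipTo   : Maybe Bool → K

  fin-Token : Finite Token
  fin-Token = H.tokens , H.∈-tokens

  K-finite : Finite K
  K-finite = fin-onto
    (λ { (inj₁ true) → start ; (inj₁ false) → rd ; (inj₂ (inj₁ t)) → act t
       ; (inj₂ (inj₂ (inj₁ b))) → so b ; (inj₂ (inj₂ (inj₂ (inj₁ b)))) → soXa b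
       ; (inj₂ (inj₂ (inj₂ (inj₂ (inj₁ b))))) → soXd b ; (inj₂ (inj₂ (inj₂ (inj₂ (inj₂ (inj₁ b)))))) → soVar b
       ; (inj₂ (inj₂ (inj₂ (inj₂ (inj₂ (inj₂ (inj₁ b))))))) → skipTo (just b)
       ; (inj₂ (inj₂ (inj₂ (inj₂ (inj₂ (inj₂ (inj₂ tt))))))) → skipTo nothing })
    (λ { start → inj₁ true ; rd → inj₁ false ; (act t) → inj₂ (inj₁ t)
       ; (so b) → inj₂ (inj₂ (inj₁ b)) ; (soXa b) → inj₂ (inj₂ (inj₂ (inj₁ b)))
       ; (soXd b) → inj₂ (inj₂ (inj₂ (inj₂ (inj₁ b)))) ; (soVar b) → inj₂ (inj₂ (inj₂ (inj₂ (inj₂ (inj₁ b)))))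
       ; (skipTo (just b)) → inj₂ (inj₂ (inj₂ (inj₂ (inj₂ (inj₂ (inj₁ b))))))
       ; (skipTo nothing) → inj₂ (inj₂ (inj₂ (inj₂ (inj₂ (inj₂ (inj₂ tt)))))) })
    (λ { start → refl ; rd → refl ; (act t) → refl ; (so b) → refl ; (soXa b) → refl
       ; (soXd b) → refl ; (soVar b) → refl ; (skipTo (just b)) → refl ; (skipTo nothing) → refl })
    (fin-⊎ fin-Bool (fin-⊎ fin-Token (fin-⊎ fin-Bool (fin-⊎ fin-Bool (fin-⊎ fin-Bool (fin-⊎ fin-Bool
      (fin-⊎ fin-Bool fin-⊤)))))))

  -- What separates the guard from the body of a trace quantifier.
  separator : Bool → List A.Token
  separator true  = A.‵¬ ∷ []
  separator false = []

  -- Printing does not move past the name, so a trace quantifier can print it twice, in the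
  -- quantifier and in the guard, before `skipTo` leaves it.
  nameThen : List (Item A.Token) → List (Item A.Token)
  nameThen is = name ∷ emit A.‵end ∷ is

  actScript : Token → List (Item A.Token)
  actScript H.‵¬        = emit A.‵¬ ∷ []
  actScript H.‵∨        = emit A.‵∨ ∷ []
  actScript H.‵X        = map emit nextTokens
  actScript H.‵U        = map emit untilTokens
  actScript (H.‵prop p) = map emit (A.‵∈₁ ∷ A.encodeTerm (position p)) ++ nameThen []
  actScript H.‵∃X       = emit (A.‵∃ class) ∷ []
  actScript H.‵∀X       = emit (A.‵∀ class) ∷ []
  actScript H.‵∃π       = emit (A.‵∃ set) ∷ nameThen (map emit (A.‵¬ ∷ A.‵∨ ∷ A.‵¬ ∷ A.‵∈₂ ∷ []) ++ nameThen [])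
  actScript H.‵∀π       = emit (A.‵∀ set) ∷ nameThen (map emit (A.‵∨ ∷ A.‵¬ ∷ A.‵∈₂ ∷ []) ++ nameThen [])
  actScript _           = []

  script : K → List (Item A.Token)
  script start     = map emit header
  script (act t)   = actScript t
  script (soXa b)  = map emit (A.‵bit false ∷ A.‵end ∷ separator b)
  script (soXd b)  = map emit (A.‵end ∷ separator b)
  script (soVar b) = emit (A.‵bit true) ∷ nameThen (map emit (separator b))
  script _         = []

  afterAct : Token → K
  afterAct (H.‵prop p) = skipTo nothing
  afterAct H.‵∃X       = so false
  afterAct H.‵∀X       = so false
  afterAct H.‵∃π       = skipTo (just true)
  afterAct H.‵∀π       = skipTo (just false)
  afterAct _           = rd

  afterSkip : Maybe Bool → K
  afterSkip nothing  = rd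
  afterSkip (just b) = so b

  decide : K → Maybe Token → Maybe StackCell → Maybe (Action K)
  decide start      _                  _ = just (go false keep rd)
  decide rd         (just t)           _ = just (go true keep (act t))
  decide rd         nothing            _ = nothing
  decide (act t)    _                  _ = just (go false keep (afterAct t))
  decide (so b)     (just H.‵Xa)       _ = just (go true keep (soXa b))
  decide (so b)     (just H.‵Xd)       _ = just (go true keep (soXd b))
  decide (so b)     _                  _ = just (go false keep (soVar b))
  decide (soXa b)   _                  _ = just (go false keep rd)
  decide (soXd b)   _                  _ = just (go false keep rd)
  decide (soVar b)  _                  _ = just (go false keep (skipTo nothing))
  decide (skipTo d) (just (H.‵bit _))  _ = just (go true keep (skipTo d))
  decide (skipTo d) _                  _ = just (go true keep (afterSkip d))

  bit? : Token → Maybe Bool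
  bit? (H.‵bit b) = just b
  bit? _          = nothing

  bit?-bit : ∀ b → bit? (H.‵bit b) ≡ just b
  bit?-bit b = refl

  open Scripted H.‵bit bit? bit?-bit A.‵bit K-finite start script decide

  goStay : ∀ {N k ls rs out o k′} → EmitsAll N (script k) ls rs [] o →
    decide k (List.head rs) nothing ≡ just (go false keep k′) →
    N ⊢ ⟨ k , ls , rs , [] , out ⟩ ⇒≤[ 1 ] ⟨ k′ , ls , rs , [] , o ʳ++ out ⟩
  goStay es eq = one (goes es eq stay keep)

  skipName : ∀ {N} d x ls rest out → N ⊢ ⟨ skipTo d , ls , encodeName x ++ rest , [] , out ⟩ ⇒≤[ length (encodeName x) ]
    ⟨ afterSkip d , encodeName x ʳ++ ls , rest , [] , out ⟩
  skipName d []       ls rest out = one (goes [] refl right keep)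
  skipName d (b ∷ x) ls rest out = one (goes [] refl right keep) then skipName d x (H.‵bit b ∷ ls) rest out

  readToken : ∀ {N t ls rs out o} → EmitsAll N (actScript t) (t ∷ ls) rs [] o →
    N ⊢ ⟨ rd , ls , t ∷ rs , [] , out ⟩ ⇒≤[ 2 ] ⟨ afterAct t , t ∷ ls , rs , [] , o ʳ++ out ⟩
  readToken es = one (goes [] refl right keep) then goStay es refl

  nameItem : ∀ {N T ls x rest} → bit? T ≡ nothing → length x ≤ N →
    Emits N name (T ∷ ls) (encodeName x ++ rest) [] (map A.‵bit x)
  nameItem {x = x} {rest} eq x≤ =
    subst (λ rs → Emits _ name _ rs [] _) (sym (name-++ H.‵bit H.‵end x rest)) (name x eq refl x≤)

  name≤ : ∀ {N} x → length (encodeName x) ≤ N → length x ≤ N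
  name≤ x le = ≤-trans (n≤1+n _) (≤-trans (≤-reflexive (sym (length-name H.‵bit H.‵end x))) le)

  ++-≤ˡ : ∀ {A : Set} {N} (xs : List A) {ys} → length (xs ++ ys) ≤ N → length xs ≤ N
  ++-≤ˡ xs le = ≤-trans (≤-trans (m≤m+n _ _) (≤-reflexive (sym (length-++ xs)))) le

  ++-≤ʳ : ∀ {A : Set} {N} (xs : List A) {ys} → length (xs ++ ys) ≤ N → length ys ≤ N
  ++-≤ʳ xs le = ≤-trans (≤-trans (m≤n+m _ (length xs)) (≤-reflexive (sym (length-++ xs)))) le

  both : ∀ {N} e₁ e₂ a₁ a₂ ls rest out →
    (∀ ls rest out → N ⊢ ⟨ rd , ls , e₁ ++ rest , [] , out ⟩ ⇒≤[ 4 * length e₁ ] ⟨ rd , e₁ ʳ++ ls , rest , [] , a₁ ʳ++ out ⟩) →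
    (∀ ls rest out → N ⊢ ⟨ rd , ls , e₂ ++ rest , [] , out ⟩ ⇒≤[ 4 * length e₂ ] ⟨ rd , e₂ ʳ++ ls , rest , [] , a₂ ʳ++ out ⟩) →
    N ⊢ ⟨ rd , ls , (e₁ ++ e₂) ++ rest , [] , out ⟩ ⇒≤[ 4 * length e₁ + 4 * length e₂ ]
      ⟨ rd , (e₁ ++ e₂) ʳ++ ls , rest , [] , (a₁ ++ a₂) ʳ++ out ⟩
  both e₁ e₂ a₁ a₂ ls rest out r₁ r₂ =
    source (cong (λ rs → ⟨ rd , ls , rs , [] , out ⟩) (++-assoc e₁ e₂ rest))
      (target (cong₂ (λ ls o → ⟨ rd , ls , rest , [] , o ⟩) (sym (++-ʳ++ e₁)) (sym (++-ʳ++ a₁)))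
        (r₁ _ _ _ then r₂ _ _ _))

  binary≤ : ∀ (e₁ e₂ : List Token) → 2 + (4 * length e₁ + 4 * length e₂) ≤ 4 * suc (length (e₁ ++ e₂))
  binary≤ e₁ e₂ = ≤-trans (≤-by 2 (binary-cost (length e₁) (length e₂)))
    (≤-reflexive (cong (λ l → 4 * suc l) (sym (length-++ e₁))))

  -- A bit or the end of a name takes one control step, and the overhead at any other token is
  -- bounded; four steps per token leave room for every case.
  runQF : ∀ {N} ψ ls rest out → length (encodeQF ψ) ≤ N →
    N ⊢ ⟨ rd , ls , encodeQF ψ ++ rest , [] , out ⟩ ⇒≤[ 4 * length (encodeQF ψ) ]
      ⟨ rd , encodeQF ψ ʳ++ ls , rest , [] , A.encode (arithQF ψ) ʳ++ out ⟩
  runQF (p at π) ls rest out le = atMost (≤-by _ (prop-cost (length (encodeName π))))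
    (readToken (emits-++ (emits-map (A.‵∈₁ ∷ A.encodeTerm (position p)))
        (nameItem {x = π} refl (name≤ π (≤-trans (n≤1+n _) le)) ∷ emit ∷ []))
      then skipName nothing π _ rest _)
  runQF (H.¬′ ψ) ls rest out le = atMost (≤-by _ (unary-cost (length (encodeQF ψ))))
    (readToken (emit ∷ []) then runQF ψ _ rest _ (≤-trans (n≤1+n _) le))
  runQF (ψ H.∨ χ) ls rest out le = atMost (binary≤ (encodeQF ψ) (encodeQF χ))
    (readToken (emit ∷ []) then both (encodeQF ψ) (encodeQF χ) (A.encode (arithQF ψ)) (A.encode (arithQF χ)) _ rest _
      (λ ls rest out → runQF ψ ls rest out (++-≤ˡ (encodeQF ψ) (≤-trans (n≤1+n _) le)))
      (λ ls rest out → runQF χ ls rest out (++-≤ʳ (encodeQF ψ) (≤-trans (n≤1+n _) le))))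
  runQF (X ψ) ls rest out le = atMost (≤-by _ (unary-cost (length (encodeQF ψ))))
    (readToken (emits-map nextTokens) then runQF ψ _ rest _ (≤-trans (n≤1+n _) le))
  runQF (ψ U χ) ls rest out le = atMost (binary≤ (encodeQF ψ) (encodeQF χ))
    (readToken (emits-map untilTokens) then both (encodeQF ψ) (encodeQF χ) (A.encode (arithQF ψ)) (A.encode (arithQF χ)) _ rest _
      (λ ls rest out → runQF ψ ls rest out (++-≤ˡ (encodeQF ψ) (≤-trans (n≤1+n _) le)))
      (λ ls rest out → runQF χ ls rest out (++-≤ʳ (encodeQF ψ) (≤-trans (n≤1+n _) le))))

  chooseVar : ∀ z rest → decide (so false) (List.head (encodeName z ++ rest)) nothing ≡ just (go false keep (soVar false))
    × decide (so true) (List.head (encodeName z ++ rest)) nothing ≡ just (go false keep (soVar true))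
  chooseVar []      rest = refl , refl
  chooseVar (_ ∷ _) rest = refl , refl

  chooseVar′ : ∀ b z rest → decide (so b) (List.head (encodeName z ++ rest)) nothing ≡ just (go false keep (soVar b))
  chooseVar′ false z rest = proj₁ (chooseVar z rest)
  chooseVar′ true  z rest = proj₂ (chooseVar z rest)

  runSOVar : ∀ {N T} b Y ls rest out → bit? T ≡ nothing → length (encodeSOVar Y) ≤ N →
    N ⊢ ⟨ so b , T ∷ ls , encodeSOVar Y ++ rest , [] , out ⟩ ⇒≤[ 2 + length (encodeSOVar Y) ]
      ⟨ rd , encodeSOVar Y ʳ++ (T ∷ ls) , rest , [] , (A.encodeName (className Y) ++ separator b) ʳ++ out ⟩
  runSOVar b Xa ls rest out nb le = atMost (n≤1+n 2) (one (goes [] refl right keep) then goStay (emits-map _) refl)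
  runSOVar b Xd ls rest out nb le = atMost (n≤1+n 2) (one (goes [] refl right keep) then goStay (emits-map _) refl)
  runSOVar b (var z) ls rest out nb le =
    target (cong (λ o → ⟨ rd , encodeName z ʳ++ _ , rest , [] , (A.‵bit true ∷ o) ʳ++ out ⟩)
                 (sym (name-++ A.‵bit A.‵end z (separator b))))
      (goStay [] (chooseVar′ b z rest)
        then goStay (emit ∷ nameItem {x = z} nb (name≤ z le) ∷ emit ∷ emits-map (separator b)) refl
        then skipName nothing z _ rest _)

  -- The machine prints the pieces in the grouping of its scripts; this regroups them along the
  -- syntax of the formula.
  existsText : ∀ {A : Set} (s e n v m : A) (P C a : List A) →
    (s ∷ (P ++ e ∷ n ∷ v ∷ n ∷ m ∷ (P ++ e ∷ []))) ++ ((C ++ n ∷ []) ++ a) ≡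
    s ∷ (P ++ e ∷ []) ++ (n ∷ v ∷ (n ∷ m ∷ (P ++ e ∷ []) ++ C) ++ n ∷ a)
  existsText s e n v m P C a = cong (s ∷_) (trans (++-assoc P _ _) (trans
    (cong (λ l → P ++ e ∷ n ∷ v ∷ n ∷ m ∷ l) (trans (cong ((P ++ e ∷ []) ++_) (++-assoc C _ a)) (sym (++-assoc (P ++ e ∷ []) C _))))
    (sym (++-assoc P _ _))))

  forallText : ∀ {A : Set} (s e n v m : A) (P C a : List A) →
    (s ∷ (P ++ e ∷ v ∷ n ∷ m ∷ (P ++ e ∷ []))) ++ ((C ++ []) ++ a) ≡
    s ∷ (P ++ e ∷ []) ++ (v ∷ (n ∷ m ∷ (P ++ e ∷ []) ++ C) ++ a)
  forallText s e n v m P C a = cong (s ∷_) (trans (++-assoc P _ _) (trans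
    (cong (λ l → P ++ e ∷ v ∷ n ∷ m ∷ l) (trans (cong ((P ++ e ∷ []) ++_) (++-assoc C _ a)) (sym (++-assoc (P ++ e ∷ []) C _))))
    (sym (++-assoc P _ _))))

  ʳ++₃ : ∀ {A : Set} (xs ys zs : List A) {out} → zs ʳ++ (ys ʳ++ (xs ʳ++ out)) ≡ (xs ++ (ys ++ zs)) ʳ++ out
  ʳ++₃ xs ys zs = trans (sym (++-ʳ++ ys)) (sym (++-ʳ++ xs))

  setQuantifier≤ : ∀ (e₁ e₂ : List Token) → 2 + ((2 + length e₁) + 4 * length e₂) ≤ 4 * suc (length (e₁ ++ e₂))
  setQuantifier≤ e₁ e₂ = ≤-trans (≤-by _ (setQuantifier-cost (length e₂) (length e₁)))
    (≤-reflexive (cong (λ l → 4 * suc l) (sym (length-++ e₁))))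

  traceQuantifier≤ : ∀ (e₀ e₁ e₂ : List Token) →
    2 + (length e₀ + ((2 + length e₁) + 4 * length e₂)) ≤ 4 * suc (length (e₀ ++ e₁ ++ e₂))
  traceQuantifier≤ e₀ e₁ e₂ = ≤-trans (≤-by _ (traceQuantifier-cost (length e₀) (length e₂) (length e₁)))
    (≤-reflexive (cong (λ l → 4 * suc l) (sym (trans (length-++ e₀) (cong (length e₀ +_) (length-++ e₁))))))

  run-φ : ∀ {N} φ ls rest out → length (H.encode φ) ≤ N →
    N ⊢ ⟨ rd , ls , H.encode φ ++ rest , [] , out ⟩ ⇒≤[ 4 * length (H.encode φ) ]
      ⟨ rd , H.encode φ ʳ++ ls , rest , [] , A.encode (arith φ) ʳ++ out ⟩

  setQuantifier : ∀ {N t q} Y φ ls rest out → actScript t ≡ emit q ∷ [] → afterAct t ≡ so false → bit? t ≡ nothing →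
    suc (length (encodeSOVar Y ++ H.encode φ)) ≤ N →
    N ⊢ ⟨ rd , ls , t ∷ (encodeSOVar Y ++ H.encode φ) ++ rest , [] , out ⟩ ⇒≤[ 4 * suc (length (encodeSOVar Y ++ H.encode φ)) ]
      ⟨ rd , (encodeSOVar Y ++ H.encode φ) ʳ++ (t ∷ ls) , rest , [] , (A.encodeName (className Y) ++ A.encode (arith φ)) ʳ++ (q ∷ out) ⟩
  setQuantifier {N} {t} {q} Y φ ls rest out eq eq′ nb le = atMost (setQuantifier≤ (encodeSOVar Y) (H.encode φ))
    (source (cong (λ rs → ⟨ rd , ls , t ∷ rs , [] , out ⟩) (++-assoc (encodeSOVar Y) (H.encode φ) rest))
      (target (cong₂ (λ ls o → ⟨ rd , ls , rest , [] , o ⟩) (sym (++-ʳ++ (encodeSOVar Y)))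
                (trans (sym (++-ʳ++ (A.encodeName (className Y) ++ [])))
                       (cong (λ l → (l ++ A.encode (arith φ)) ʳ++ (q ∷ out)) (++-identityʳ (A.encodeName (className Y))))))
        (target (cong (λ k → ⟨ k , _ , _ , [] , _ ⟩) eq′)
           (readToken (subst (λ is → EmitsAll N is _ _ [] (q ∷ [])) (sym eq) (emit ∷ [])))
          then runSOVar false Y ls _ _ nb (++-≤ˡ (encodeSOVar Y) (≤-trans (n≤1+n _) le))
          then run-φ φ _ rest _ (++-≤ʳ (encodeSOVar Y) (≤-trans (n≤1+n _) le)))))

  traceQuantifier : ∀ {N t o b} π Y φ ls rest out →
    (∀ {ls rs} → Emits N name (t ∷ ls) (encodeName π ++ rs) [] (map A.‵bit π) → EmitsAll N (actScript t) (t ∷ ls) (encodeName π ++ rs) [] o) →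
    afterAct t ≡ skipTo (just b) → bit? t ≡ nothing →
    suc (length (encodeName π ++ encodeSOVar Y ++ H.encode φ)) ≤ N →
    N ⊢ ⟨ rd , ls , t ∷ (encodeName π ++ encodeSOVar Y ++ H.encode φ) ++ rest , [] , out ⟩
        ⇒≤[ 4 * suc (length (encodeName π ++ encodeSOVar Y ++ H.encode φ)) ]
      ⟨ rd , (encodeName π ++ encodeSOVar Y ++ H.encode φ) ʳ++ (t ∷ ls) , rest , []
      , (o ++ ((A.encodeName (className Y) ++ separator b) ++ A.encode (arith φ))) ʳ++ out ⟩
  traceQuantifier {N} {t} {o} {b} π Y φ ls rest out es eq′ nb le =
    atMost (traceQuantifier≤ (encodeName π) (encodeSOVar Y) (H.encode φ))
    (source (cong (λ rs → ⟨ rd , ls , t ∷ rs , [] , out ⟩)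
               (trans (++-assoc (encodeName π) _ rest) (cong (encodeName π ++_) (++-assoc (encodeSOVar Y) (H.encode φ) rest))))
      (target (cong₂ (λ ls o → ⟨ rd , ls , rest , [] , o ⟩)
                (ʳ++₃ (encodeName π) (encodeSOVar Y) (H.encode φ))
                (ʳ++₃ o (A.encodeName (className Y) ++ separator b) (A.encode (arith φ))))
        (target (cong (λ k → ⟨ k , _ , _ , [] , _ ⟩) eq′)
           (readToken (es (nameItem {x = π} nb (name≤ π (++-≤ˡ (encodeName π) (≤-trans (n≤1+n _) le))))))
          then skipName (just b) π _ _ _
          then source (cong (λ ls → ⟨ so b , ls , _ , [] , _ ⟩) (++-ʳ++ (map H.‵bit π)))
                 (target (cong (λ ls → ⟨ rd , encodeSOVar Y ʳ++ ls , _ , [] , _ ⟩) (sym (++-ʳ++ (map H.‵bit π))))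
                   (runSOVar b Y _ _ _ refl (++-≤ˡ (encodeSOVar Y) (++-≤ʳ (encodeName π) (≤-trans (n≤1+n _) le)))))
          then run-φ φ _ rest _ (++-≤ʳ (encodeSOVar Y) (++-≤ʳ (encodeName π) (≤-trans (n≤1+n _) le))))))

  run-φ (∃X Y φ)   ls rest out le = setQuantifier Y φ ls rest out refl refl refl le
  run-φ (∀X Y φ)   ls rest out le = setQuantifier Y φ ls rest out refl refl refl le
  run-φ (∃π π Y φ) ls rest out le =
    target (cong (λ l → ⟨ rd , H.encode (∃π π Y φ) ʳ++ ls , rest , [] , l ʳ++ out ⟩)
              (existsText _ _ _ _ _ (map A.‵bit π) (A.encodeName (className Y)) (A.encode (arith φ))))
      (traceQuantifier π Y φ ls rest out
        (λ e → emit ∷ e ∷ emit ∷ emits-++ (emits-map (A.‵¬ ∷ A.‵∨ ∷ A.‵¬ ∷ A.‵∈₂ ∷ [])) (e ∷ emit ∷ [])) refl refl le)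
  run-φ (∀π π Y φ) ls rest out le =
    target (cong (λ l → ⟨ rd , H.encode (∀π π Y φ) ʳ++ ls , rest , [] , l ʳ++ out ⟩)
              (forallText _ _ _ _ _ (map A.‵bit π) (A.encodeName (className Y)) (A.encode (arith φ))))
      (traceQuantifier π Y φ ls rest out
        (λ e → emit ∷ e ∷ emit ∷ emits-++ (emits-map (A.‵∨ ∷ A.‵¬ ∷ A.‵∈₂ ∷ [])) (e ∷ emit ∷ [])) refl refl le)
  run-φ (qf ψ)     ls rest out le = runQF ψ ls rest out le

  computes : ∀ φ → length (H.encode φ) ⊢ ⟨ start , [] , H.encode φ , [] , [] ⟩ ⇒≤[ 8 * length (H.encode φ) + 1 ]
    ⟨ rd , H.encode φ ʳ++ [] , [] , [] , A.encode (closing (arith φ)) ʳ++ [] ⟩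
  computes φ = atMost (≤-trans (≤-reflexive (+-comm 1 _)) (+-monoˡ-≤ 1 (*-monoˡ-≤ (length (H.encode φ)) {4} {8} (m≤m+n 4 4))))
    (goStay (emits-map header) refl
      then source (cong (λ rs → ⟨ rd , [] , rs , [] , _ ⟩) (sym (++-identityʳ (H.encode φ))))
             (run-φ φ [] [] _ ≤-refl))

  hyper≤arithmetic : ExcludedMiddle 0ℓ → Hyper²LTL-SAT n ≤ₚ ThirdOrderTruth
  hyper≤arithmetic em = record
    { reduce   = reduceA
    ; correct  = λ (φ , _) → ⇔-sym (closing-correct em φ)
    ; machine  = machine
    ; c        = coefficient 1
    ; k        = 3
    ; computes = λ (φ , _) → let t , t≤ , h = computesIn 1 (computes φ) refl refl in
        t , t≤ , subst (Run.HaltsIn_On_With_ machine t _)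
          (reverse-involutive (A.encode (closing (arith φ)))) h
    }

-- Numbers as tracks of traces

-- Quantifier-free formulas over a single proposition, with abstract trace
-- variables.
data Template (A : Set) : Set where
  at′        : A → Template A
  not′ next′ : Template A → Template A
  or′ until′ : Template A → Template A → Template A

and′ implies′ iff′ : ∀ {A} → Template A → Template A → Template A
and′ φ ψ     = not′ (or′ (not′ φ) (not′ ψ))
implies′ φ ψ = or′ (not′ φ) ψ
iff′ φ ψ     = and′ (implies′ φ ψ) (implies′ ψ φ)

nextN : ∀ {A} → ℕ → Template A → Template A
nextN zero    φ = φ
nextN (suc k) φ = next′ (nextN k φ)

data Op : Set where
  same inc reset : Op

apply : Op → ℕ → ℕ
apply same  k = k
apply inc   k = suc k
apply reset k = 0

Five : Set → Set
Five B = B × B × B × B × B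

-- A trace is divided into blocks of length 5, which are marked by the clock;
-- track j consists of the j-th positions of the blocks.
module Tracks {A : Set} (clock : A) where

  eventually always : Template A → Template A
  -- The disjunction is a tautology and serves as the constant true.
  eventually φ = until′ (or′ (at′ clock) (not′ (at′ clock))) φ
  always φ     = not′ (eventually (not′ φ))

  everyBlock someBlock : Template A → Template A
  everyBlock φ = always (implies′ (at′ clock) φ)
  someBlock φ  = eventually (and′ (at′ clock) φ)

  bit : ℕ → A → Template A
  bit j a = nextN j (at′ a)

  sameTrack : ℕ → ℕ → A → A → Template A
  sameTrack j k s t = everyBlock (iff′ (bit j s) (bit k t))

  isZero : ℕ → A → Template A
  isZero j t = and′ (bit j t) (everyBlock (not′ (nextN 5 (bit j t))))

  -- Demands only the mark in block 1; it is applied to tracks that are known to be singletons.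
  isOne : ℕ → A → Template A
  isOne j t = nextN 5 (bit j t)

  operation : Op → ℕ → A → A → Template A
  operation same  j s t = sameTrack j j s t
  operation inc   j s t = and′ (not′ (bit j t)) (everyBlock (iff′ (bit j s) (nextN 5 (bit j t))))
  operation reset j s t = isZero j t

  step : Five Op → A → A → Template A
  step (o₀ , o₁ , o₂ , o₃ , o₄) s t = and′ (operation o₀ 0 s t) (and′ (operation o₁ 1 s t)
    (and′ (operation o₂ 2 s t) (and′ (operation o₃ 3 s t) (operation o₄ 4 s t))))

  isClock : Template A
  isClock = and′ (at′ clock) (and′ (not′ (bit 1 clock)) (and′ (not′ (bit 2 clock)) (and′ (not′ (bit 3 clock))
    (and′ (not′ (bit 4 clock)) (always (iff′ (at′ clock) (nextN 5 (at′ clock))))))))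

  -- Both work on track 3, which carries the value. The search for the mark of `t` starts one block
  -- after that of `s`, which makes the order strict.
  smaller member : A → A → Template A
  smaller s t = someBlock (and′ (bit 3 s) (nextN 5 (someBlock (bit 3 t))))
  member s t  = someBlock (and′ (bit 3 s) (bit 3 t))

holds : ∀ {A} → (A → ℕ → Set) → ℕ → Template A → Set
holds B i (at′ a)      = B a i
holds B i (not′ φ)     = ¬ holds B i φ
holds B i (or′ φ ψ)    = holds B i φ ⊎ holds B i ψ
holds B i (next′ φ)    = holds B (suc i) φ
holds B i (until′ φ ψ) = ∃[ j ] holds B (i + j) ψ × (∀ j′ → j′ < j → holds B (i + j′) φ)

record Clock (c : ℕ → Set) : Set where
  field
    marks : ∀ m → c (m * 5)
    only  : ∀ i → c i → ∃[ m ] i ≡ m * 5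

-- Track j is the singleton of k.
Singleton : (ℕ → Set) → ℕ → ℕ → Set
Singleton b j k = ∀ m → b (j + m * 5) ⇔ (m ≡ k)

Encodes : (ℕ → Set) → Five ℕ → Set
Encodes b (k₀ , k₁ , k₂ , k₃ , k₄) =
  Singleton b 0 k₀ × Singleton b 1 k₁ × Singleton b 2 k₂ × Singleton b 3 k₃ × Singleton b 4 k₄

applyAll : Five Op → Five ℕ → Five ℕ
applyAll (o₀ , o₁ , o₂ , o₃ , o₄) (k₀ , k₁ , k₂ , k₃ , k₄) =
  apply o₀ k₀ , apply o₁ k₁ , apply o₂ k₂ , apply o₃ k₃ , apply o₄ k₄

module Reading (em : ExcludedMiddle 0ℓ) where

  open Classical em public

  module _ {A : Set} (B : A → ℕ → Set) where

    holds-nextN : ∀ k i φ → holds B i (nextN k φ) ⇔ holds B (k + i) φ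
    holds-nextN zero    i φ = ⇔-refl
    holds-nextN (suc k) i φ = ⇔-trans (holds-nextN k (suc i) φ) (≡⇒⇔ (cong (λ j → holds B j φ) (+-suc k i)))

    module _ (clock : A) where
      open Tracks clock

      holds-eventually : ∀ i φ → holds B i (eventually φ) ⇔ (∃[ j ] holds B (i + j) φ)
      holds-eventually i φ = mk⇔ (λ (j , h , _) → j , h) (λ (j , h) → j , h , λ j′ _ → excluded (i + j′))
        where
        excluded : ∀ j → B clock j ⊎ ¬ B clock j
        excluded j with em {B clock j}
        ... | yes b = inj₁ b
        ... | no nb = inj₂ nb

      holds-always : ∀ φ → holds B 0 (always φ) ⇔ (∀ i → holds B i φ)
      holds-always φ = mk⇔ (λ k i → stable λ nh → k (bwd (holds-eventually 0 (not′ φ)) (i , nh)))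
        (λ h k → let i , nh = fwd (holds-eventually 0 (not′ φ)) k in nh (h i))

      open Clock

      holds-isClock : holds B 0 isClock ⇔ Clock (B clock)
      holds-isClock = mk⇔ to′ from′
        where
        period : Template A
        period = iff′ (at′ clock) (nextN 5 (at′ clock))
        to′ : holds B 0 isClock → Clock (B clock)
        to′ h with fwd conj h
        ... | b₀ , h with fwd conj h
        ... | b₁ , h with fwd conj h
        ... | b₂ , h with fwd conj h
        ... | b₃ , h with fwd conj h
        ... | b₄ , h = record { marks = marks′ ; only = only′ }
          where
          periodic : ∀ i → B clock i ⇔ B clock (5 + i)
          periodic i = fwd iff (fwd (holds-always period) h i)
          marks′ : ∀ m → B clock (m * 5)
          marks′ zero    = b₀
          marks′ (suc m) = fwd (periodic (m * 5)) (marks′ m)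
          only′ : ∀ i → B clock i → ∃[ m ] i ≡ m * 5
          only′ 0 b = 0 , refl
          only′ 1 b = contradiction b b₁
          only′ 2 b = contradiction b b₂
          only′ 3 b = contradiction b b₃
          only′ 4 b = contradiction b b₄
          only′ (suc (suc (suc (suc (suc i))))) b = let m , eq = only′ i (bwd (periodic i) b) in suc m , cong (5 +_) eq
        not-mark : ∀ r m → r + 0 * 5 < 5 → r ≢ 0 → r ≢ m * 5
        not-mark r zero    lt ne eq = ne eq
        not-mark r (suc m) lt ne refl = <⇒≱ lt (≤-trans (m≤m+n 5 (m * 5)) (m≤m+n _ 0))
        from′ : Clock (B clock) → holds B 0 isClock
        from′ c = bwd conj (marks c 0 , bwd conj (off 1 (s≤s (s≤s z≤n)) (λ ()) , bwd conj (off 2 (s≤s (s≤s (s≤s z≤n))) (λ ())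
          , bwd conj (off 3 (s≤s (s≤s (s≤s (s≤s z≤n)))) (λ ()) , bwd conj (off 4 (s≤s (s≤s (s≤s (s≤s (s≤s z≤n))))) (λ ())
          , bwd (holds-always period) λ i → bwd iff (mk⇔ (later i) (earlier i)))))))
          where
          off : ∀ r → r + 0 * 5 < 5 → r ≢ 0 → ¬ B clock r
          off r lt ne b = let m , eq = only c r b in not-mark r m lt ne eq
          later : ∀ i → B clock i → B clock (5 + i)
          later i b with only c i b
          ... | m , refl = marks c (suc m)
          earlier : ∀ i → B clock (5 + i) → B clock i
          earlier i b with only c (5 + i) b
          ... | suc m , eq = subst (B clock) (+-cancelˡ-≡ 5 (m * 5) i (sym eq)) (marks c m)

      module _ (clocked : Clock (B clock)) where

        holds-everyBlock : ∀ φ → holds B 0 (everyBlock φ) ⇔ (∀ m → holds B (m * 5) φ)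
        holds-everyBlock φ = mk⇔
          (λ h m → fwd impl (fwd (holds-always (implies′ (at′ clock) φ)) h (m * 5)) (marks clocked m))
          (λ h → bwd (holds-always (implies′ (at′ clock) φ)) λ i → bwd impl λ b → let m , eq = only clocked i b in
            subst (λ i → holds B i φ) (sym eq) (h m))

        holds-someBlock : ∀ k φ → holds B (k * 5) (someBlock φ) ⇔ (∃[ m ] holds B ((k + m) * 5) φ)
        holds-someBlock k φ = mk⇔
          (λ h → let j , c = fwd (holds-eventually (k * 5) (and′ (at′ clock) φ)) h
                     b , hφ = fwd conj c
                     m , eq = only clocked _ b
                 in m ∸ k , subst (λ i → holds B i φ) (trans eq (cong (_* 5) (sym (m+[n∸m]≡n
                      (*-cancelʳ-≤ k m 5 (≤-trans (m≤m+n (k * 5) j) (≤-reflexive eq))))))) hφ)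
          (λ (m , h) → bwd (holds-eventually (k * 5) (and′ (at′ clock) φ)) (m * 5 ,
            subst (λ i → holds B i (and′ (at′ clock) φ)) (*-distribʳ-+ 5 k m) (bwd conj (marks clocked (k + m) , h))))

        holds-bit : ∀ j a i → holds B i (bit j a) ⇔ B a (j + i)
        holds-bit j a i = holds-nextN j i (at′ a)

        holds-bit′ : ∀ j a m → holds B (m * 5) (nextN 5 (bit j a)) ⇔ B a (j + suc m * 5)
        holds-bit′ j a m = holds-bit j a (suc m * 5)

        holds-sameTrack : ∀ j k s t → holds B 0 (sameTrack j k s t) ⇔ (∀ m → B s (j + m * 5) ⇔ B t (k + m * 5))
        holds-sameTrack j k s t = ⇔-trans (holds-everyBlock (iff′ (bit j s) (bit k t))) (⇔Π λ m → ⇔-trans iff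
          (mk⇔ (λ e → ⇔-trans (⇔-sym (holds-bit j s _)) (⇔-trans e (holds-bit k t _)))
               (λ e → ⇔-trans (holds-bit j s _) (⇔-trans e (⇔-sym (holds-bit k t _))))))

        Track : A → ℕ → ℕ → Set
        Track t = Singleton (B t)

        same-values : ∀ {s t j k x y} → Track s j x → Track t k y → holds B 0 (sameTrack j k s t) ⇔ (x ≡ y)
        same-values {s} {t} {j} {k} {x} {y} tr tr′ = ⇔-trans (holds-sameTrack j k s t)
          (mk⇔ (λ h → fwd (tr′ x) (fwd (h x) (bwd (tr x) refl))) λ { refl m → ⇔-trans (tr m) (⇔-sym (tr′ m)) })

        same-value : ∀ {s t j k x} → Track s j x → holds B 0 (sameTrack j k s t) → Track t k x
        same-value {s} {t} {j} {k} tr h m = ⇔-trans (⇔-sym (fwd (holds-sameTrack j k s t) h m)) (tr m)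

        holds-isZero : ∀ j t → holds B 0 (isZero j t) ⇔ Track t j 0
        holds-isZero j t = ⇔-trans conj (mk⇔
          (λ { (b , h) zero → mk⇔ (λ _ → refl) (λ _ → fwd (holds-bit j t 0) b)
             ; (b , h) (suc m) → mk⇔ (λ b′ → contradiction (bwd (holds-bit′ j t m) b′) (fwd (holds-everyBlock (not′ (nextN 5 (bit j t)))) h m)) (λ ()) })
          (λ tr → bwd (holds-bit j t 0) (bwd (tr 0) refl) ,
            bwd (holds-everyBlock (not′ (nextN 5 (bit j t)))) λ m h → 1+n≢0 (fwd (tr (suc m)) (fwd (holds-bit′ j t m) h))))

        isOne-value : ∀ {t j k} → Track t j k → holds B 0 (isOne j t) ⇔ (1 ≡ k)
        isOne-value {t} {j} tr = ⇔-trans (holds-bit′ j t 0) (tr 1)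

        holds-operation : ∀ {s t k} o j → Track s j k → holds B 0 (operation o j s t) ⇔ Track t j (apply o k)
        holds-operation {s} {t} same j tr = mk⇔ (same-value {s} {t} tr)
          λ tr′ → bwd (holds-sameTrack j j s t) λ m → ⇔-trans (tr m) (⇔-sym (tr′ m))
        holds-operation {s} {t} {k} inc j tr = ⇔-trans conj (mk⇔
          (λ { (nb , h) zero → mk⇔ (λ b → contradiction (bwd (holds-bit j t 0) b) nb) (λ ())
             ; (nb , h) (suc m) → ⇔-trans (⇔-sym (shifted h m)) (⇔-trans (tr m) (mk⇔ (cong suc) suc-injective)) })
          (λ tr′ → (λ b → 0≢1+n (fwd (tr′ 0) (fwd (holds-bit j t 0) b))) ,
            bwd (holds-everyBlock (iff′ (bit j s) (nextN 5 (bit j t)))) λ m → bwd iff (⇔-trans (holds-bit j s _) (⇔-trans (tr m)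
              (⇔-trans (mk⇔ (cong suc) suc-injective) (⇔-trans (⇔-sym (tr′ (suc m))) (⇔-sym (holds-bit′ j t m))))))))
          where
          shifted : holds B 0 (everyBlock (iff′ (bit j s) (nextN 5 (bit j t)))) → ∀ m → B s (j + m * 5) ⇔ B t (j + suc m * 5)
          shifted h m = ⇔-trans (⇔-sym (holds-bit j s _)) (⇔-trans (fwd iff (fwd (holds-everyBlock (iff′ (bit j s) (nextN 5 (bit j t)))) h m)) (holds-bit′ j t m))
        holds-operation {s} {t} reset j tr = holds-isZero j t

        -- The template fixes all tracks of `t`. Therefore it can both force a successor to lie in
        -- the distinguished set and recognise a given trace as one.
        holds-step : ∀ {s t} os {ks} → Encodes (B s) ks → holds B 0 (step os s t) ⇔ Encodes (B t) (applyAll os ks)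
        holds-step (o₀ , o₁ , o₂ , o₃ , o₄) (t₀ , t₁ , t₂ , t₃ , t₄) =
          ⇔-trans conj (holds-operation o₀ 0 t₀ ⇔× ⇔-trans conj (holds-operation o₁ 1 t₁ ⇔×
            ⇔-trans conj (holds-operation o₂ 2 t₂ ⇔× ⇔-trans conj (holds-operation o₃ 3 t₃ ⇔× holds-operation o₄ 4 t₄))))

        smaller-value : ∀ {s t x y} → Track s 3 x → Track t 3 y → holds B 0 (smaller s t) ⇔ (x < y)
        smaller-value {s} {t} {x} {y} tr tr′ = ⇔-trans (holds-someBlock 0 (and′ (bit 3 s) (nextN 5 (someBlock (bit 3 t))))) (mk⇔
          (λ (m , h) → let b , h′ = fwd conj h
                           l , c = fwd (holds-someBlock (suc m) (bit 3 t)) (fwd (holds-nextN 5 (m * 5) (someBlock (bit 3 t))) h′)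
                       in subst₂ _<_ (fwd (tr m) b) (fwd (tr′ (suc m + l)) c) (s≤s (m≤m+n m l)))
          (λ x<y → x , bwd conj (bwd (tr x) refl , bwd (holds-someBlock (suc x) (bit 3 t))
            (y ∸ suc x , bwd (tr′ _) (m+[n∸m]≡n x<y)))))

        member-value : ∀ {s t x} → Track s 3 x → holds B 0 (member s t) ⇔ B t (3 + x * 5)
        member-value {s} {t} {x} tr = ⇔-trans (holds-someBlock 0 (and′ (bit 3 s) (bit 3 t))) (mk⇔
          (λ (m , h) → let b , b′ = fwd conj h in subst (λ m → B t (3 + m * 5)) (fwd (tr m) b) b′)
          (λ b → x , bwd conj (bwd (tr x) refl , b)))

-- From arithmetic to Hyper²LTL

data Arith : Set where
  plus times : Arith

data Rel : Set where
  equal less mem₁ mem₂ : Rel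

data Bin : Set where
  arith : Arith → Bin
  rel   : Rel → Bin
  or    : Bin

-- Terms, atoms and formulas of arithmetic, uniformly.  The Boolean of a
-- quantifier tells whether it is existential.
data Tree : Set where
  leaf  : Sort → Name → Tree
  bin   : Bin → Tree → Tree → Tree
  neg   : Tree → Tree
  quant : Bool → Sort → Name → Tree → Tree

leftSort rightSort : Bin → Sort
leftSort (rel mem₂)  = set
leftSort _           = number
rightSort (rel mem₁) = set
rightSort (rel mem₂) = class
rightSort _          = number

data Kind : Set where
  operand : Sort → Kind
  formula : Kind

data Sorted : Kind → Tree → Set where
  leaf  : ∀ {s x} → Sorted (operand s) (leaf s x)
  arith : ∀ {k l r} → Sorted (operand number) l → Sorted (operand number) r → Sorted (operand number) (bin (arith k) l r)
  rel   : ∀ {k l r} → Sorted (operand (leftSort (rel k))) l → Sorted (operand (rightSort (rel k))) r →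
          Sorted formula (bin (rel k) l r)
  or    : ∀ {l r} → Sorted formula l → Sorted formula r → Sorted formula (bin or l r)
  neg   : ∀ {t} → Sorted formula t → Sorted formula (neg t)
  quant : ∀ {e s x t} → Sorted formula t → Sorted formula (quant e s x t)

fromTerm : A.Term → Tree
fromTerm (A.var x) = leaf number x
fromTerm (t A.⊕ u) = bin (arith plus) (fromTerm t) (fromTerm u)
fromTerm (t A.⊗ u) = bin (arith times) (fromTerm t) (fromTerm u)

fromFormula : A.Formula → Tree
fromFormula (t A.≐ u)    = bin (rel equal) (fromTerm t) (fromTerm u)
fromFormula (t A.≺ u)    = bin (rel less) (fromTerm t) (fromTerm u)
fromFormula (t A.∈₁ B)   = bin (rel mem₁) (fromTerm t) (leaf set B)
fromFormula (B A.∈₂ C)   = bin (rel mem₂) (leaf set B) (leaf class C)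
fromFormula (A.¬′ φ)     = neg (fromFormula φ)
fromFormula (φ A.∨ ψ)    = bin or (fromFormula φ) (fromFormula ψ)
fromFormula (A.∃′ s x φ) = quant true s x (fromFormula φ)
fromFormula (A.∀′ s x φ) = quant false s x (fromFormula φ)

sorted-term : ∀ t → Sorted (operand number) (fromTerm t)
sorted-term (A.var x) = leaf
sorted-term (t A.⊕ u) = arith (sorted-term t) (sorted-term u)
sorted-term (t A.⊗ u) = arith (sorted-term t) (sorted-term u)

sorted-formula : ∀ φ → Sorted formula (fromFormula φ)
sorted-formula (t A.≐ u)    = rel (sorted-term t) (sorted-term u)
sorted-formula (t A.≺ u)    = rel (sorted-term t) (sorted-term u)
sorted-formula (t A.∈₁ B)   = rel (sorted-term t) leaf
sorted-formula (B A.∈₂ C)   = rel leaf leaf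
sorted-formula (A.¬′ φ)     = neg (sorted-formula φ)
sorted-formula (φ A.∨ ψ)    = or (sorted-formula φ) (sorted-formula ψ)
sorted-formula (A.∃′ s x φ) = quant (sorted-formula φ)
sorted-formula (A.∀′ s x φ) = quant (sorted-formula φ)

FreeTree : Sort → Name → Tree → Set
FreeTree s x (leaf s′ y)      = s ≡ s′ × x ≡ y
FreeTree s x (bin k l r)      = FreeTree s x l ⊎ FreeTree s x r
FreeTree s x (neg t)          = FreeTree s x t
FreeTree s x (quant e s′ y t) = ¬ (s ≡ s′ × x ≡ y) × FreeTree s x t

free-term : ∀ {s x} t → FreeTree s x (fromTerm t) → s ≡ number × A.OccursIn x t
free-term (A.var x) h = h
free-term (t A.⊕ u) (inj₁ h) = let e , o = free-term t h in e , inj₁ o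
free-term (t A.⊕ u) (inj₂ h) = let e , o = free-term u h in e , inj₂ o
free-term (t A.⊗ u) (inj₁ h) = let e , o = free-term t h in e , inj₁ o
free-term (t A.⊗ u) (inj₂ h) = let e , o = free-term u h in e , inj₂ o

free-formula : ∀ {s x} φ → FreeTree s x (fromFormula φ) → A.Free s x φ
free-formula (t A.≐ u) (inj₁ h) = let e , o = free-term t h in e , inj₁ o
free-formula (t A.≐ u) (inj₂ h) = let e , o = free-term u h in e , inj₂ o
free-formula (t A.≺ u) (inj₁ h) = let e , o = free-term t h in e , inj₁ o
free-formula (t A.≺ u) (inj₂ h) = let e , o = free-term u h in e , inj₂ o
free-formula (t A.∈₁ B) (inj₁ h) = inj₁ (free-term t h)
free-formula (t A.∈₁ B) (inj₂ h) = inj₂ h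
free-formula (B A.∈₂ C) h = h
free-formula (A.¬′ φ) h = free-formula φ h
free-formula (φ A.∨ ψ) (inj₁ h) = inj₁ (free-formula φ h)
free-formula (φ A.∨ ψ) (inj₂ h) = inj₂ (free-formula ψ h)
free-formula (A.∃′ s x φ) (ne , h) = ne , free-formula φ h
free-formula (A.∀′ s x φ) (ne , h) = ne , free-formula φ h

data LeafVar : Set where
  clock self ref : LeafVar

data RelVar : Set where
  clock lhs rhs : RelVar

data ResultVar : Set where
  clock self lhs rhs : ResultVar

data HeaderVar : Set where
  clock base current succ₁ succ₂ succ₃ pred : HeaderVar

-- Tracks 0 to 4 of the elements of the distinguished set carry the numbers
-- a, b, r, ab + r and a + b + (ab + r).
advance-r advance-a advance-b : Five Op
advance-r = same , same , inc , inc , inc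
advance-a = inc , same , reset , same , inc
advance-b = same , inc , same , same , inc

module _ where
  open Tracks {HeaderVar} clock

  -- `atEnd` is r = b, the point at which r is carried into a; `atStart` is a = r = 0, the point at
  -- which b may grow while ab + r stays zero.
  allZero atStart atEnd : HeaderVar → Template HeaderVar
  allZero t = and′ (isZero 0 t) (and′ (isZero 1 t) (and′ (isZero 2 t) (and′ (isZero 3 t) (isZero 4 t))))
  atStart t = and′ (isZero 0 t) (and′ (isZero 2 t) (isZero 3 t))
  atEnd t   = sameTrack 2 1 t t

  originates : Template HeaderVar
  originates = or′ (allZero current) (or′ (step advance-r pred current)
    (or′ (and′ (atEnd pred) (step advance-a pred current)) (and′ (atStart pred) (step advance-b pred current))))

  lawful : Template HeaderVar
  lawful = and′ isClock (and′ (allZero base) (and′ (step advance-r current succ₁)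
    (and′ (implies′ (atEnd current) (step advance-a current succ₂))
    (and′ (implies′ (atStart current) (step advance-b current succ₃))
    -- At least one rank has to be marked, since the descent along predecessors needs a number to
    -- start from.
    (and′ (someBlock (bit 4 current)) originates)))))

module _ where
  open Tracks {ResultVar} clock

  -- The value of a tuple is ab + r: for a = 1 it is the sum of b and r, for r = 0 the product of a
  -- and b.
  result : Arith → Template ResultVar
  result plus  = and′ (isOne 0 self) (and′ (sameTrack 1 3 self lhs) (sameTrack 2 3 self rhs))
  result times = and′ (sameTrack 0 3 self lhs) (and′ (sameTrack 1 3 self rhs) (isZero 2 self))

module _ where
  open Tracks {RelVar} clock

  related : Rel → Template RelVar
  related equal = sameTrack 3 3 lhs rhs
  related less  = smaller lhs rhs
  related mem₁  = member lhs rhs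
  -- The trace drawn from the class has to be a genuine member, marked at position 0, and not a
  -- filler.
  related mem₂  = and′ (at′ rhs) (sameTrack 3 3 lhs rhs)

module _ where
  open Tracks {LeafVar} clock

  -- States that the value of a leaf is wrong. For a class nothing can be wrong, since the trace was
  -- drawn from the set of the variable itself, so the template is contradictory.
  differs : Sort → Template LeafVar
  differs class = not′ (sameTrack 3 3 self self)
  differs _     = not′ (sameTrack 3 3 self ref)

-- All of them begin with `true`, whereas the names attached to nodes begin with `false`, so the two
-- never clash.
headerName : HeaderVar → Name
headerName clock   = true ∷ []
headerName base    = true ∷ false ∷ []
headerName current = true ∷ true ∷ []
headerName succ₁   = true ∷ false ∷ false ∷ []
headerName succ₂   = true ∷ false ∷ true ∷ []
headerName succ₃   = true ∷ true ∷ false ∷ []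
headerName pred    = true ∷ true ∷ true ∷ []

-- The trace that a node evaluates to, and the trace chosen by a quantifier.
valueName choiceName : List Bool → Name
valueName p  = false ∷ false ∷ p
choiceName p = false ∷ true ∷ p

setName : List Bool → SOVar
setName p = var (true ∷ p)

clocks tuples : SOVar
clocks = var (false ∷ [])
tuples = var []

leafName : List Bool → List Bool → LeafVar → Name
leafName p q clock = headerName clock
leafName p q self  = valueName p
leafName p q ref   = choiceName q

relName : List Bool → RelVar → Name
relName p clock = headerName clock
relName p lhs   = valueName (false ∷ p)
relName p rhs   = valueName (true ∷ p)

resultName : List Bool → ResultVar → Name
resultName p clock = headerName clock
resultName p self  = valueName p
resultName p lhs   = valueName (false ∷ p)
resultName p rhs   = valueName (true ∷ p)

flip : Bool → Bool → Bool
flip true  pol = pol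
flip false pol = not pol

module Translation (n : ℕ) (p₀ : Fin n) where

  module H = Hyper n
  open H using (∃X; ∀X; ∃π; ∀π; qf)

  inst : ∀ {V : Set} → (V → Name) → Template V → H.QF
  inst σ (at′ a)      = p₀ H.at σ a
  inst σ (not′ φ)     = H.¬′ inst σ φ
  inst σ (next′ φ)    = H.X inst σ φ
  inst σ (or′ φ ψ)    = inst σ φ H.∨ inst σ ψ
  inst σ (until′ φ ψ) = inst σ φ H.U inst σ ψ

  -- At an operand the matrix says that some value in the subtree is wrong, at an atom that the
  -- relation holds and no value is wrong. At positive occurrences the values are existential and
  -- have to be right; at negative ones they are universal, and a wrong value only makes the atom
  -- false, which is harmless there.
  matrix : Bool → Tree → List Frame → H.QF
  matrix b (leaf s x)          fs = inst (leafName (bits fs) (bits (look s x fs))) (differs s)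
  matrix b (bin (arith k) l r) fs = H.¬′ inst (resultName (bits fs)) (result k) H.∨
    (matrix b l (lf b number ∷ fs) H.∨ matrix b r (rf ∷ fs))
  matrix b (bin (rel k) l r)   fs = H.¬′ (H.¬′ inst (relName (bits fs)) (related k) H.∨
    (matrix b l (lf b (rightSort (rel k)) ∷ fs) H.∨ matrix b r (rf ∷ fs)))
  matrix b (bin or l r)        fs = matrix b l (lf b number ∷ fs) H.∨ matrix b r (rf ∷ fs)
  matrix b (neg t)             fs = H.¬′ matrix (not b) t (rf ∷ fs)
  matrix b (quant e s x t)     fs = matrix b t (bd s x ∷ fs)

  quantX : Bool → SOVar → H.Formula → H.Formula
  quantX true  = ∃X
  quantX false = ∀X

  quantπ : Bool → Name → SOVar → H.Formula → H.Formula
  quantπ true  = ∃π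
  quantπ false = ∀π

  -- A set variable quantified together with an element of it lets the element range over all traces
  -- without mention of `Xa`. For a class the set is the actual choice and the element a dummy; this
  -- restricts the choice to nonempty sets, which suffice to code every class.
  choose : Bool → Sort → Name → List Bool → H.Formula → H.Formula
  choose b number π p K = quantπ b π tuples K
  choose b _      π p K = quantX b (setName p) (quantπ b π (setName p) K)

  valuePrefix : Bool → Sort → Name → List Frame → H.Formula → H.Formula
  valuePrefix b class x fs K = quantπ b (valueName (bits fs)) (setName (bits (look class x fs))) K
  valuePrefix b s     x fs K = choose b s (valueName (bits fs)) (bits fs) K

  nodePrefix : Bool → Bin → List Bool → H.Formula → H.Formula
  nodePrefix b (arith k) p K = quantπ b (valueName p) tuples K
  nodePrefix b _         p K = K

  -- The quantifiers of a tree in front of K; the polarity is true if the tree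
  -- occurs positively.
  prefix : Bool → Tree → List Frame → H.Formula → H.Formula
  prefix b (leaf s x)      fs K = valuePrefix b s x fs K
  prefix b (bin k l r)     fs K = nodePrefix b k (bits fs)
    (prefix b l (lf b (rightSort k) ∷ fs) (prefix b r (rf ∷ fs) K))
  prefix b (neg t)         fs K = prefix (not b) t (rf ∷ fs) K
  prefix b (quant e s x t) fs K = choose (flip e b) s (choiceName (bits fs)) (bits fs) (prefix b t (bd s x ∷ fs) K)

  lawfulQF : H.QF
  lawfulQF = inst headerName lawful

  -- The set `clocks` has the sole purpose of introducing the clock, as a trace can only be drawn
  -- from a set.
  header : H.Formula → H.Formula
  header K = ∃X clocks (∃π (headerName clock) clocks (∃X tuples (∃π (headerName base) tuples (∀π (headerName current) tuples
    (∃π (headerName succ₁) tuples (∃π (headerName succ₂) tuples (∃π (headerName succ₃) tuples (∃π (headerName pred) tuples K))))))))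

  kernel : Tree → H.Formula
  kernel t = qf (H.¬′ (H.¬′ lawfulQF H.∨ H.¬′ matrix true t []))

  hyper : A.Formula → H.Formula
  hyper φ = header (prefix true (fromFormula φ) [] (kernel (fromFormula φ)))

  -- The translated formula is a sentence without Xa

  free-inst : ∀ {V : Set} (σ : V → Name) φ {π} → H.FreeInQF π (inst σ φ) → ∃[ a ] π ≡ σ a
  free-inst σ (at′ a)      h        = a , h
  free-inst σ (not′ φ)     h        = free-inst σ φ h
  free-inst σ (next′ φ)    h        = free-inst σ φ h
  free-inst σ (or′ φ ψ)    (inj₁ h) = free-inst σ φ h
  free-inst σ (or′ φ ψ)    (inj₂ h) = free-inst σ ψ h
  free-inst σ (until′ φ ψ) (inj₁ h) = free-inst σ φ h
  free-inst σ (until′ φ ψ) (inj₂ h) = free-inst σ ψ h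

  traceFree-choose : ∀ {b s π p K ρ} → H.TraceVarFree ρ (choose b s π p K) → ρ ≢ π × H.TraceVarFree ρ K
  traceFree-choose {true}  {number} h = h
  traceFree-choose {true}  {set}    h = h
  traceFree-choose {true}  {class}  h = h
  traceFree-choose {false} {number} h = h
  traceFree-choose {false} {set}    h = h
  traceFree-choose {false} {class}  h = h

  traceFree-value : ∀ {b s x fs K ρ} → H.TraceVarFree ρ (valuePrefix b s x fs K) → ρ ≢ valueName (bits fs) × H.TraceVarFree ρ K
  traceFree-value {b}     {number} {fs = fs} h = traceFree-choose {b} {number} {p = bits fs} h
  traceFree-value {b}     {set}    h = traceFree-choose {b} {set} h
  traceFree-value {true}  {class}  h = h
  traceFree-value {false} {class}  h = h

  traceFree-result : ∀ {b k p K ρ} → H.TraceVarFree ρ (nodePrefix b (arith k) p K) → ρ ≢ valueName p × H.TraceVarFree ρ K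
  traceFree-result {true}  h = h
  traceFree-result {false} h = h

  traceFree-node : ∀ {b} k {p K ρ} → H.TraceVarFree ρ (nodePrefix b k p K) → H.TraceVarFree ρ K
  traceFree-node {b} (arith k) {p} {K} h = proj₂ (traceFree-result {b} {k} {p} {K} h)
  traceFree-node (rel _) h = h
  traceFree-node or      h = h

  traceFree-prefix : ∀ b t fs {K ρ} → H.TraceVarFree ρ (prefix b t fs K) → H.TraceVarFree ρ K
  traceFree-prefix b (leaf s x)      fs h = proj₂ (traceFree-value {b} {s} {x} {fs} h)
  traceFree-prefix b (bin k l r)     fs h = traceFree-prefix b r (rf ∷ fs) (traceFree-prefix b l (lf b (rightSort k) ∷ fs) (traceFree-node {b} k h))
  traceFree-prefix b (neg t)         fs h = traceFree-prefix (not b) t (rf ∷ fs) h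
  traceFree-prefix b (quant e s x t) fs h = traceFree-prefix b t (bd s x ∷ fs) (proj₂ (traceFree-choose {flip e b} {s} h))

  operand-bound : ∀ b {s t} fs {K} → Sorted (operand s) t → ¬ H.TraceVarFree (valueName (bits fs)) (prefix b t fs K)
  operand-bound b fs (leaf {s} {x})        h = proj₁ (traceFree-value {b} {s} {x} {fs} h) refl
  operand-bound b fs (arith {k} _ _) h = proj₁ (traceFree-result {b} {k} {bits fs} h) refl

  look-here : ∀ s x fs → look s x (bd s x ∷ fs) ≡ fs
  look-here s x fs with s ≟ₛ s | x ≟ⁿ x
  ... | yes _ | yes _ = refl
  ... | yes _ | no ne = contradiction refl ne
  ... | no ne | _     = contradiction refl ne

  look-there : ∀ {s s′ x y} fs → ¬ (s ≡ s′ × x ≡ y) → look s x (bd s′ y ∷ fs) ≡ look s x fs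
  look-there {s} {s′} {x} {y} fs ne with s ≟ₛ s′ | x ≟ⁿ y
  ... | yes p | yes q = contradiction (p , q) ne
  ... | yes _ | no  _ = refl
  ... | no  _ | _     = refl

  -- The trace variables that the matrix of t needs from outside t.
  Outer : Tree → List Frame → Name → Set
  Outer t fs π = π ≡ headerName clock ⊎ ∃[ s ] ∃[ x ] FreeTree s x t × π ≡ choiceName (bits (look s x fs))

  outer-mono : ∀ {t u} f fs {π} → (∀ {s x} → FreeTree s x t → FreeTree s x u) →
    (∀ s x → look s x (f ∷ fs) ≡ look s x fs) → Outer t (f ∷ fs) π → Outer u fs π
  outer-mono f fs g e (inj₁ h)                  = inj₁ h
  outer-mono f fs g e (inj₂ (s , x , h , refl)) = inj₂ (s , x , g h , cong (choiceName ∘ bits) (e s x))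

  -- Value names are bound in the prefix of the subtree itself, and choice names by the quantifier
  -- nodes within it. This leaves the clock and the choices made for free variables.
  outer-matrix : ∀ b {k t} fs {K π} → Sorted k t → H.FreeInQF π (matrix b t fs) →
    H.TraceVarFree π (prefix b t fs K) → Outer t fs π
  outer-children : ∀ b {l r j k s} fs {K π} → Sorted j l → Sorted k r →
    H.FreeInQF π (matrix b l (lf b s ∷ fs)) ⊎ H.FreeInQF π (matrix b r (rf ∷ fs)) →
    H.TraceVarFree π (prefix b l (lf b s ∷ fs) (prefix b r (rf ∷ fs) K)) → ∀ {k} → Outer (bin k l r) fs π
  outer-children b {l} {r} {s = s} fs sl sr (inj₁ h) tv {k} =
    outer-mono {l} {bin k l r} (lf b s) fs inj₁ (λ _ _ → refl) (outer-matrix b _ sl h tv)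
  outer-children b {l} {r} {s = s} fs sl sr (inj₂ h) tv {k} =
    outer-mono {r} {bin k l r} rf fs inj₂ (λ _ _ → refl) (outer-matrix b _ sr h (traceFree-prefix b l (lf b s ∷ fs) tv))
  outer-matrix b fs (leaf {s} {x}) h tv with free-inst (leafName (bits fs) (bits (look s x fs))) (differs s) h
  ... | clock , π≡ = inj₁ π≡
  ... | self  , π≡ = contradiction π≡ (proj₁ (traceFree-value {b} {s} {x} {fs} tv))
  ... | ref   , π≡ = inj₂ (s , x , (refl , refl) , π≡)
  outer-matrix b fs (arith {k} {l} {r} sl sr) (inj₁ h) tv
    with traceFree-result {b} {k} {bits fs} tv | free-inst (resultName (bits fs)) (result k) h
  ... | ne , tv′ | clock , π≡   = inj₁ π≡
  ... | ne , tv′ | self  , π≡   = contradiction π≡ ne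
  ... | ne , tv′ | lhs   , refl = ⊥-elim (operand-bound b (lf b number ∷ fs) sl tv′)
  ... | ne , tv′ | rhs   , refl = ⊥-elim (operand-bound b (rf ∷ fs) sr (traceFree-prefix b l (lf b number ∷ fs) tv′))
  outer-matrix b fs (arith {k} sl sr) (inj₂ h) tv = outer-children b fs sl sr h (traceFree-node {b} (arith k) {bits fs} tv) {arith k}
  outer-matrix b fs (rel {k} {l} {r} sl sr) (inj₁ h) tv with free-inst (relName (bits fs)) (related k) h
  ... | clock , π≡   = inj₁ π≡
  ... | lhs   , refl = ⊥-elim (operand-bound b (lf b (rightSort (rel k)) ∷ fs) sl tv)
  ... | rhs   , refl = ⊥-elim (operand-bound b (rf ∷ fs) sr (traceFree-prefix b l (lf b (rightSort (rel k)) ∷ fs) tv))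
  outer-matrix b fs (rel {k} sl sr) (inj₂ h) tv = outer-children b fs sl sr h tv {rel k}
  outer-matrix b fs (or sl sr) h tv = outer-children b fs sl sr h tv {or}
  outer-matrix b fs (neg {t} st) h tv = outer-mono {t} {neg t} rf fs id (λ _ _ → refl) (outer-matrix (not b) (rf ∷ fs) st h tv)
  outer-matrix b fs (quant {e} {s} {x} {t} st) h tv with traceFree-choose {flip e b} {s} tv
  ... | ne , tv′ with outer-matrix b (bd s x ∷ fs) st h tv′
  ... | inj₁ π≡ = inj₁ π≡
  ... | inj₂ (s′ , y , free , refl) with s′ ≟ₛ s | y ≟ⁿ x
  ... | yes refl | yes refl = contradiction refl ne
  ... | yes _    | no y≢x   = inj₂ (s′ , y , ((y≢x ∘ proj₂) , free) , refl)
  ... | no s′≢s  | _        = inj₂ (s′ , y , ((s′≢s ∘ proj₁) , free) , refl)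

  OuterSet : Tree → List Frame → SOVar → Set
  OuterSet t fs Z = Z ≡ tuples ⊎ ∃[ x ] FreeTree class x t × Z ≡ setName (bits (look class x fs))

  outerSet-choose : ∀ b s {π p K Z} → H.SOVarFree Z (choose b s π p K) →
    (Z ≡ tuples ⊎ H.SOVarFree Z K) × (s ≡ class → Z ≢ setName p)
  outerSet-choose true  number h               = h , λ ()
  outerSet-choose false number h               = h , λ ()
  outerSet-choose true  set   (ne , inj₁ Z≡) = contradiction Z≡ ne
  outerSet-choose true  set   (ne , inj₂ h)   = inj₂ h , λ ()
  outerSet-choose false set   (ne , inj₁ Z≡) = contradiction Z≡ ne
  outerSet-choose false set   (ne , inj₂ h)   = inj₂ h , λ ()
  outerSet-choose true  class (ne , inj₁ Z≡) = contradiction Z≡ ne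
  outerSet-choose true  class (ne , inj₂ h)   = inj₂ h , λ _ → ne
  outerSet-choose false class (ne , inj₁ Z≡) = contradiction Z≡ ne
  outerSet-choose false class (ne , inj₂ h)   = inj₂ h , λ _ → ne

  outerSet-prefix : ∀ b t fs {K Z} → H.SOVarFree Z (prefix b t fs K) → OuterSet t fs Z ⊎ H.SOVarFree Z K
  outerSet-prefix b (leaf number x) fs h with proj₁ (outerSet-choose b number {p = bits fs} h)
  ... | inj₁ Z≡ = inj₁ (inj₁ Z≡)
  ... | inj₂ h  = inj₂ h
  outerSet-prefix b (leaf set x) fs h with proj₁ (outerSet-choose b set h)
  ... | inj₁ Z≡ = inj₁ (inj₁ Z≡)
  ... | inj₂ h  = inj₂ h
  outerSet-prefix true  (leaf class x) fs (inj₁ Z≡) = inj₁ (inj₂ (x , (refl , refl) , Z≡))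
  outerSet-prefix true  (leaf class x) fs (inj₂ h)   = inj₂ h
  outerSet-prefix false (leaf class x) fs (inj₁ Z≡) = inj₁ (inj₂ (x , (refl , refl) , Z≡))
  outerSet-prefix false (leaf class x) fs (inj₂ h)   = inj₂ h
  outerSet-prefix b (bin k l r) fs {K} {Z} h with start k h
    where
    start : ∀ k {K} → H.SOVarFree Z (nodePrefix b k (bits fs) K) → Z ≡ tuples ⊎ H.SOVarFree Z K
    start (arith k) h = number-choice b h
      where
      number-choice : ∀ b {K} → H.SOVarFree Z (nodePrefix b (arith k) (bits fs) K) → Z ≡ tuples ⊎ H.SOVarFree Z K
      number-choice true  h = h
      number-choice false h = h
    start (rel _)   h = inj₂ h
    start or        h = inj₂ h
  ... | inj₁ Z≡ = inj₁ (inj₁ Z≡)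
  ... | inj₂ h with outerSet-prefix b l (lf b (rightSort k) ∷ fs) h
  ... | inj₁ (inj₁ Z≡)                 = inj₁ (inj₁ Z≡)
  ... | inj₁ (inj₂ (x , free , Z≡)) = inj₁ (inj₂ (x , inj₁ free , Z≡))
  ... | inj₂ h with outerSet-prefix b r (rf ∷ fs) h
  ... | inj₁ (inj₁ Z≡)                 = inj₁ (inj₁ Z≡)
  ... | inj₁ (inj₂ (x , free , Z≡)) = inj₁ (inj₂ (x , inj₂ free , Z≡))
  ... | inj₂ h = inj₂ h
  outerSet-prefix b (neg t) fs h with outerSet-prefix (not b) t (rf ∷ fs) h
  ... | inj₁ o = inj₁ o
  ... | inj₂ h = inj₂ h
  outerSet-prefix b (quant e s x t) fs h with outerSet-choose (flip e b) s h
  ... | inj₁ Z≡ , _ = inj₁ (inj₁ Z≡)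
  ... | inj₂ h , ne with outerSet-prefix b t (bd s x ∷ fs) h
  ... | inj₁ (inj₁ Z≡) = inj₁ (inj₁ Z≡)
  ... | inj₂ h = inj₂ h
  ... | inj₁ (inj₂ (y , free , refl)) with class ≟ₛ s | y ≟ⁿ x
  ... | yes refl | yes refl = contradiction refl (ne refl)
  ... | yes _    | no y≢x   = inj₁ (inj₂ (y , ((y≢x ∘ proj₂) , free) , refl))
  ... | no ≢s    | _        = inj₁ (inj₂ (y , ((≢s ∘ proj₁) , free) , refl))

  occurs-choose : ∀ b s {π p K} → H.OccursSO Xa (choose b s π p K) → H.OccursSO Xa K
  occurs-choose true  number (inj₂ h)        = h
  occurs-choose false number (inj₂ h)        = h
  occurs-choose true  set    (inj₂ (inj₂ h)) = h
  occurs-choose false set    (inj₂ (inj₂ h)) = h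
  occurs-choose true  class  (inj₂ (inj₂ h)) = h
  occurs-choose false class  (inj₂ (inj₂ h)) = h

  occurs-prefix : ∀ b t fs {K} → H.OccursSO Xa (prefix b t fs K) → H.OccursSO Xa K
  occurs-prefix b     (leaf number x) fs h = occurs-choose b number {p = bits fs} h
  occurs-prefix b     (leaf set x)    fs h = occurs-choose b set h
  occurs-prefix true  (leaf class x)  fs (inj₂ h) = h
  occurs-prefix false (leaf class x)  fs (inj₂ h) = h
  occurs-prefix b (bin (arith k) l r) fs h =
    occurs-prefix b r (rf ∷ fs) (occurs-prefix b l (lf b number ∷ fs) (occurs-choose b number {π = valueName (bits fs)} {[]} h))
  occurs-prefix b (bin (rel k) l r)   fs h = occurs-prefix b r (rf ∷ fs) (occurs-prefix b l (lf b (rightSort (rel k)) ∷ fs) h)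
  occurs-prefix b (bin or l r)        fs h = occurs-prefix b r (rf ∷ fs) (occurs-prefix b l (lf b number ∷ fs) h)
  occurs-prefix b (neg t)             fs h = occurs-prefix (not b) t (rf ∷ fs) h
  occurs-prefix b (quant e s x t)     fs h = occurs-prefix b t (bd s x ∷ fs) (occurs-choose (flip e b) s h)

  hyper-sentence : ∀ φ → (∀ s x → ¬ A.Free s x φ) → H.IsSentence (hyper φ)
  hyper-sentence φ closed = noTraces , noSets
    where
    t = fromFormula φ
    noTraces : ∀ π → ¬ H.TraceVarFree π (hyper φ)
    noTraces π (≢clock , ≢base , ≢current , ≢succ₁ , ≢succ₂ , ≢succ₃ , ≢pred , h) with traceFree-prefix true t [] h
    ... | inj₁ hl with free-inst headerName lawful hl
    ... | clock   , π≡ = ≢clock π≡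
    ... | base    , π≡ = ≢base π≡
    ... | current , π≡ = ≢current π≡
    ... | succ₁   , π≡ = ≢succ₁ π≡
    ... | succ₂   , π≡ = ≢succ₂ π≡
    ... | succ₃   , π≡ = ≢succ₃ π≡
    ... | pred    , π≡ = ≢pred π≡
    noTraces π (≢clock , ≢base , ≢current , ≢succ₁ , ≢succ₂ , ≢succ₃ , ≢pred , h)
        | inj₂ hm with outer-matrix true [] (sorted-formula φ) hm h
    ... | inj₁ π≡ = ≢clock π≡
    ... | inj₂ (s , x , free , _) = closed s x (free-formula φ free)
    noSets : ∀ Y → H.SOVarFree Y (hyper φ) → Y ≡ Xa ⊎ Y ≡ Xd
    noSets Y (≢clocks , inj₁ Y≡) = contradiction Y≡ ≢clocks
    noSets Y (≢clocks , inj₂ (≢tuples , h)) = ⊥-elim (inside h)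
      where
      inside : ¬ (Y ≡ tuples ⊎ Y ≡ tuples ⊎ Y ≡ tuples ⊎ Y ≡ tuples ⊎ Y ≡ tuples ⊎ Y ≡ tuples ⊎ H.SOVarFree Y (prefix true t [] (kernel t)))
      inside (inj₁ Y≡)                                    = ≢tuples Y≡
      inside (inj₂ (inj₁ Y≡))                             = ≢tuples Y≡
      inside (inj₂ (inj₂ (inj₁ Y≡)))                      = ≢tuples Y≡
      inside (inj₂ (inj₂ (inj₂ (inj₁ Y≡))))               = ≢tuples Y≡
      inside (inj₂ (inj₂ (inj₂ (inj₂ (inj₁ Y≡)))))        = ≢tuples Y≡
      inside (inj₂ (inj₂ (inj₂ (inj₂ (inj₂ (inj₁ Y≡)))))) = ≢tuples Y≡
      inside (inj₂ (inj₂ (inj₂ (inj₂ (inj₂ (inj₂ h)))))) with outerSet-prefix true t [] h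
      ... | inj₁ (inj₁ Y≡) = ≢tuples Y≡
      ... | inj₁ (inj₂ (x , free , _)) = closed class x (free-formula φ free)

  hyper-XaFree : ∀ φ → H.XaFree (hyper φ)
  hyper-XaFree φ (inj₂ (inj₂ (inj₂ (inj₂ (inj₂ (inj₂ (inj₂ (inj₂ (inj₂ h))))))))) = occurs-prefix true (fromFormula φ) [] h

-- Strategies in the evaluation game

tuple : ℕ → ℕ → ℕ → Five ℕ
tuple a b r = a , b , r , a * b + r , a + b + (a * b + r)

spread : (ℕ → ℕ → Bool) → ℕ → Bool
spread g i = g (i % 5) (i / 5)

spread-at : ∀ g j m → j < 5 → spread g (j + m * 5) ≡ g j m
spread-at g j m j<5 = cong₂ g (trans ([m+kn]%n≡m%n j m 5) (m<n⇒m%n≡m j<5))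
  (trans (+-distrib-/-∣ʳ j (divides-refl m)) (cong₂ _+_ (m<n⇒m/n≡0 j<5) (m*n/n≡m m 5)))

valueOf : Valuation → (s : Sort) → Name → ⟦ s ⟧
valueOf v number = num v
valueOf v set    = st v
valueOf v class  = cls v

valueOf-same : ∀ v s x a → valueOf (v [ s , x ↦ a ]) s x ≡ a
valueOf-same v number x a = override-same (num v) x a
valueOf-same v set    x a = override-same (st v) x a
valueOf-same v class  x a = override-same (cls v) x a

valueOf-other : ∀ v {s s′ x y} a → ¬ (s′ ≡ s × y ≡ x) → valueOf (v [ s , x ↦ a ]) s′ y ≡ valueOf v s′ y
valueOf-other v {number} {number} a ne = override-other (num v) a λ e → ne (refl , e)
valueOf-other v {number} {set}    a ne = refl
valueOf-other v {number} {class}  a ne = refl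
valueOf-other v {set}    {number} a ne = refl
valueOf-other v {set}    {set}    a ne = override-other (st v) a λ e → ne (refl , e)
valueOf-other v {set}    {class}  a ne = refl
valueOf-other v {class}  {number} a ne = refl
valueOf-other v {class}  {set}    a ne = refl
valueOf-other v {class}  {class}  a ne = override-other (cls v) a λ e → ne (refl , e)

-- Paths are stored with the innermost step first, so the nodes at or below `p` are those whose path
-- ends in `p`.
UnderT : List Bool → Name → Set
UnderT p π = ∃[ c ] ∃[ r ] π ≡ false ∷ c ∷ r ++ p

UnderS : List Bool → SOVar → Set
UnderS p Y = ∃[ r ] Y ≡ setName (r ++ p)

under-childT : ∀ {c p π} → UnderT (c ∷ p) π → UnderT p π
under-childT {c} {p} (d , r , refl) = d , r ++ c ∷ [] , cong (λ l → false ∷ d ∷ l) (sym (++-assoc r (c ∷ []) p))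

under-childS : ∀ {c p Y} → UnderS (c ∷ p) Y → UnderS p Y
under-childS {c} {p} (r , refl) = r ++ c ∷ [] , cong setName (sym (++-assoc r (c ∷ []) p))

-- A proper ancestor has a shorter path, hence its variables are untouched by the play in the
-- subtree.
too-short : ∀ {q p : List Bool} r → length q < length p → q ≢ r ++ p
too-short {p = p} r lt refl = <⇒≱ lt (≤-trans (m≤n+m (length p) (length r)) (≤-reflexive (sym (length-++ r))))

short-choice : ∀ {q p} → length q < length p → ¬ UnderT p (choiceName q)
short-choice lt (c , r , e) = too-short r lt (∷-injectiveʳ (∷-injectiveʳ e))

short-value : ∀ {q p} → length q < length p → ¬ UnderT p (valueName q)
short-value lt (c , r , e) = too-short r lt (∷-injectiveʳ (∷-injectiveʳ e))

short-set : ∀ {q p} → length q < length p → ¬ UnderS p (setName q)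
short-set lt (r , e) = too-short r lt (setName-injective e)
  where
  setName-injective : ∀ {q q′} → setName q ≡ setName q′ → q ≡ q′
  setName-injective refl = refl

siblings : ∀ {p π} → UnderT (false ∷ p) π → ¬ UnderT (true ∷ p) π
siblings {p} (c , r , refl) (c′ , r′ , e) with ∷ʳ-injectiveʳ r r′ (++-cancelʳ p (r ++ false ∷ []) (r′ ++ true ∷ [])
  (trans (++-assoc r _ p) (trans (∷-injectiveʳ (∷-injectiveʳ e)) (sym (++-assoc r′ _ p)))))
... | ()

not-header : ∀ {p} a → ¬ UnderT p (headerName a)
not-header clock   (_ , _ , ())
not-header base    (_ , _ , ())
not-header current (_ , _ , ())
not-header succ₁   (_ , _ , ())
not-header succ₂   (_ , _ , ())
not-header succ₃   (_ , _ , ())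
not-header pred    (_ , _ , ())

look-suffix : ∀ s x fs → ∃[ gs ] fs ≡ gs ++ look s x fs
look-suffix s x [] = [] , refl
look-suffix s x (lf b s′ ∷ fs) = let gs , e = look-suffix s x fs in lf b s′ ∷ gs , cong (lf b s′ ∷_) e
look-suffix s x (rf ∷ fs) = let gs , e = look-suffix s x fs in rf ∷ gs , cong (rf ∷_) e
look-suffix s x (bd s′ y ∷ fs) with s ≟ₛ s′ | x ≟ⁿ y
... | yes _ | yes _ = bd s′ y ∷ [] , refl
... | yes _ | no  _ = let gs , e = look-suffix s x fs in bd s′ y ∷ gs , cong (bd s′ y ∷_) e
... | no  _ | _     = let gs , e = look-suffix s x fs in bd s′ y ∷ gs , cong (bd s′ y ∷_) e

-- What Q is worth for a player who wants Q to hold if P does (polarity true),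
-- or to fail if P does (polarity false).
Transfer : Bool → Set → Set → Set
Transfer true  P Q = P → Q
Transfer false P Q = Q → P

-- The analogue for operands, where `M` reports an error and `V` says that the value is right. With
-- polarity true the player sets the values and secures both; with polarity false the opponent sets
-- them, and avoiding an error commits him to the right value.
Outcome : Bool → Set → Set → Set
Outcome true  M V = (¬ M) × V
Outcome false M V = ¬ M → V

module Correctness (n : ℕ) (p₀ : Fin n) (em : ExcludedMiddle 0ℓ) where

  open Translation n p₀
  open Satisfaction n
  open Reading em
  open H using (Assignment; Trace; TraceSet; trace; traces; _⊨_; _⊨ᵠ_; _∈[_]_; _∈ᵗ_; _[_↦ᵗ_]; _[_↦ˢ_])

  Bit : Trace → ℕ → Set
  Bit t i = p₀ ∈ₛ t i

  Bit⇔ : ∀ t i → Bit t i ⇔ (lookup (t i) p₀ ≡ true)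
  Bit⇔ t i = mk⇔ []=⇒lookup (lookup⇒[]= p₀ (t i))

  fromBits : (ℕ → Bool) → Trace
  fromBits b i = replicate n (b i)

  Bit-fromBits : ∀ b i → Bit (fromBits b) i ⇔ (b i ≡ true)
  Bit-fromBits b i = ⇔-trans (Bit⇔ (fromBits b) i) (≡⇒⇔ (cong (_≡ true) (lookup-replicate p₀ (b i))))

  fromTracks : (ℕ → ℕ → Bool) → Trace
  fromTracks g = fromBits (spread g)

  Bit-fromTracks : ∀ g j m → j < 5 → Bit (fromTracks g) (j + m * 5) ⇔ (g j m ≡ true)
  Bit-fromTracks g j m j<5 = ⇔-trans (Bit-fromBits (spread g) (j + m * 5)) (≡⇒⇔ (cong (_≡ true) (spread-at g j m j<5)))

  tb : Assignment → Name → ℕ → Set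
  tb Π = table Π p₀

  trace-same : ∀ Π π t → trace (Π [ π ↦ᵗ t ]) π ≡ just t
  trace-same Π π t with π ≟ⁿ π
  ... | yes _ = refl
  ... | no ne = contradiction refl ne

  trace-other : ∀ Π π ρ t → ρ ≢ π → trace (Π [ π ↦ᵗ t ]) ρ ≡ trace Π ρ
  trace-other Π π ρ t ne with π ≟ⁿ ρ
  ... | yes e = contradiction (sym e) ne
  ... | no _  = refl

  traces-same : ∀ Π Y T → traces (Π [ Y ↦ˢ T ]) Y ≡ just T
  traces-same Π Y T with Y ≟ˢ Y
  ... | yes _ = refl
  ... | no ne = contradiction refl ne

  traces-other : ∀ Π Y Z T → Z ≢ Y → traces (Π [ Y ↦ˢ T ]) Z ≡ traces Π Z
  traces-other Π Y Z T ne with Y ≟ˢ Z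
  ... | yes e = contradiction (sym e) ne
  ... | no _  = refl

  tb-cong : ∀ {Π Π′ π} → trace Π′ π ≡ trace Π π → ∀ i → tb Π′ π i ⇔ tb Π π i
  tb-cong e i = ≡⇒⇔ (cong (Any (λ t → p₀ ∈ₛ t i)) e)

  tb-same : ∀ Π π t i → tb (Π [ π ↦ᵗ t ]) π i ⇔ Bit t i
  tb-same Π π t i = ⇔-trans (≡⇒⇔ (cong (Any (λ t → p₀ ∈ₛ t i)) (trace-same Π π t))) just⇔

  ∈-same : ∀ Π Y T t → (t ∈[ Π [ Y ↦ˢ T ] ] Y) ⇔ (t ∈ᵗ T)
  ∈-same Π Y T t = ⇔-trans (≡⇒⇔ (cong (Any (t ∈ᵗ_)) (traces-same Π Y T))) just⇔

  ∈-cong : ∀ {Π Π′ Y} t → traces Π′ Y ≡ traces Π Y → (t ∈[ Π′ ] Y) ⇔ (t ∈[ Π ] Y)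
  ∈-cong t e = ≡⇒⇔ (cong (Any (t ∈ᵗ_)) e)

  sat-inst : ∀ {V : Set} {B} (σ : V → Name) i φ → sat B i (inst σ φ) ⇔ holds (λ a → B p₀ (σ a)) i φ
  sat-inst σ i (at′ a)      = ⇔-refl
  sat-inst σ i (not′ φ)     = ⇔¬ (sat-inst σ i φ)
  sat-inst σ i (next′ φ)    = sat-inst σ (suc i) φ
  sat-inst σ i (or′ φ ψ)    = sat-inst σ i φ ⇔⊎ sat-inst σ i ψ
  sat-inst σ i (until′ φ ψ) = ⇔Σ λ j → sat-inst σ (i + j) ψ ⇔× ⇔Π λ j′ → ⇔→ (sat-inst σ (i + j′) φ)

  ⊨-inst : ∀ {V : Set} (σ : V → Name) Π φ → Π ⊨ᵠ inst σ φ ⇔ holds (λ a → tb Π (σ a)) 0 φ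
  ⊨-inst σ Π φ = ⇔-trans (⊨ᵠ⇔sat Π (inst σ φ)) (sat-inst σ 0 φ)

  sat-cong : ∀ {B B′} ψ → (∀ p π i → H.FreeInQF π ψ → B p π i ⇔ B′ p π i) → ∀ i → sat B i ψ ⇔ sat B′ i ψ
  sat-cong (p H.at π)  e i = e p π i refl
  sat-cong (H.¬′ ψ)    e i = ⇔¬ (sat-cong ψ e i)
  sat-cong (ψ H.∨ χ)   e i = sat-cong ψ (λ p π i → e p π i ∘ inj₁) i ⇔⊎ sat-cong χ (λ p π i → e p π i ∘ inj₂) i
  sat-cong (H.X ψ)     e i = sat-cong ψ e (suc i)
  sat-cong (ψ H.U χ)   e i = ⇔Σ λ j → sat-cong χ (λ p π i → e p π i ∘ inj₂) (i + j) ⇔×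
    ⇔Π λ j′ → ⇔→ (sat-cong ψ (λ p π i → e p π i ∘ inj₁) (i + j′))

  coincidence : ∀ {Π Π′} ψ → (∀ π → H.FreeInQF π ψ → trace Π′ π ≡ trace Π π) → Π′ ⊨ᵠ ψ ⇔ Π ⊨ᵠ ψ
  coincidence {Π} {Π′} ψ e = ⇔-trans (⊨ᵠ⇔sat Π′ ψ) (⇔-trans
    (sat-cong ψ (λ p π i free → ≡⇒⇔ (cong (Any (λ t → p ∈ₛ t i)) (e π free))) 0) (⇔-sym (⊨ᵠ⇔sat Π ψ)))

  record Agree (p : List Bool) (Π Π′ : Assignment) : Set where
    field
      sameTrace  : ∀ π → ¬ UnderT p π → trace Π′ π ≡ trace Π π
      sameTraces : ∀ Y → ¬ UnderS p Y → traces Π′ Y ≡ traces Π Y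
  open Agree

  agree-refl : ∀ {p Π} → Agree p Π Π
  sameTrace  agree-refl _ _ = refl
  sameTraces agree-refl _ _ = refl

  agree-trans : ∀ {p Π Π′ Π″} → Agree p Π Π′ → Agree p Π′ Π″ → Agree p Π Π″
  sameTrace  (agree-trans a b) π nu = trans (sameTrace b π nu) (sameTrace a π nu)
  sameTraces (agree-trans a b) Y nu = trans (sameTraces b Y nu) (sameTraces a Y nu)

  agree-child : ∀ {c p Π Π′} → Agree (c ∷ p) Π Π′ → Agree p Π Π′
  sameTrace  (agree-child a) π nu = sameTrace a π (nu ∘ under-childT)
  sameTraces (agree-child a) Y nu = sameTraces a Y (nu ∘ under-childS)

  agree-trace : ∀ {p Π π t} → UnderT p π → Agree p Π (Π [ π ↦ᵗ t ])
  sameTrace  (agree-trace {Π = Π} {π} {t} u) ρ nu = trace-other Π π ρ t λ { refl → nu u }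
  sameTraces (agree-trace u) Y nu = refl

  agree-set : ∀ {p Π T} → Agree p Π (Π [ setName p ↦ˢ T ])
  sameTrace  agree-set π nu = refl
  sameTraces (agree-set {p} {Π} {T}) Y nu = traces-other Π (setName p) Y T λ { refl → nu ([] , refl) }

  under-value : ∀ p → UnderT p (valueName p)
  under-value p = false , [] , refl

  under-choice : ∀ p → UnderT p (choiceName p)
  under-choice p = true , [] , refl

  -- G stands for the assumption that the clock and the set of tuples are as
  -- intended; without it only nonemptiness is known.
  record Base (G : Set) (Π : Assignment) : Set where
    field
      clocked  : G → Clock (tb Π (headerName clock))
      nonempty : ∃[ t ] t ∈[ Π ] tuples
      sound    : G → ∀ t → t ∈[ Π ] tuples → ∃[ a ] ∃[ b ] ∃[ r ] Encodes (Bit t) (tuple a b r)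
      complete : G → ∀ a b r → ∃[ t ] t ∈[ Π ] tuples × Encodes (Bit t) (tuple a b r)
  open Base

  clock-cong : ∀ {c c′ : ℕ → Set} → (∀ i → c′ i ⇔ c i) → Clock c → Clock c′
  clock-cong e k = record { marks = λ m → bwd (e _) (Clock.marks k m) ; only = λ i b → Clock.only k i (fwd (e i) b) }

  base-agree : ∀ {G p Π Π′} → Agree p Π Π′ → Base G Π → Base G Π′
  base-agree {Π = Π} {Π′} ag B = record
    { clocked  = λ g → clock-cong (tb-cong {Π} {Π′} {headerName clock} (sameTrace ag _ (not-header clock))) (clocked B g)
    ; nonempty = let t , m = nonempty B in t , bwd (mem t) m
    ; sound    = λ g t m → sound B g t (fwd (mem t) m)
    ; complete = λ g a b r → let t , m , e = complete B g a b r in t , bwd (mem t) m , e }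
    where
    mem : ∀ t → (t ∈[ Π′ ] tuples) ⇔ (t ∈[ Π ] tuples)
    mem t = ∈-cong {Π} {Π′} t (sameTraces ag tuples λ { (_ , ()) })

  Reads : Assignment → Name → (ℕ → Set) → Set
  Reads Π π V = ∀ m → tb Π π (3 + m * 5) ⇔ V m

  reads-cong : ∀ {Π Π′ π V} → trace Π′ π ≡ trace Π π → Reads Π π V → Reads Π′ π V
  reads-cong {Π} {Π′} {π} e r m = ⇔-trans (tb-cong {Π} {Π′} {π} e _) (r m)

  TraceReads : Trace → (ℕ → Bool) → Set
  TraceReads t A = ∀ m → Bit t (3 + m * 5) ⇔ (A m ≡ true)

  Represents : (s : Sort) → Assignment → Name → SOVar → ⟦ s ⟧ → Set
  Represents number Π π Y k = Reads Π π (_≡ k)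
  Represents set    Π π Y A = Reads Π π (λ m → A m ≡ true)
  Represents class  Π π Y C = ∀ A → (Func.to C A ≡ true) ⇔ (∃[ t ] t ∈[ Π ] Y × Bit t 0 × TraceReads t A)

  -- Required independently of `G`: the leaf of a class variable draws a trace from its set, and an
  -- existential draw must be possible in every case.
  Inhabited : Sort → Assignment → SOVar → Set
  Inhabited class Π Y = ∃[ t ] t ∈[ Π ] Y
  Inhabited _     Π Y = ⊤

  represents-cong : ∀ s {Π Π′ π Y a} → trace Π′ π ≡ trace Π π → traces Π′ Y ≡ traces Π Y →
    Represents s Π π Y a → Represents s Π′ π Y a
  represents-cong number {Π} {Π′} {π} e e′ r = reads-cong {Π} {Π′} {π} e r
  represents-cong set    {Π} {Π′} {π} e e′ r = reads-cong {Π} {Π′} {π} e r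
  represents-cong class  {Π} {Π′} {π} {Y} e e′ r A = ⇔-trans (r A) (⇔Σ λ t → ⇔-sym (∈-cong {Π} {Π′} {Y} t e′) ⇔× ⇔-refl)

  inhabited-cong : ∀ s {Π Π′ Y} → traces Π′ Y ≡ traces Π Y → Inhabited s Π Y → Inhabited s Π′ Y
  inhabited-cong number e h       = tt
  inhabited-cong set    e h       = tt
  inhabited-cong class  {Π} {Π′} {Y} e (t , m) = t , bwd (∈-cong {Π} {Π′} {Y} t e) m

  -- `proper` puts the binder strictly above the current node, so that the variable keeps its trace
  -- and its set during later play.
  record Bound (G : Set) (Π : Assignment) (fs : List Frame) (v : Valuation) (s : Sort) (x : Name) : Set where
    field
      proper     : length (bits (look s x fs)) < length (bits fs)
      inhabited  : Inhabited s Π (setName (bits (look s x fs)))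
      represents : G → Represents s Π (choiceName (bits (look s x fs))) (setName (bits (look s x fs))) (valueOf v s x)
  open Bound

  Env : Set → Assignment → List Frame → Valuation → (Sort → Name → Set) → Set
  Env G Π fs v Fr = ∀ s x → Fr s x → Bound G Π fs v s x

  bound-agree : ∀ {G Π Π′ fs v s x} → Agree (bits fs) Π Π′ → Bound G Π fs v s x → Bound G Π′ fs v s x
  bound-agree {s = s} ag b = record
    { proper     = proper b
    ; inhabited  = inhabited-cong s (sameTraces ag _ (short-set (proper b))) (inhabited b)
    ; represents = λ g → represents-cong s (sameTrace ag _ (short-choice (proper b)))
                                           (sameTraces ag _ (short-set (proper b))) (represents b g) }

  bound-down : ∀ {G Π fs v s x f} → look s x (f ∷ fs) ≡ look s x fs → Bound G Π fs v s x → Bound G Π (f ∷ fs) v s x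
  bound-down {G} {Π} {fs} {v} {s} {x} {f} e b = record
    { proper     = ≤-trans (≤-reflexive (cong (suc ∘ length ∘ bits) e)) (m≤n⇒m≤1+n (proper b))
    ; inhabited  = subst (λ gs → Inhabited s Π (setName (bits gs))) (sym e) (inhabited b)
    ; represents = λ g → subst (λ gs → Represents s Π (choiceName (bits gs)) (setName (bits gs)) (valueOf v s x)) (sym e) (represents b g) }

  -- In a prenex formula the quantifiers of one subtree enclose those of the next. Strategies are
  -- therefore in continuation-passing style: `K` is all that follows, and it may rely on the
  -- outcome `W` only under `G`.
  Continues : Set → List Bool → Assignment → (Assignment → Set) → H.Formula → Set
  Continues G p Π W K = ∀ Π′ → Agree p Π Π′ → (G → W Π′) → Π′ ⊨ K

  onTrack : (ℕ → Bool) → ℕ → ℕ → Bool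
  onTrack A 3 m = A m
  -- In particular position 0 is set, so these traces are marked.
  onTrack A _ _ = true

  setTrace : (ℕ → Bool) → Trace
  setTrace A = fromTracks (onTrack A)

  setTrace-reads : ∀ A → TraceReads (setTrace A) A
  setTrace-reads A m = Bit-fromTracks (onTrack A) 3 m (s≤s (s≤s (s≤s (s≤s z≤n))))

  setTrace-marked : ∀ A → Bit (setTrace A) 0
  setTrace-marked A = bwd (Bit-fromTracks (onTrack A) 0 0 (s≤s z≤n)) refl

  setOf : Trace → ℕ → Bool
  setOf t m = lookup (t (3 + m * 5)) p₀

  setOf-reads : ∀ t → TraceReads t (setOf t)
  setOf-reads t m = Bit⇔ t (3 + m * 5)

  reads-unique : ∀ {t A A′} → TraceReads t A → TraceReads t A′ → ∀ m → A m ≡ A′ m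
  reads-unique {t} {A} {A′} r r′ m = ⇔→≡ (⇔-trans (⇔-sym (r m)) (r′ m))

  -- A class is coded by the traces that are marked at position 0 and read one
  -- of its members, together with all unmarked traces, so that it is nonempty.
  classSet : ⟦ class ⟧ → TraceSet
  classSet C = record
    { to   = λ t → if lookup (t 0) p₀ then Func.to C (setOf t) else true
    ; cong = λ {t} {t′} e → trans (cong (λ b → if b then Func.to C (setOf t) else true) (cong (λ s → lookup s p₀) (e 0)))
        (cong (λ c → if lookup (t′ 0) p₀ then c else true) (Func.cong C λ m → cong (λ s → lookup s p₀) (e (3 + m * 5)))) }

  marked-∈ : ∀ C t A → Bit t 0 → TraceReads t A → (Func.to (classSet C) t ≡ true) ⇔ (Func.to C A ≡ true)
  marked-∈ C t A b r = ≡⇒⇔ (cong (_≡ true)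
    (trans (cong (λ b → if b then Func.to C (setOf t) else true) (fwd (Bit⇔ t 0) b))
           (Func.cong C (reads-unique {t} (setOf-reads t) r))))

  represented : ∀ Π π Y C → traces Π Y ≡ just (classSet C) → Represents class Π π Y C
  represented Π π Y C e A = mk⇔
    (λ h → setTrace A , subst (Any (setTrace A ∈ᵗ_)) (sym e) (just (bwd (marked-∈ C (setTrace A) A (setTrace-marked A) (setTrace-reads A)) h))
         , setTrace-marked A , setTrace-reads A)
    (λ (t , m , b , r) → fwd (marked-∈ C t A b r) (fwd just⇔ (subst (Any (t ∈ᵗ_)) e m)))

  -- A set chosen by the opponent need not be of the form `classSet C`. It is understood as the
  -- class of all sets that its marked traces read.
  classOf : TraceSet → ⟦ class ⟧
  classOf T = record
    { to   = λ A → does (em {∃[ t ] t ∈ᵗ T × Bit t 0 × TraceReads t A})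
    ; cong = λ {A} {A′} e → ⇔→≡ (⇔-trans (does⇔ em) (⇔-trans (mk⇔ (transport e) (transport (sym ∘ e))) (⇔-sym (does⇔ em)))) }
    where
    transport : ∀ {A A′} → (∀ m → A m ≡ A′ m) → (∃[ t ] t ∈ᵗ T × Bit t 0 × TraceReads t A) → ∃[ t ] t ∈ᵗ T × Bit t 0 × TraceReads t A′
    transport e (t , m , b , r) = t , m , b , λ i → ⇔-trans (r i) (≡⇒⇔ (cong (_≡ true) (e i)))

  classOf-represents : ∀ Π π Y T → traces Π Y ≡ just T → Represents class Π π Y (classOf T)
  classOf-represents Π π Y T e A = ⇔-trans (does⇔ em)
    (⇔Σ λ t → ⇔-trans (⇔-sym just⇔) (≡⇒⇔ (cong (Any (t ∈ᵗ_)) (sym e))) ⇔× ⇔-refl)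

  Chosen : Set → List Bool → Assignment → Name → (s : Sort) → ⟦ s ⟧ → H.Formula → Set
  Chosen G p Π π s a K = ∀ Π′ → Agree p Π Π′ → Inhabited s Π′ (setName p) → (G → Represents s Π′ π (setName p) a) → Π′ ⊨ K

  -- If `G` fails, the set of tuples may be anything; the strategy then moves to the one element
  -- known to exist and promises nothing.
  pick : ∀ {G p Π π K} → UnderT p π → Base G Π → ∀ s (a : ⟦ s ⟧) → Chosen G p Π π s a K → Π ⊨ choose true s π p K
  pick {G} {p} {Π} {π} u B number k cont with em {G}
  -- The tuple (0, 0, k) has the value k.
  ... | yes g = let t , m , e = complete B g 0 0 k in t , m , cont _ (agree-trace u) tt
                  λ _ m → ⇔-trans (tb-same Π π t _) (proj₁ (proj₂ (proj₂ (proj₂ e))) m)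
  ... | no ng = let t , m = nonempty B in t , m , cont _ (agree-trace u) tt λ g → contradiction g ng
  pick {G} {p} {Π} {π} u B set A cont =
    H.allTraces , setTrace A , bwd (∈-same Π (setName p) H.allTraces (setTrace A)) refl ,
    cont _ (agree-trans agree-set (agree-trace u)) tt
      λ _ m → ⇔-trans (tb-same _ π (setTrace A) _) (setTrace-reads A m)
  pick {G} {p} {Π} {π} u B class C cont =
    classSet C , dull , bwd (∈-same Π (setName p) (classSet C) dull) dull∈ ,
    cont _ (agree-trans agree-set (agree-trace u)) (dull , bwd (∈-same Π (setName p) (classSet C) dull) dull∈)
      λ _ → represented (Π [ setName p ↦ˢ classSet C ] [ π ↦ᵗ dull ]) π (setName p) C (traces-same Π (setName p) (classSet C))
    where
    dull : Trace
    dull = fromBits (const false)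
    dull∈ : dull ∈ᵗ classSet C
    dull∈ = cong (λ b → if b then Func.to C (setOf dull) else true) (lookup-replicate p₀ false)

  every : ∀ {G p Π π K} → UnderT p π → Base G Π → ∀ s → (∀ a → Chosen G p Π π s a K) → Π ⊨ choose false s π p K
  every {G} {p} {Π} {π} u B number cont t m with em {G}
  ... | yes g = let a , b , r , e = sound B g t m in cont (a * b + r) _ (agree-trace u) tt
                  λ _ m → ⇔-trans (tb-same Π π t _) (proj₁ (proj₂ (proj₂ (proj₂ e))) m)
  ... | no ng = cont 0 _ (agree-trace u) tt λ g → contradiction g ng
  every {G} {p} {Π} {π} u B set cont T t m = cont (setOf t) _ (agree-trans agree-set (agree-trace u)) tt
    λ _ m → ⇔-trans (tb-same _ π t _) (setOf-reads t m)
  every {G} {p} {Π} {π} u B class cont T t m = cont (classOf T) _ (agree-trans agree-set (agree-trace u)) (t , m)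
    λ _ → classOf-represents (Π [ setName p ↦ˢ T ] [ π ↦ᵗ t ]) π (setName p) T (traces-same Π (setName p) T)

  -- The shapes of names that a matrix can mention: the clock, names at or below the node, and
  -- choices at ancestors, where the frame `f` makes the ancestor a proper one.
  data Named (fs : List Frame) (π : Name) : Set where
    clock  : π ≡ headerName clock → Named fs π
    under  : UnderT (bits fs) π → Named fs π
    choice : ∀ f gs hs → fs ≡ f ∷ gs ++ hs → π ≡ choiceName (bits hs) → Named fs π

  named-parent : ∀ {f fs π} → Named (f ∷ fs) π → Named fs π
  named-parent (clock e) = clock e
  named-parent (under u) = under (under-childT u)
  named-parent (choice f [] hs refl refl)       = under (under-choice _)
  named-parent (choice f (g ∷ gs) hs refl refl) = choice g gs hs refl refl

  named-value : ∀ {fs π} → π ≡ valueName (bits fs) → Named fs π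
  named-value refl = under (under-value _)

  named-child : ∀ {f fs π} → π ≡ valueName (frameBit f ∷ bits fs) → Named fs π
  named-child {f} {fs} refl = named-parent (named-value {f ∷ fs} refl)

  named-matrix : ∀ b t fs {π} → H.FreeInQF π (matrix b t fs) → Named fs π
  named-matrix b (leaf s x) fs h with free-inst (leafName (bits fs) (bits (look s x fs))) (differs s) h
  ... | clock , e = clock e
  ... | self  , e = named-value e
  ... | ref   , e with look-suffix s x fs
  ... | []     , fs≡ = under (subst (λ gs → UnderT (bits gs) _) (sym fs≡) (subst (UnderT _) (sym e) (under-choice _)))
  ... | g ∷ gs , fs≡ = choice g gs (look s x fs) fs≡ e
  named-matrix b (bin (arith k) l r) fs (inj₁ h) with free-inst (resultName (bits fs)) (result k) h
  ... | clock , e = clock e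
  ... | self  , e = named-value e
  ... | lhs   , e = named-child {lf b number} e
  ... | rhs   , e = named-child {rf} e
  named-matrix b (bin (arith k) l r) fs (inj₂ (inj₁ h)) = named-parent (named-matrix b l _ h)
  named-matrix b (bin (arith k) l r) fs (inj₂ (inj₂ h)) = named-parent (named-matrix b r _ h)
  named-matrix b (bin (rel k) l r) fs (inj₁ h) with free-inst (relName (bits fs)) (related k) h
  ... | clock , e = clock e
  ... | lhs   , e = named-child {lf b number} e
  ... | rhs   , e = named-child {rf} e
  named-matrix b (bin (rel k) l r) fs (inj₂ (inj₁ h)) = named-parent (named-matrix b l _ h)
  named-matrix b (bin (rel k) l r) fs (inj₂ (inj₂ h)) = named-parent (named-matrix b r _ h)
  named-matrix b (bin or l r) fs (inj₁ h) = named-parent (named-matrix b l _ h)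
  named-matrix b (bin or l r) fs (inj₂ h) = named-parent (named-matrix b r _ h)
  named-matrix b (neg t) fs h = named-parent (named-matrix (not b) t _ h)
  named-matrix b (quant e s x t) fs h = named-parent (named-matrix b t _ h)

  named-left : ∀ {b s fs π} → Named (lf b s ∷ fs) π → ¬ UnderT (true ∷ bits fs) π
  named-left (clock refl) = not-header clock
  named-left (under u)    = siblings u
  named-left {fs = fs} (choice f gs hs e refl) = short-choice (s≤s (≤-trans (m≤n+m (length (bits hs)) (length gs))
    (≤-reflexive (trans (cong (length gs +_) (length-map frameBit hs)) (trans (sym (length-++ gs))
      (trans (cong length (sym (∷-injectiveʳ e))) (sym (length-map frameBit fs))))))))

  -- The right subtree is played after the left one. What has been achieved on the left survives,
  -- because the matrix of the left child mentions no name under the right child.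
  left-stable : ∀ b t {s fs Π Π′} → Agree (true ∷ bits fs) Π Π′ →
    Π′ ⊨ᵠ matrix b t (lf b s ∷ fs) ⇔ Π ⊨ᵠ matrix b t (lf b s ∷ fs)
  left-stable b t {s} {fs} ag = coincidence (matrix b t (lf b s ∷ fs)) λ π free →
    sameTrace ag π (named-left (named-matrix b t (lf b s ∷ fs) free))

  outcome-map : ∀ b {M M′ V V′} → M′ ⇔ M → (V → V′) → Outcome b M V → Outcome b M′ V′
  outcome-map true  e f (nm , v) = nm ∘ fwd e , f v
  outcome-map false e f h nm     = f (h (nm ∘ bwd e))

  transfer-map : ∀ b {P M M′} → M′ ⇔ M → Transfer b P M → Transfer b P M′
  transfer-map true  e h = bwd e ∘ h
  transfer-map false e h = h ∘ fwd e

  OperandOutcome : Bool → Tree → List Frame → (ℕ → Set) → Assignment → Set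
  OperandOutcome b t fs V Π = Outcome b (Π ⊨ᵠ matrix b t fs) (Reads Π (valueName (bits fs)) V)

  outcome-stable : ∀ b t {s fs V Π Π′} → Agree (true ∷ bits fs) Π Π′ →
    OperandOutcome b t (lf b s ∷ fs) V Π → OperandOutcome b t (lf b s ∷ fs) V Π′
  outcome-stable b t {s} {fs} {V} {Π} {Π′} ag = outcome-map b (left-stable b t ag)
    (reads-cong {Π} {Π′} {valueName (false ∷ bits fs)} {V} (sameTrace ag _ (siblings (under-value (false ∷ bits fs)))))

  Playable : Set → Assignment → Bool → Tree → List Frame → (Assignment → Set) → Set
  Playable G Π b t fs W = ∀ K → Continues G (bits fs) Π W K → Π ⊨ prefix b t fs K

  -- The strategy for the right child is the continuation of that for the left child; `stays`
  -- carries the left outcome through the play on the right.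
  children : ∀ {G Π} b l r fs s K {WL WR : Assignment → Set} →
    Playable G Π b l (lf b s ∷ fs) WL →
    (∀ Π₁ → Agree (bits fs) Π Π₁ → Playable G Π₁ b r (rf ∷ fs) WR) →
    (∀ Π₁ Π₂ → Agree (true ∷ bits fs) Π₁ Π₂ → WL Π₁ → WL Π₂) →
    (∀ Π₂ → Agree (bits fs) Π Π₂ → trace Π₂ (valueName (bits fs)) ≡ trace Π (valueName (bits fs)) →
      (G → WL Π₂ × WR Π₂) → Π₂ ⊨ K) →
    Π ⊨ prefix b l (lf b s ∷ fs) (prefix b r (rf ∷ fs) K)
  children b l r fs s K playL playR stays cont = playL _ λ Π₁ ag₁ wl → playR Π₁ (agree-child ag₁) K λ Π₂ ag₂ wr →
    cont Π₂ (agree-trans (agree-child ag₁) (agree-child ag₂))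
      (trans (sameTrace ag₂ _ (short-value {bits fs} ≤-refl)) (sameTrace ag₁ _ (short-value {bits fs} ≤-refl)))
      λ g → stays Π₁ Π₂ ag₂ (wl g) , wr g

  env-down : ∀ {G Π Π₁ fs v} {Fr Fr′ : Sort → Name → Set} f → (∀ s x → look s x (f ∷ fs) ≡ look s x fs) →
    Agree (bits fs) Π Π₁ → (∀ {s x} → Fr′ s x → Fr s x) → Env G Π fs v Fr → Env G Π₁ (f ∷ fs) v Fr′
  env-down f e ag sub env s x h = bound-down (e s x) (bound-agree ag (env s x (sub h)))

  leaf-differs : ∀ Π p q → Clock (tb Π (headerName clock)) →
    (Π ⊨ᵠ inst (leafName p q) (differs number)) ⇔ (¬ Reads Π (valueName p) (λ m → tb Π (choiceName q) (3 + m * 5)))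
  leaf-differs Π p q clk = ⇔-trans (⊨-inst (leafName p q) Π (differs number))
    (⇔¬ (holds-sameTrack (λ a → tb Π (leafName p q a)) clock clk 3 3 self ref))

  leaf-outcome : ∀ b Π V p q → Clock (tb Π (headerName clock)) → Reads Π (choiceName q) V →
    (b ≡ true → Reads Π (valueName p) V) →
    Outcome b (Π ⊨ᵠ inst (leafName p q) (differs number)) (Reads Π (valueName p) V)
  leaf-outcome true  Π V p q clk r rd = (λ h → fwd (leaf-differs Π p q clk) h λ m → ⇔-trans (rd refl m) (⇔-sym (r m))) , rd refl
  leaf-outcome false Π V p q clk r rd = λ nh m → ⇔-trans (stable (nh ∘ bwd (leaf-differs Π p q clk)) m) (r m)

  leaf-number : ∀ {G Π fs v x} b → Base G Π → Bound G Π fs v number x →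
    Playable G Π b (leaf number x) fs (OperandOutcome b (leaf number x) fs (_≡ num v x))
  leaf-number {fs = fs} {v} {x} true B bound K cont = pick {K = K} (under-value (bits fs)) B number (num v x) λ Π′ ag _ rep →
    cont Π′ ag λ g → leaf-outcome true Π′ (_≡ num v x) (bits fs) (bits (look number x fs)) (clocked (base-agree ag B) g)
      (represents (bound-agree ag bound) g) λ _ → rep g
  leaf-number {fs = fs} {v} {x} false B bound K cont = every {K = K} (under-value (bits fs)) B number λ a Π′ ag _ rep →
    cont Π′ ag λ g → leaf-outcome false Π′ (_≡ num v x) (bits fs) (bits (look number x fs)) (clocked (base-agree ag B) g)
      (represents (bound-agree ag bound) g) λ ()

  leaf-set : ∀ {G Π fs v x} b → Base G Π → Bound G Π fs v set x →
    Playable G Π b (leaf set x) fs (OperandOutcome b (leaf set x) fs (λ m → st v x m ≡ true))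
  leaf-set {fs = fs} {v} {x} true B bound K cont = pick {K = K} (under-value (bits fs)) B set (st v x) λ Π′ ag _ rep →
    cont Π′ ag λ g → leaf-outcome true Π′ (λ m → st v x m ≡ true) (bits fs) (bits (look set x fs)) (clocked (base-agree ag B) g)
      (represents (bound-agree ag bound) g) λ _ → rep g
  leaf-set {fs = fs} {v} {x} false B bound K cont = every {K = K} (under-value (bits fs)) B set λ a Π′ ag _ rep →
    cont Π′ ag λ g → leaf-outcome false Π′ (λ m → st v x m ≡ true) (bits fs) (bits (look set x fs)) (clocked (base-agree ag B) g)
      (represents (bound-agree ag bound) g) λ ()

  encodes-cong : ∀ {c c′ : ℕ → Set} {ks} → (∀ i → c′ i ⇔ c i) → Encodes c ks → Encodes c′ ks
  encodes-cong e (t₀ , t₁ , t₂ , t₃ , t₄) =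
    (λ m → ⇔-trans (e _) (t₀ m)) , (λ m → ⇔-trans (e _) (t₁ m)) , (λ m → ⇔-trans (e _) (t₂ m)) ,
    (λ m → ⇔-trans (e _) (t₃ m)) , (λ m → ⇔-trans (e _) (t₄ m))

  compute : Arith → ℕ → ℕ → ℕ
  compute plus  x y = x + y
  compute times x y = x * y

  Computes : Arith → (a b r x y : ℕ) → Set
  Computes plus  a b r x y = 1 ≡ a × (b ≡ x × r ≡ y)
  Computes times a b r x y = a ≡ x × (b ≡ y × 0 ≡ r)

  computes-value : ∀ k {a b r x y} → Computes k a b r x y → a * b + r ≡ compute k x y
  computes-value plus  {b = b} {r} (refl , refl , refl) = cong (_+ r) (+-identityʳ b)
  computes-value times {a} {b}     (refl , refl , refl) = +-identityʳ (a * b)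

  computation : ∀ k x y → ∃[ a ] ∃[ b ] ∃[ r ] Computes k a b r x y
  computation plus  x y = 1 , x , y , refl , refl , refl
  computation times x y = x , y , 0 , refl , refl , refl

  holds-result : ∀ k {Π p a b r x y} → Clock (tb Π (headerName clock)) → Encodes (tb Π (valueName p)) (tuple a b r) →
    Reads Π (valueName (false ∷ p)) (_≡ x) → Reads Π (valueName (true ∷ p)) (_≡ y) →
    (Π ⊨ᵠ inst (resultName p) (result k)) ⇔ Computes k a b r x y
  holds-result plus {Π} {p} clk (t₀ , t₁ , t₂ , _) l r = ⇔-trans (⊨-inst (resultName p) Π (result plus))
    (⇔-trans conj (isOne-value B clock clk {self} t₀ ⇔× ⇔-trans conj
      (same-values B clock clk {self} {lhs} t₁ l ⇔× same-values B clock clk {self} {rhs} t₂ r)))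
    where
    B : ResultVar → ℕ → Set
    B a = tb Π (resultName p a)
  holds-result times {Π} {p} {r = z} clk (t₀ , t₁ , t₂ , _) l r = ⇔-trans (⊨-inst (resultName p) Π (result times))
    (⇔-trans conj (same-values B clock clk {self} {lhs} t₀ l ⇔× ⇔-trans conj
      (same-values B clock clk {self} {rhs} t₁ r ⇔× ⇔-trans (holds-isZero B clock clk 2 self)
        (mk⇔ (λ tr → fwd (t₂ 0) (bwd (tr 0) refl)) λ { refl → t₂ }))))
    where
    B : ResultVar → ℕ → Set
    B a = tb Π (resultName p a)

  result-outcome : ∀ b {R ML MR VL VR V} → Outcome b ML VL → Outcome b MR VR →
    (VL → VR → Transfer b V R) → (b ≡ true → V) → Outcome b (¬ R ⊎ (ML ⊎ MR)) V
  result-outcome true (nl , vl) (nr , vr) f v =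
    (λ { (inj₁ nR) → nR (f vl vr (v refl)) ; (inj₂ (inj₁ l)) → nl l ; (inj₂ (inj₂ r)) → nr r }) , v refl
  result-outcome false hl hr f v nh =
    f (hl (nh ∘ inj₂ ∘ inj₁)) (hr (nh ∘ inj₂ ∘ inj₂)) (stable (nh ∘ inj₁))

  witness : ∀ {G Π} → Base G Π → ∀ a b r → ∃[ t ] t ∈[ Π ] tuples × (G → Encodes (Bit t) (tuple a b r))
  witness {G} B a b r with em {G}
  ... | yes g = let t , m , e = complete B g a b r in t , m , λ _ → e
  ... | no ng = let t , m = nonempty B in t , m , λ g → contradiction g ng

  reads-value : ∀ {Π p a b r k} → Encodes (tb Π (valueName p)) (tuple a b r) → a * b + r ≡ k → Reads Π (valueName p) (_≡ k)
  reads-value (_ , _ , _ , t₃ , _) refl = t₃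

  -- The value of the node is quantified before those of its operands. This is no handicap, since
  -- the valuation determines all of them in advance.
  operation-plays : ∀ {G Π fs x y} b k l r → Base G Π →
    (∀ Π₁ → Agree (bits fs) Π Π₁ → Playable G Π₁ b l (lf b number ∷ fs) (OperandOutcome b l (lf b number ∷ fs) (_≡ x))) →
    (∀ Π₁ → Agree (bits fs) Π Π₁ → Playable G Π₁ b r (rf ∷ fs) (OperandOutcome b r (rf ∷ fs) (_≡ y))) →
    Playable G Π b (bin (arith k) l r) fs (OperandOutcome b (bin (arith k) l r) fs (_≡ compute k x y))
  operation-plays {G} {Π} {fs} {x} {y} true k l r B playL playR K cont with computation k x y
  ... | a , b , c , comp with witness B a b c
  ... | t , m , enc = t , m ,
    children true l r fs number K (playL Π₁ ag₁) (λ Π₂ ag₂ → playR Π₂ (agree-trans ag₁ ag₂)) (λ _ _ → outcome-stable true l)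
      λ Π₂ ag₂ kept w → cont Π₂ (agree-trans ag₁ ag₂) λ g →
        let enc₂ = encodes-cong {ks = tuple a b c} (λ i → ⇔-trans (tb-cong {Π₁} {Π₂} {valueName (bits fs)} kept i) (tb-same Π (valueName (bits fs)) t i)) (enc g)
            wl , wr = w g
            clk = clocked (base-agree (agree-trans ag₁ ag₂) B) g
        in result-outcome true wl wr (λ vl vr _ → bwd (holds-result k {Π₂} {bits fs} clk enc₂ vl vr) comp)
             λ _ → reads-value {Π₂} {bits fs} enc₂ (computes-value k comp)
    where
    Π₁ = Π [ valueName (bits fs) ↦ᵗ t ]
    ag₁ : Agree (bits fs) Π Π₁
    ag₁ = agree-trace (under-value (bits fs))
  operation-plays {G} {Π} {fs} {x} {y} false k l r B playL playR K cont t m =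
    children false l r fs number K (playL Π₁ ag₁) (λ Π₂ ag₂ → playR Π₂ (agree-trans ag₁ ag₂)) (λ _ _ → outcome-stable false l)
      λ Π₂ ag₂ kept w → cont Π₂ (agree-trans ag₁ ag₂) λ g →
        let a , b , c , enc = sound B g t m
            enc₂ = encodes-cong {ks = tuple a b c} (λ i → ⇔-trans (tb-cong {Π₁} {Π₂} {valueName (bits fs)} kept i) (tb-same Π (valueName (bits fs)) t i)) enc
            wl , wr = w g
            clk = clocked (base-agree (agree-trans ag₁ ag₂) B) g
        in result-outcome false wl wr
             (λ vl vr R → reads-value {Π₂} {bits fs} enc₂ (computes-value k (fwd (holds-result k {Π₂} {bits fs} clk enc₂ vl vr) R))) λ ()
    where
    Π₁ = Π [ valueName (bits fs) ↦ᵗ t ]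
    ag₁ : Agree (bits fs) Π Π₁
    ag₁ = agree-trace (under-value (bits fs))

  term-plays : ∀ {G Π fs v} b t → Base G Π → Env G Π fs v (λ s x → s ≡ number × A.OccursIn x t) →
    Playable G Π b (fromTerm t) fs (OperandOutcome b (fromTerm t) fs (_≡ A.eval v t))
  term-plays b (A.var x) B env = leaf-number b B (env number x (refl , refl))
  term-plays b (t A.⊕ u) B env = operation-plays b plus (fromTerm t) (fromTerm u) B
    (λ Π₁ ag → term-plays b t (base-agree ag B) (env-down (lf b number) (λ _ _ → refl) ag (λ (e , o) → e , inj₁ o) env))
    (λ Π₁ ag → term-plays b u (base-agree ag B) (env-down rf (λ _ _ → refl) ag (λ (e , o) → e , inj₂ o) env))
  term-plays b (t A.⊗ u) B env = operation-plays b times (fromTerm t) (fromTerm u) B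
    (λ Π₁ ag → term-plays b t (base-agree ag B) (env-down (lf b number) (λ _ _ → refl) ag (λ (e , o) → e , inj₁ o) env))
    (λ Π₁ ag → term-plays b u (base-agree ag B) (env-down rf (λ _ _ → refl) ag (λ (e , o) → e , inj₂ o) env))

  ClassOutcome : Bool → Tree → List Frame → (ℕ → Bool) → Set → Assignment → Set
  ClassOutcome b t fs A P Π = (¬ (Π ⊨ᵠ matrix b t fs)) ×
    Transfer b P (tb Π (valueName (bits fs)) 0 × Reads Π (valueName (bits fs)) (λ m → A m ≡ true))

  leaf-class-sound : ∀ Π p q → Clock (tb Π (headerName clock)) → ¬ (Π ⊨ᵠ inst (leafName p q) (differs class))
  leaf-class-sound Π p q clk h = fwd (⊨-inst (leafName p q) Π (differs class)) h
    (bwd (holds-sameTrack (λ a → tb Π (leafName p q a)) clock clk 3 3 self self) λ _ → ⇔-refl)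

  -- If `A` belongs to the class, the player draws a marked trace that reads it; otherwise nothing
  -- is owed, and any element of the set will do.
  leaf-class : ∀ {G Π fs v C} b A → Base G Π → Bound G Π fs v class C →
    Playable G Π b (leaf class C) fs (ClassOutcome b (leaf class C) fs A (Func.to (cls v C) A ≡ true))
  leaf-class {G} {Π} {fs} {v} {C} true A B bound K cont with em {G × Func.to (cls v C) A ≡ true}
  ... | yes (g , p) = let t , m , b₀ , r = fwd (represents bound g A) p in t , m ,
    cont _ (agree-trace (under-value (bits fs))) λ g →
      leaf-class-sound (Π [ valueName (bits fs) ↦ᵗ t ]) (bits fs) (bits (look class C fs)) (clocked (base-agree (agree-trace {t = t} (under-value (bits fs))) B) g) ,
      λ _ → bwd (tb-same Π (valueName (bits fs)) t 0) b₀ , λ m → ⇔-trans (tb-same Π (valueName (bits fs)) t _) (r m)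
  ... | no n = let t , m = inhabited bound in t , m ,
    cont _ (agree-trace (under-value (bits fs))) λ g →
      leaf-class-sound (Π [ valueName (bits fs) ↦ᵗ t ]) (bits fs) (bits (look class C fs)) (clocked (base-agree (agree-trace {t = t} (under-value (bits fs))) B) g) ,
      λ p → contradiction (g , p) n
  leaf-class {G} {Π} {fs} {v} {C} false A B bound K cont t m =
    cont _ (agree-trace (under-value (bits fs))) λ g →
      leaf-class-sound (Π [ valueName (bits fs) ↦ᵗ t ]) (bits fs) (bits (look class C fs)) (clocked (base-agree (agree-trace {t = t} (under-value (bits fs))) B) g) ,
      λ (b₀ , r) → bwd (represents bound g A) (t , m , fwd (tb-same Π (valueName (bits fs)) t 0) b₀ ,
        λ m → ⇔-trans (⇔-sym (tb-same Π (valueName (bits fs)) t _)) (r m))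

  FormulaOutcome : Bool → Tree → List Frame → Set → Assignment → Set
  FormulaOutcome b t fs P Π = Transfer b P (Π ⊨ᵠ matrix b t fs)

  relation-outcome : ∀ b {R P ML MR VL VR} → Outcome b ML VL → Outcome b MR VR → (VL → VR → R ⇔ P) →
    Transfer b P (¬ (¬ R ⊎ (ML ⊎ MR)))
  relation-outcome true (nl , vl) (nr , vr) f p (inj₁ nR)       = nR (bwd (f vl vr) p)
  relation-outcome true (nl , vl) (nr , vr) f p (inj₂ (inj₁ l)) = nl l
  relation-outcome true (nl , vl) (nr , vr) f p (inj₂ (inj₂ r)) = nr r
  relation-outcome false hl hr f nh =
    fwd (f (hl (nh ∘ inj₂ ∘ inj₁)) (hr (nh ∘ inj₂ ∘ inj₂))) (stable (nh ∘ inj₁))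

  -- Treated apart from the other relations: the right operand has no value of its own, and its
  -- trace witnesses the membership of one particular set, or fails to.
  membership-outcome : ∀ b {R P ML MR VL E W} → Outcome b ML VL → (¬ MR) × Transfer b P E → (VL → R ⇔ E) →
    W ⇔ P → Transfer b W (¬ (¬ R ⊎ (ML ⊎ MR)))
  membership-outcome true (nl , vl) (nr , t) f e p (inj₁ nR)       = nR (bwd (f vl) (t (fwd e p)))
  membership-outcome true (nl , vl) (nr , t) f e p (inj₂ (inj₁ l)) = nl l
  membership-outcome true (nl , vl) (nr , t) f e p (inj₂ (inj₂ r)) = nr r
  membership-outcome false hl (nr , t) f e nh = bwd e (t (fwd (f (hl (nh ∘ inj₂ ∘ inj₁))) (stable (nh ∘ inj₁))))

  relation-plays : ∀ {G Π fs P} {VL VR : ℕ → Set} b k l r → Base G Π →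
    Playable G Π b l (lf b (rightSort (rel k)) ∷ fs) (OperandOutcome b l (lf b (rightSort (rel k)) ∷ fs) VL) →
    (∀ Π₁ → Agree (bits fs) Π Π₁ → Playable G Π₁ b r (rf ∷ fs) (OperandOutcome b r (rf ∷ fs) VR)) →
    (∀ Π₂ → Clock (tb Π₂ (headerName clock)) → Reads Π₂ (valueName (false ∷ bits fs)) VL →
      Reads Π₂ (valueName (true ∷ bits fs)) VR → holds (λ a → tb Π₂ (relName (bits fs) a)) 0 (related k) ⇔ P) →
    Playable G Π b (bin (rel k) l r) fs (FormulaOutcome b (bin (rel k) l r) fs P)
  relation-plays {fs = fs} b k l r B playL playR correct K cont =
    children b l r fs (rightSort (rel k)) K playL playR (λ _ _ → outcome-stable b l) λ Π₂ ag _ w → cont Π₂ ag λ g →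
      relation-outcome b (proj₁ (w g)) (proj₂ (w g)) λ vl vr →
        ⇔-trans (⊨-inst (relName (bits fs)) Π₂ (related k)) (correct Π₂ (clocked (base-agree ag B) g) vl vr)

  negation-outcome : ∀ b {P M} → Transfer (not b) P M → Transfer b (¬ P) (¬ M)
  negation-outcome true  h np = np ∘ h
  negation-outcome false h nm = nm ∘ h

  disjunction-outcome : ∀ b {P Q M N} → Transfer b P M → Transfer b Q N → Transfer b (P ⊎ Q) (M ⊎ N)
  disjunction-outcome true  f g (inj₁ p) = inj₁ (f p)
  disjunction-outcome true  f g (inj₂ q) = inj₂ (g q)
  disjunction-outcome false f g (inj₁ m) = inj₁ (f m)
  disjunction-outcome false f g (inj₂ n) = inj₂ (g n)

  anything : (s : Sort) → ⟦ s ⟧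
  anything number = 0
  anything set    = const false
  anything class  = record { to = const false ; cong = const refl }

  env-bind : ∀ {G Π Π₁ fs v s x a} {Fr Fr′ : Sort → Name → Set} → Agree (bits fs) Π Π₁ →
    Inhabited s Π₁ (setName (bits fs)) → (G → Represents s Π₁ (choiceName (bits fs)) (setName (bits fs)) a) →
    (∀ {s′ y} → ¬ (s′ ≡ s × y ≡ x) → Fr′ s′ y → Fr s′ y) →
    Env G Π fs v Fr → Env G Π₁ (bd s x ∷ fs) (v [ s , x ↦ a ]) Fr′
  env-bind {G} {Π} {Π₁} {fs} {v} {s} {x} {a} ag inh rep sub env s′ y h = split (s′ ≟ₛ s) (y ≟ⁿ x)
    where
    other : ¬ (s′ ≡ s × y ≡ x) → Bound G Π₁ (bd s x ∷ fs) (v [ s , x ↦ a ]) s′ y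
    other ne = let b = bound-down {f = bd s x} (look-there fs ne) (bound-agree ag (env s′ y (sub ne h))) in record
      { proper = proper b ; inhabited = inhabited b
      ; represents = λ g → subst (Represents s′ Π₁ (choiceName (bits (look s′ y (bd s x ∷ fs)))) (setName (bits (look s′ y (bd s x ∷ fs))))) (sym (valueOf-other v a ne)) (represents b g) }
    split : Dec (s′ ≡ s) → Dec (y ≡ x) → Bound G Π₁ (bd s x ∷ fs) (v [ s , x ↦ a ]) s′ y
    split (yes refl) (yes refl) = record
      { proper     = subst (λ gs → length (bits gs) < suc (length (bits fs))) (sym (look-here s x fs)) ≤-refl
      ; inhabited  = subst (λ gs → Inhabited s Π₁ (setName (bits gs))) (sym (look-here s x fs)) inh
      ; represents = λ g → subst (λ gs → Represents s Π₁ (choiceName (bits gs)) (setName (bits gs)) (valueOf (v [ s , x ↦ a ]) s x)) (sym (look-here s x fs))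
          (subst (Represents s Π₁ (choiceName (bits fs)) (setName (bits fs))) (sym (valueOf-same v s x a)) (rep g)) }
    split (yes _) (no y≢x) = other (y≢x ∘ proj₂)
    split (no s≢s′) _      = other (s≢s′ ∘ proj₁)

  -- At a quantifier of his own the player chooses a witness found in the standard model; at one of
  -- the opponent the trace or set chosen is decoded into a value, to which the induction hypothesis
  -- applies. A negation exchanges the roles.
  formula-plays : ∀ {G Π fs v} b φ → Base G Π → Env G Π fs v (λ s x → A.Free s x φ) →
    Playable G Π b (fromFormula φ) fs (FormulaOutcome b (fromFormula φ) fs (v A.⊨ φ))
  formula-plays {fs = fs} b (t A.≐ u) B env = relation-plays b equal (fromTerm t) (fromTerm u) B
    (term-plays b t B (env-down (lf b number) (λ _ _ → refl) agree-refl (λ (e , o) → e , inj₁ o) env))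
    (λ Π₁ ag → term-plays b u (base-agree ag B) (env-down rf (λ _ _ → refl) ag (λ (e , o) → e , inj₂ o) env))
    λ Π₂ clk vl vr → same-values (λ a → tb Π₂ (relName (bits fs) a)) clock clk {lhs} {rhs} vl vr
  formula-plays {fs = fs} b (t A.≺ u) B env = relation-plays b less (fromTerm t) (fromTerm u) B
    (term-plays b t B (env-down (lf b number) (λ _ _ → refl) agree-refl (λ (e , o) → e , inj₁ o) env))
    (λ Π₁ ag → term-plays b u (base-agree ag B) (env-down rf (λ _ _ → refl) ag (λ (e , o) → e , inj₂ o) env))
    λ Π₂ clk vl vr → smaller-value (λ a → tb Π₂ (relName (bits fs) a)) clock clk {lhs} {rhs} vl vr
  formula-plays {fs = fs} b (t A.∈₁ C) B env = relation-plays b mem₁ (fromTerm t) (leaf set C) B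
    (term-plays b t B (env-down (lf b set) (λ _ _ → refl) agree-refl inj₁ env))
    (λ Π₁ ag → leaf-set b (base-agree ag B) (env-down rf (λ _ _ → refl) ag id env set C (inj₂ (refl , refl))))
    λ Π₂ clk vl vr → ⇔-trans (member-value (λ a → tb Π₂ (relName (bits fs) a)) clock clk {lhs} {rhs} vl) (vr _)
  formula-plays {G} {Π} {fs} {v} b (S A.∈₂ C) B env K cont =
    children b (leaf set S) (leaf class C) fs class K
      (leaf-set b B (env-down (lf b class) (λ _ _ → refl) agree-refl id env set S (inj₁ (refl , refl))))
      (λ Π₁ ag → leaf-class b (st v S) (base-agree ag B) (env-down rf (λ _ _ → refl) ag id env class C (inj₂ (refl , refl))))
      (λ _ _ → outcome-stable b (leaf set S) {s = class} {fs = fs} {V = λ m → st v S m ≡ true}) λ Π₂ ag _ w → cont Π₂ ag λ g →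
        membership-outcome b (proj₁ (w g)) (proj₂ (w g))
          (λ vl → ⇔-trans (⊨-inst (relName (bits fs)) Π₂ (related mem₂)) (⇔-trans conj (⇔-refl ⇔×
            ⇔-trans (holds-sameTrack (λ a → tb Π₂ (relName (bits fs) a)) clock (clocked (base-agree ag B) g) 3 3 lhs rhs)
              (⇔Π λ m → mk⇔ (λ e → ⇔-trans (⇔-sym e) (vl m)) (λ e → ⇔-trans (vl m) (⇔-sym e))))))
          ⇔-refl
  formula-plays b (A.¬′ φ) B env K cont =
    formula-plays (not b) φ B (env-down rf (λ _ _ → refl) agree-refl id env) K
      λ Π′ ag w → cont Π′ (agree-child ag) λ g → negation-outcome b (w g)
  formula-plays {fs = fs} b (φ A.∨ ψ) B env K cont =
    children b (fromFormula φ) (fromFormula ψ) fs number K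
      (formula-plays b φ B (env-down (lf b number) (λ _ _ → refl) agree-refl inj₁ env))
      (λ Π₁ ag → formula-plays b ψ (base-agree ag B) (env-down rf (λ _ _ → refl) ag inj₂ env))
      (λ _ _ ag → transfer-map b (left-stable b (fromFormula φ) ag))
      λ Π₂ ag _ w → cont Π₂ ag λ g → disjunction-outcome b (proj₁ (w g)) (proj₂ (w g))
  formula-plays {fs = fs} {v} true (A.∃′ s x φ) B env K cont with em {∃[ a ] (v [ s , x ↦ a ] A.⊨ φ)}
  ... | yes (a , p) = pick (under-choice (bits fs)) B s a λ Π₁ ag inh rep →
    formula-plays true φ (base-agree ag B) (env-bind ag inh rep _,_ env) K
      λ Π′ ag′ w → cont Π′ (agree-trans ag (agree-child ag′)) λ g _ → w g p
  -- The formula is false, so nothing has to be achieved, but a move must still be made.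
  ... | no np = pick (under-choice (bits fs)) B s (anything s) λ Π₁ ag inh rep →
    formula-plays true φ (base-agree ag B) (env-bind ag inh rep _,_ env) K
      λ Π′ ag′ w → cont Π′ (agree-trans ag (agree-child ag′)) λ g p → contradiction p np
  formula-plays {fs = fs} {v} false (A.∃′ s x φ) B env K cont =
    every (under-choice (bits fs)) B s λ a Π₁ ag inh rep →
      formula-plays false φ (base-agree ag B) (env-bind ag inh rep _,_ env) K
        λ Π′ ag′ w → cont Π′ (agree-trans ag (agree-child ag′)) λ g m → a , w g m
  formula-plays {fs = fs} {v} true (A.∀′ s x φ) B env K cont =
    every (under-choice (bits fs)) B s λ a Π₁ ag inh rep →
      formula-plays true φ (base-agree ag B) (env-bind ag inh rep _,_ env) K
        λ Π′ ag′ w → cont Π′ (agree-trans ag (agree-child ag′)) λ g p → w g (p a)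
  formula-plays {fs = fs} {v} false (A.∀′ s x φ) B env K cont with em {∃[ a ] (¬ (v [ s , x ↦ a ] A.⊨ φ))}
  ... | yes (a , np) = pick (under-choice (bits fs)) B s a λ Π₁ ag inh rep →
    formula-plays false φ (base-agree ag B) (env-bind ag inh rep _,_ env) K
      λ Π′ ag′ w → cont Π′ (agree-trans ag (agree-child ag′)) λ g m → contradiction (w g m) np
  ... | no nnp = pick (under-choice (bits fs)) B s (anything s) λ Π₁ ag inh rep →
    formula-plays false φ (base-agree ag B) (env-bind ag inh rep _,_ env) K
      λ Π′ ag′ w → cont Π′ (agree-trans ag (agree-child ag′)) λ g m a → stable λ np → nnp (a , np)

-- The header and the set of tuples

abstract
  tuple-a : ∀ a b → a * b + b ≡ suc a * b + 0
  tuple-a = solve-∀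

  tuple-a-time : ∀ a b → suc (a + b + (a * b + b)) ≡ suc a + b + (suc a * b + 0)
  tuple-a-time = solve-∀

advances-r : ∀ a b r → applyAll advance-r (tuple a b r) ≡ tuple a b (suc r)
advances-r a b r = cong₂ (λ d e → a , b , suc r , d , e) (sym (+-suc (a * b) r))
  (trans (sym (+-suc (a + b) (a * b + r))) (cong (a + b +_) (sym (+-suc (a * b) r))))

-- At r = b the carry is invisible in the value, since ab + b = (a + 1) b + 0. Thus the product is
-- built up although each track only stays, moves by one or is reset.
advances-a : ∀ a b → applyAll advance-a (tuple a b b) ≡ tuple (suc a) b 0
advances-a a b = cong₂ (λ d e → suc a , b , 0 , d , e) (tuple-a a b) (tuple-a-time a b)

advances-b : ∀ b → applyAll advance-b (tuple 0 b 0) ≡ tuple 0 (suc b) 0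
advances-b b = refl

-- The polarities stored in the frames do not matter for names.
record SameNames (fs fs′ : List Frame) : Set where
  field
    same-bits : bits fs ≡ bits fs′
    same-look : ∀ s x → bits (look s x fs) ≡ bits (look s x fs′)
open SameNames

same-lf : ∀ {b s b′ s′ fs fs′} → SameNames fs fs′ → SameNames (lf b s ∷ fs) (lf b′ s′ ∷ fs′)
same-bits (same-lf e) = cong (false ∷_) (same-bits e)
same-look (same-lf e) = same-look e

same-rf : ∀ {fs fs′} → SameNames fs fs′ → SameNames (rf ∷ fs) (rf ∷ fs′)
same-bits (same-rf e) = cong (true ∷_) (same-bits e)
same-look (same-rf e) = same-look e

same-bd : ∀ {s x fs fs′} → SameNames fs fs′ → SameNames (bd s x ∷ fs) (bd s x ∷ fs′)
same-bits (same-bd e) = cong (true ∷_) (same-bits e)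
same-look (same-bd {s} {x} e) s′ y with s′ ≟ₛ s | y ≟ⁿ x
... | yes _ | yes _ = same-bits e
... | yes _ | no  _ = same-look e s′ y
... | no  _ | _     = same-look e s′ y

same-refl : ∀ {fs} → SameNames fs fs
same-bits same-refl     = refl
same-look same-refl s x = refl

module Header (n : ℕ) (p₀ : Fin n) (em : ExcludedMiddle 0ℓ) where

  open Translation n p₀
  open Satisfaction n
  open Reading em
  open Correctness n p₀ em
  open H using (Trace; _⊨_; _⊨ᵠ_)

  matrix-same : ∀ b b′ t {fs fs′} → SameNames fs fs′ → matrix b t fs ≡ matrix b′ t fs′
  matrix-same b b′ (leaf s x) e = cong₂ (λ p q → inst (leafName p q) (differs s)) (same-bits e) (same-look e s x)
  matrix-same b b′ (bin (arith k) l r) e = cong₂ (λ p m → H.¬′ inst (resultName p) (result k) H.∨ m) (same-bits e)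
    (cong₂ H._∨_ (matrix-same b b′ l (same-lf e)) (matrix-same b b′ r (same-rf e)))
  matrix-same b b′ (bin (rel k) l r) e = cong₂ (λ p m → H.¬′ (H.¬′ inst (relName p) (related k) H.∨ m)) (same-bits e)
    (cong₂ H._∨_ (matrix-same b b′ l (same-lf e)) (matrix-same b b′ r (same-rf e)))
  matrix-same b b′ (bin or l r) e = cong₂ H._∨_ (matrix-same b b′ l (same-lf e)) (matrix-same b b′ r (same-rf e))
  matrix-same b b′ (neg t) e = cong H.¬′_ (matrix-same (not b) (not b′) t (same-rf e))
  matrix-same b b′ (quant _ s x t) e = matrix-same b b′ t (same-bd e)

  Excludes : H.Formula → H.Formula → Set
  Excludes K K′ = ∀ Π → Π ⊨ K → ¬ (Π ⊨ K′)

  excludes-π : ∀ b π Y {K K′} → Excludes K K′ → Excludes (quantπ (not b) π Y K) (quantπ b π Y K′)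
  excludes-π true  π Y e Π all (t , m , h) = e _ (all t m) h
  excludes-π false π Y e Π (t , m , h) all = e _ h (all t m)

  excludes-X : ∀ b Y {K K′} → Excludes K K′ → Excludes (quantX (not b) Y K) (quantX b Y K′)
  excludes-X true  Y e Π all (T , h) = e _ (all T) h
  excludes-X false Y e Π (T , h) all = e _ h (all T)

  excludes-choose : ∀ b s π p {K K′} → Excludes K K′ → Excludes (choose (not b) s π p K) (choose b s π p K′)
  excludes-choose b number π p e = excludes-π b π tuples e
  excludes-choose b set    π p e = excludes-X b (setName p) (excludes-π b π (setName p) e)
  excludes-choose b class  π p e = excludes-X b (setName p) (excludes-π b π (setName p) e)

  flip-not : ∀ e b → flip e (not b) ≡ not (flip e b)
  flip-not true  b = refl
  flip-not false b = refl

  -- Reversing the polarity turns every quantifier of the prefix into its dual, and dual quantifiers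
  -- preserve incompatibility.
  excludes : ∀ b t {fs fs′ K K′} → SameNames fs fs′ → Excludes K K′ → Excludes (prefix (not b) t fs K) (prefix b t fs′ K′)
  excludes b (leaf number x) e ex rewrite same-bits e = excludes-choose b number _ [] ex
  excludes b (leaf set x)    e ex rewrite same-bits e = excludes-choose b set _ _ ex
  excludes b (leaf class x)  e ex rewrite same-bits e | same-look e class x = excludes-π b _ _ ex
  excludes b (bin (arith k) l r) e ex rewrite same-bits e =
    excludes-π b _ tuples (excludes b l (same-lf e) (excludes b r (same-rf e) ex))
  excludes b (bin (rel k) l r) e ex = excludes b l (same-lf e) (excludes b r (same-rf e) ex)
  excludes b (bin or l r)      e ex = excludes b l (same-lf e) (excludes b r (same-rf e) ex)
  excludes b (neg t)           e ex = excludes (not b) t (same-rf e) ex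
  excludes b (quant q s x t)   e ex rewrite same-bits e | flip-not q b =
    excludes-choose (flip q b) s _ _ (excludes b t (same-bd e) ex)

  -- By duality, what a player can avoid is not forced upon him.
  forced : ∀ φ {v Π G ψ} → Base G Π → Env G Π [] v (λ s x → A.Free s x φ) →
    (∀ Π′ → Agree [] Π Π′ → (G → Π′ ⊨ᵠ matrix true (fromFormula φ) [] → v A.⊨ φ) → ¬ (Π′ ⊨ᵠ ψ)) →
    ¬ (Π ⊨ prefix true (fromFormula φ) [] (H.qf ψ))
  forced φ {v} {Π} {ψ = ψ} B env avoid = excludes true (fromFormula φ) {K = H.qf (H.¬′ ψ)} same-refl (λ _ → id) Π
    (formula-plays false φ B env (H.qf (H.¬′ ψ)) λ Π′ ag w → avoid Π′ ag λ g m →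
      w g (subst (Π′ ⊨ᵠ_) (matrix-same true false (fromFormula φ) same-refl) m))

  HeaderBits : (HeaderVar → Trace) → HeaderVar → ℕ → Set
  HeaderBits ts a = Bit (ts a)

  assign : (c t₀ t t₁ t₂ t₃ t₄ : Trace) → HeaderVar → Trace
  assign c t₀ t t₁ t₂ t₃ t₄ clock   = c
  assign c t₀ t t₁ t₂ t₃ t₄ base    = t₀
  assign c t₀ t t₁ t₂ t₃ t₄ current = t
  assign c t₀ t t₁ t₂ t₃ t₄ succ₁   = t₁
  assign c t₀ t t₁ t₂ t₃ t₄ succ₂   = t₂
  assign c t₀ t t₁ t₂ t₃ t₄ succ₃   = t₃
  assign c t₀ t t₁ t₂ t₃ t₄ pred    = t₄

  module _ (B : HeaderVar → ℕ → Set) (clk : Clock (B clock)) where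
    open Tracks {HeaderVar} clock

    holds-allZero : ∀ t → holds B 0 (allZero t) ⇔ Encodes (B t) (tuple 0 0 0)
    holds-allZero t = ⇔-trans conj (holds-isZero B clock clk 0 t ⇔× ⇔-trans conj (holds-isZero B clock clk 1 t ⇔×
      ⇔-trans conj (holds-isZero B clock clk 2 t ⇔× ⇔-trans conj (holds-isZero B clock clk 3 t ⇔× holds-isZero B clock clk 4 t))))

    holds-advance : ∀ {s t} os {ks ls} → applyAll os ks ≡ ls → Encodes (B s) ks → holds B 0 (step os s t) ⇔ Encodes (B t) ls
    holds-advance {s} {t} os refl e = holds-step B clock clk {s} {t} os e

    holds-atEnd : ∀ {t a b r} → Encodes (B t) (tuple a b r) → holds B 0 (atEnd t) ⇔ (r ≡ b)
    holds-atEnd {t} (_ , t₁ , t₂ , _) = same-values B clock clk {t} {t} t₂ t₁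

    holds-atStart : ∀ {t a b r} → Encodes (B t) (tuple a b r) → holds B 0 (atStart t) ⇔ (a ≡ 0 × r ≡ 0)
    holds-atStart {t} {a} {b} {r} (t₀ , _ , t₂ , t₃ , _) = mk⇔
      (λ h → let h₀ , h′ = fwd conj h
                 h₂ , _  = fwd conj h′
             in sym (fwd (t₀ 0) (bwd (fwd (holds-isZero B clock clk 0 t) h₀ 0) refl)) ,
                sym (fwd (t₂ 0) (bwd (fwd (holds-isZero B clock clk 2 t) h₂ 0) refl)))
      λ { (refl , refl) → bwd conj (bwd (holds-isZero B clock clk 0 t) t₀ , bwd conj
          (bwd (holds-isZero B clock clk 2 t) t₂ , bwd (holds-isZero B clock clk 3 t) t₃)) }

    -- The rank track is consulted mark by mark, because during the descent neither trace is yet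
    -- known to encode a tuple.
    earlier : ∀ o₀ o₁ o₂ o₃ s t m → holds B 0 (step (o₀ , o₁ , o₂ , o₃ , inc) s t) → B t (4 + m * 5) →
      ∃[ l ] m ≡ suc l × B s (4 + l * 5)
    earlier o₀ o₁ o₂ o₃ s t m h b =
      let _ , h = fwd conj h
          _ , h = fwd conj h
          _ , h = fwd conj h
          _ , h = fwd conj h
          nz , h = fwd conj h
      in settle m nz (fwd (holds-everyBlock B clock clk (iff′ (bit 4 s) (nextN 5 (bit 4 t)))) h) b
      where
      settle : ∀ m → ¬ B t 4 → (∀ m → holds B (m * 5) (iff′ (bit 4 s) (nextN 5 (bit 4 t)))) → B t (4 + m * 5) → ∃[ l ] m ≡ suc l × B s (4 + l * 5)
      settle zero    nz h b = contradiction b nz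
      settle (suc l) nz h b = l , refl , bwd (fwd iff (h l)) b

  module _ (B : HeaderVar → ℕ → Set) where
    open Tracks {HeaderVar} clock

    lawful-parts : holds B 0 lawful ⇔ (holds B 0 isClock × holds B 0 (allZero base) × holds B 0 (step advance-r current succ₁) ×
      (holds B 0 (atEnd current) → holds B 0 (step advance-a current succ₂)) ×
      (holds B 0 (atStart current) → holds B 0 (step advance-b current succ₃)) ×
      holds B 0 (someBlock (bit 4 current)) × holds B 0 originates)
    lawful-parts = ⇔-trans conj (⇔-refl ⇔× ⇔-trans conj (⇔-refl ⇔× ⇔-trans conj (⇔-refl ⇔×
      ⇔-trans conj (impl ⇔× ⇔-trans conj (impl ⇔× conj)))))

    originates-parts : holds B 0 originates ⇔ (holds B 0 (allZero current) ⊎ holds B 0 (step advance-r pred current) ⊎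
      (holds B 0 (atEnd pred) × holds B 0 (step advance-a pred current)) ⊎
      (holds B 0 (atStart pred) × holds B 0 (step advance-b pred current)))
    originates-parts = ⇔-refl ⇔⊎ ⇔-refl ⇔⊎ conj ⇔⊎ conj

  -- The meaning of lawful, with tuples instead of tracks.
  record Lawful (B : HeaderVar → ℕ → Set) : Set where
    field
      clocked : Clock (B clock)
      zeroes  : Encodes (B base) (tuple 0 0 0)
      next-r  : ∀ a b r → Encodes (B current) (tuple a b r) → Encodes (B succ₁) (tuple a b (suc r))
      next-a  : ∀ a b → Encodes (B current) (tuple a b b) → Encodes (B succ₂) (tuple (suc a) b 0)
      next-b  : ∀ b → Encodes (B current) (tuple 0 b 0) → Encodes (B succ₃) (tuple 0 (suc b) 0)
      timed   : ∃[ m ] B current (4 + m * 5)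
      descent : Encodes (B current) (tuple 0 0 0) ⊎
        ((∀ m → B current (4 + m * 5) → ∃[ l ] m ≡ suc l × B pred (4 + l * 5)) ×
         (∀ a b r → Encodes (B pred) (tuple a b r) → ∃[ a ] ∃[ b ] ∃[ r ] Encodes (B current) (tuple a b r)))

  module _ (B : HeaderVar → ℕ → Set) (clk : Clock (B clock)) where
    open Tracks {HeaderVar} clock

    lawful-descent : holds B 0 (allZero current) ⊎ holds B 0 (step advance-r pred current) ⊎
      (holds B 0 (atEnd pred) × holds B 0 (step advance-a pred current)) ⊎
      (holds B 0 (atStart pred) × holds B 0 (step advance-b pred current)) →
      Encodes (B current) (tuple 0 0 0) ⊎
        ((∀ m → B current (4 + m * 5) → ∃[ l ] m ≡ suc l × B pred (4 + l * 5)) ×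
         (∀ a b r → Encodes (B pred) (tuple a b r) → ∃[ a ] ∃[ b ] ∃[ r ] Encodes (B current) (tuple a b r)))
    lawful-descent (inj₁ z) = inj₁ (fwd (holds-allZero B clk current) z)
    lawful-descent (inj₂ (inj₁ s)) = inj₂ ((λ m → earlier B clk same same inc inc pred current m s) ,
      λ a b r e → a , b , suc r , fwd (holds-advance B clk {pred} {current} advance-r (advances-r a b r) e) s)
    lawful-descent (inj₂ (inj₂ (inj₁ (end , s)))) = inj₂ ((λ m → earlier B clk inc same reset same pred current m s) ,
      λ a b r e → suc a , b , 0 , fwd (holds-advance B clk {pred} {current} advance-a (advances-a a b)
        (subst (λ r → Encodes (B pred) (tuple a b r)) (fwd (holds-atEnd B clk {pred} {a} {b} {r} e) end) e)) s)
    lawful-descent (inj₂ (inj₂ (inj₂ (start , s)))) = inj₂ ((λ m → earlier B clk same inc same same pred current m s) ,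
      λ a b r e → let a≡0 , r≡0 = fwd (holds-atStart B clk {pred} {a} {b} {r} e) start in
        0 , suc b , 0 , fwd (holds-advance B clk {pred} {current} advance-b (advances-b b)
          (subst₂ (λ a r → Encodes (B pred) (tuple a b r)) a≡0 r≡0 e)) s)

  lawful-elim : ∀ B → holds B 0 lawful → Lawful B
  lawful-elim B h = let k , z , r , a , b , t , o = fwd (lawful-parts B) h
                        clk = fwd (holds-isClock B clock) k in record
    { clocked = clk
    ; zeroes  = fwd (holds-allZero B clk base) z
    ; next-r  = λ x y z e → fwd (holds-advance B clk {current} {succ₁} advance-r (advances-r x y z) e) r
    ; next-a  = λ x y e → fwd (holds-advance B clk {current} {succ₂} advance-a (advances-a x y) e)
        (a (bwd (holds-atEnd B clk {current} {x} {y} {y} e) refl))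
    ; next-b  = λ y e → fwd (holds-advance B clk {current} {succ₃} advance-b (advances-b y) e)
        (b (bwd (holds-atStart B clk {current} {0} {y} {0} e) (refl , refl)))
    ; timed   = fwd (holds-someBlock B clock clk 0 (Tracks.bit clock 4 current)) t
    ; descent = lawful-descent B clk (fwd (originates-parts B) o) }

  module Extraction (c t₀ : Trace) (Φ : Trace → Set) (t₀∈ : Φ t₀)
    (lawful-at : ∀ t → Φ t → ∃[ t₁ ] Φ t₁ × ∃[ t₂ ] Φ t₂ × ∃[ t₃ ] Φ t₃ × ∃[ t₄ ] Φ t₄ ×
       Lawful (HeaderBits (assign c t₀ t t₁ t₂ t₃ t₄))) where

    open Lawful

    Found : Trace → Set
    Found t = ∃[ a ] ∃[ b ] ∃[ r ] Encodes (Bit t) (tuple a b r)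

    isClock′ : Clock (Bit c)
    isClock′ with lawful-at t₀ t₀∈
    ... | _ , _ , _ , _ , _ , _ , _ , _ , law = clocked law

    -- Induction on a marked rank `m`. Each step lowers the mark by one and none can produce a mark
    -- in block 0, so at rank 0 only the zero tuple remains; on the way back each step yields a
    -- tuple from a tuple.
    originated : ∀ m t → Φ t → Bit t (4 + m * 5) → Found t
    originated m t t∈ b with lawful-at t t∈
    ... | _ , _ , _ , _ , _ , _ , t₄ , t₄∈ , law with descent law
    ... | inj₁ e = 0 , 0 , 0 , e
    ... | inj₂ (earlier′ , advance′) with earlier′ m b
    ... | l , refl , b′ = let x , y , z , e = originated l t₄ t₄∈ b′ in advance′ x y z e

    all-sound : ∀ t → Φ t → Found t
    all-sound t t∈ with lawful-at t t∈
    ... | _ , _ , _ , _ , _ , _ , _ , _ , law = let m , b = timed law in originated m t t∈ b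

    -- Lexicographic recursion on a, b, r that follows the steps backwards: (a + 1, b, 0) is reached
    -- from (a, b, b), and (0, b + 1, 0) from (0, b, 0).
    all-complete : ∀ a b r → ∃[ t ] Φ t × Encodes (Bit t) (tuple a b r)
    all-complete a b (suc r) with all-complete a b r
    ... | t , t∈ , e with lawful-at t t∈
    ... | t₁ , t₁∈ , _ , _ , _ , _ , _ , _ , law = t₁ , t₁∈ , next-r law a b r e
    all-complete (suc a) b zero with all-complete a b b
    ... | t , t∈ , e with lawful-at t t∈
    ... | _ , _ , t₂ , t₂∈ , _ , _ , _ , _ , law = t₂ , t₂∈ , next-a law a b e
    all-complete zero (suc b) zero with all-complete zero b zero
    ... | t , t∈ , e with lawful-at t t∈
    ... | _ , _ , _ , _ , t₃ , t₃∈ , _ , _ , law = t₃ , t₃∈ , next-b law b e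
    all-complete zero zero zero with lawful-at t₀ t₀∈
    ... | _ , _ , _ , _ , _ , _ , _ , _ , law = t₀ , t₀∈ , zeroes law

holds-cong : ∀ {V : Set} {B B′ : V → ℕ → Set} → (∀ a i → B a i ⇔ B′ a i) → ∀ φ i → holds B i φ ⇔ holds B′ i φ
holds-cong e (at′ a)      i = e a i
holds-cong e (not′ φ)     i = ⇔¬ (holds-cong e φ i)
holds-cong e (next′ φ)    i = holds-cong e φ (suc i)
holds-cong e (or′ φ ψ)    i = holds-cong e φ i ⇔⊎ holds-cong e ψ i
holds-cong e (until′ φ ψ) i = ⇔Σ λ j → holds-cong e ψ (i + j) ⇔× ⇔Π λ j′ → ⇔→ (holds-cong e φ (i + j′))

module HeaderCorrectness (n : ℕ) (p₀ : Fin n) (em : ExcludedMiddle 0ℓ) where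

  open Translation n p₀
  open Satisfaction n
  open Reading em
  open Correctness n p₀ em
  open Header n p₀ em
  open H using (Assignment; Trace; TraceSet; _⊨_; _⊨ᵠ_; _∈ᵗ_; _[_↦ᵗ_]; _[_↦ˢ_])

  tupleTracks : Five ℕ → ℕ → ℕ → Bool
  tupleTracks (k , _ , _ , _ , _) 0 m = does (m ≟ k)
  tupleTracks (_ , k , _ , _ , _) 1 m = does (m ≟ k)
  tupleTracks (_ , _ , k , _ , _) 2 m = does (m ≟ k)
  tupleTracks (_ , _ , _ , k , _) 3 m = does (m ≟ k)
  tupleTracks (_ , _ , _ , _ , k) _ m = does (m ≟ k)

  tupleTrace : Five ℕ → Trace
  tupleTrace ks = fromTracks (tupleTracks ks)

  tupleTrace-encodes : ∀ ks → Encodes (Bit (tupleTrace ks)) ks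
  tupleTrace-encodes ks =
    (λ m → ⇔-trans (Bit-fromTracks (tupleTracks ks) 0 m (s≤s z≤n)) (does⇔ (m ≟ _))) ,
    (λ m → ⇔-trans (Bit-fromTracks (tupleTracks ks) 1 m (s≤s (s≤s z≤n))) (does⇔ (m ≟ _))) ,
    (λ m → ⇔-trans (Bit-fromTracks (tupleTracks ks) 2 m (s≤s (s≤s (s≤s z≤n)))) (does⇔ (m ≟ _))) ,
    (λ m → ⇔-trans (Bit-fromTracks (tupleTracks ks) 3 m (s≤s (s≤s (s≤s (s≤s z≤n))))) (does⇔ (m ≟ _))) ,
    (λ m → ⇔-trans (Bit-fromTracks (tupleTracks ks) 4 m (s≤s (s≤s (s≤s (s≤s (s≤s z≤n)))))) (does⇔ (m ≟ _)))

  clockTracks : ℕ → ℕ → Bool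
  clockTracks zero    _ = true
  clockTracks (suc _) _ = false

  clockTrace : Trace
  clockTrace = fromTracks clockTracks

  clockTrace-clock : Clock (Bit clockTrace)
  clockTrace-clock = record
    { marks = λ m → bwd (Bit-fromTracks clockTracks 0 m (s≤s z≤n)) refl
    ; only  = λ i b → i / 5 , trans (m≡m%n+[m/n]*n i 5)
        (cong (_+ (i / 5) * 5) (first {i / 5} (i % 5) (fwd (Bit-fromBits (spread clockTracks) i) b))) }
    where
    first : ∀ {m} j → clockTracks j m ≡ true → j ≡ 0
    first zero _ = refl

  IsTuple : Trace → Set
  IsTuple t = ∃[ a ] ∃[ b ] ∃[ r ] Encodes (Bit t) (tuple a b r)

  isTuple-cong : ∀ {t t′} → (∀ i → t i ≡ t′ i) → IsTuple t → IsTuple t′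
  isTuple-cong e (a , b , r , h) = a , b , r , encodes-cong {ks = tuple a b r} (λ i → ≡⇒⇔ (cong (p₀ ∈ₛ_) (sym (e i)))) h

  tupleSet : TraceSet
  tupleSet = record
    { to   = λ t → does (em {IsTuple t})
    ; cong = λ e → ⇔→≡ (⇔-trans (does⇔ em) (⇔-trans (mk⇔ (isTuple-cong e) (isTuple-cong (sym ∘ e))) (⇔-sym (does⇔ em)))) }

  ∈-tupleSet : ∀ t → (t ∈ᵗ tupleSet) ⇔ IsTuple t
  ∈-tupleSet t = does⇔ em

  tuple∈ : ∀ a b r → tupleTrace (tuple a b r) ∈ᵗ tupleSet
  tuple∈ a b r = bwd (∈-tupleSet (tupleTrace (tuple a b r))) (a , b , r , tupleTrace-encodes (tuple a b r))

  origin : Trace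
  origin = tupleTrace (tuple 0 0 0)

  -- The cases invert the three steps in the same order of priority: first r, then a, then b is
  -- lowered, and only the zero tuple needs no predecessor.
  origin-of : ∀ t t₁ t₂ t₃ a b r → Encodes (Bit t) (tuple a b r) →
    ∃[ t₄ ] t₄ ∈ᵗ tupleSet × holds (HeaderBits (assign clockTrace origin t t₁ t₂ t₃ t₄)) 0 originates
  origin-of t t₁ t₂ t₃ x y (suc z) e = t₄ , tuple∈ x y z , bwd (originates-parts B) (inj₂ (inj₁
      (bwd (holds-advance B clockTrace-clock {pred} {current} advance-r (advances-r x y z) (tupleTrace-encodes (tuple x y z))) e)))
    where
    t₄ = tupleTrace (tuple x y z)
    B = HeaderBits (assign clockTrace origin t t₁ t₂ t₃ t₄)
  origin-of t t₁ t₂ t₃ (suc x) y zero e = t₄ , tuple∈ x y y , bwd (originates-parts B) (inj₂ (inj₂ (inj₁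
      ( bwd (holds-atEnd B clockTrace-clock {pred} (tupleTrace-encodes (tuple x y y))) refl
      , bwd (holds-advance B clockTrace-clock {pred} {current} advance-a (advances-a x y) (tupleTrace-encodes (tuple x y y))) e))))
    where
    t₄ = tupleTrace (tuple x y y)
    B = HeaderBits (assign clockTrace origin t t₁ t₂ t₃ t₄)
  origin-of t t₁ t₂ t₃ zero (suc y) zero e = t₄ , tuple∈ 0 y 0 , bwd (originates-parts B) (inj₂ (inj₂ (inj₂
      ( bwd (holds-atStart B clockTrace-clock {pred} (tupleTrace-encodes (tuple 0 y 0))) (refl , refl)
      , bwd (holds-advance B clockTrace-clock {pred} {current} advance-b (advances-b y) (tupleTrace-encodes (tuple 0 y 0))) e))))
    where
    t₄ = tupleTrace (tuple 0 y 0)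
    B = HeaderBits (assign clockTrace origin t t₁ t₂ t₃ t₄)
  origin-of t t₁ t₂ t₃ zero zero zero e = origin , tuple∈ 0 0 0 ,
    bwd (originates-parts B) (inj₁ (bwd (holds-allZero B clockTrace-clock current) e))
    where B = HeaderBits (assign clockTrace origin t t₁ t₂ t₃ origin)

  module Built (t : Trace) (a b r : ℕ) (e : Encodes (Bit t) (tuple a b r)) where

    next-r next-a next-b : Trace
    next-r = tupleTrace (tuple a b (suc r))
    next-a = tupleTrace (tuple (suc a) b 0)
    next-b = tupleTrace (tuple 0 (suc b) 0)

    bitsOf : Trace → HeaderVar → ℕ → Set
    bitsOf t₄ = HeaderBits (assign clockTrace origin t next-r next-a next-b t₄)

    predecessor : ∃[ t₄ ] t₄ ∈ᵗ tupleSet × holds (bitsOf t₄) 0 originates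
    predecessor = origin-of t next-r next-a next-b a b r e

    satisfied : holds (bitsOf (proj₁ predecessor)) 0 lawful
    satisfied = bwd (lawful-parts B)
      ( bwd (holds-isClock B clock) clockTrace-clock
      , bwd (holds-allZero B clockTrace-clock base) (tupleTrace-encodes (tuple 0 0 0))
      , bwd (holds-advance B clockTrace-clock {current} {succ₁} advance-r (advances-r a b r) e) (tupleTrace-encodes (tuple a b (suc r)))
      , (λ h → at-end (fwd (holds-atEnd B clockTrace-clock {current} e) h))
      , (λ h → at-start (fwd (holds-atStart B clockTrace-clock {current} e) h))
      , bwd (holds-someBlock B clock clockTrace-clock 0 (Tracks.bit clock 4 current))
          (a + b + (a * b + r) , bwd (proj₂ (proj₂ (proj₂ (proj₂ e))) _) refl)
      , proj₂ (proj₂ predecessor) )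
      where
      B = bitsOf (proj₁ predecessor)
      at-end : r ≡ b → holds B 0 (Tracks.step clock advance-a current succ₂)
      at-end r≡b = bwd (holds-advance B clockTrace-clock {current} {succ₂} advance-a (advances-a a b)
        (subst (λ z → Encodes (Bit t) (tuple a b z)) r≡b e)) (tupleTrace-encodes (tuple (suc a) b 0))
      at-start : a ≡ 0 × r ≡ 0 → holds B 0 (Tracks.step clock advance-b current succ₃)
      at-start (a≡0 , r≡0) = bwd (holds-advance B clockTrace-clock {current} {succ₃} advance-b (advances-b b)
        (subst₂ (λ x z → Encodes (Bit t) (tuple x b z)) a≡0 r≡0 e)) (tupleTrace-encodes (tuple 0 (suc b) 0))

  headed : TraceSet → TraceSet → TraceSet → (c t₀ t t₁ t₂ t₃ t₄ : Trace) → Assignment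
  headed T C Φ c t₀ t t₁ t₂ t₃ t₄ = H.initial T [ clocks ↦ˢ C ] [ headerName clock ↦ᵗ c ] [ tuples ↦ˢ Φ ]
    [ headerName base ↦ᵗ t₀ ] [ headerName current ↦ᵗ t ] [ headerName succ₁ ↦ᵗ t₁ ] [ headerName succ₂ ↦ᵗ t₂ ]
    [ headerName succ₃ ↦ᵗ t₃ ] [ headerName pred ↦ᵗ t₄ ]

  module _ (T C Φ : TraceSet) (c t₀ t t₁ t₂ t₃ t₄ : Trace) where

    private Π = headed T C Φ c t₀ t t₁ t₂ t₃ t₄

    headed-bits : ∀ a i → tb Π (headerName a) i ⇔ Bit (assign c t₀ t t₁ t₂ t₃ t₄ a) i
    headed-bits clock   i = just⇔
    headed-bits base    i = just⇔
    headed-bits current i = just⇔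
    headed-bits succ₁   i = just⇔
    headed-bits succ₂   i = just⇔
    headed-bits succ₃   i = just⇔
    headed-bits pred    i = just⇔

    headed-lawful : ∀ {Π′} → Agree [] Π Π′ → (Π′ ⊨ᵠ lawfulQF) ⇔ holds (HeaderBits (assign c t₀ t t₁ t₂ t₃ t₄)) 0 lawful
    headed-lawful {Π′} ag = ⇔-trans (⊨-inst headerName Π′ lawful) (holds-cong
      (λ a i → ⇔-trans (tb-cong {Π} {Π′} {headerName a} (Agree.sameTrace ag (headerName a) (not-header a)) i) (headed-bits a i)) lawful 0)

    headed-base : ∀ {G : Set} → t₀ ∈ᵗ Φ → (G → Clock (Bit c)) → (G → ∀ t → t ∈ᵗ Φ → IsTuple t) →
      (G → ∀ a b r → ∃[ t ] t ∈ᵗ Φ × Encodes (Bit t) (tuple a b r)) → Base G Π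
    headed-base t₀∈ clk snd cmp = record
      { clocked  = λ g → clock-cong (headed-bits clock) (clk g)
      ; nonempty = t₀ , just t₀∈
      ; sound    = λ { g t (just m) → snd g t m }
      ; complete = λ g a b r → let t , m , e = cmp g a b r in t , just m , e }

  hyper-correct : ∀ φ → (∀ s x → ¬ A.Free s x φ) → (A.default A.⊨ φ) ⇔ (∃[ T ] H.initial T ⊨ hyper φ)
  hyper-correct φ closed = mk⇔ to′ from′
    where
    tree = fromFormula φ
    env : ∀ {G Π} → Env G Π [] A.default (λ s x → A.Free s x φ)
    env s x free = ⊥-elim (closed s x free)

    to′ : A.default A.⊨ φ → ∃[ T ] H.initial T ⊨ hyper φ
    to′ p = H.allTraces , H.allTraces , clockTrace , just refl , tupleSet , origin , just (tuple∈ 0 0 0) , play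
      where
      play : ∀ t → Any (t ∈ᵗ_) (just tupleSet) → _
      play t (just m) with fwd (∈-tupleSet t) m
      ... | a , b , r , e = next-r , just (tuple∈ a b (suc r)) , next-a , just (tuple∈ (suc a) b 0)
          , next-b , just (tuple∈ 0 (suc b) 0) , t₄ , just (proj₁ (proj₂ predecessor))
          , formula-plays {G = ⊤} true φ
              (headed-base H.allTraces H.allTraces tupleSet clockTrace origin t next-r next-a next-b t₄ (tuple∈ 0 0 0)
                (λ _ → clockTrace-clock) (λ _ t → fwd (∈-tupleSet t))
                (λ _ a b r → tupleTrace (tuple a b r) , tuple∈ a b r , tupleTrace-encodes (tuple a b r)))
              env (kernel tree)
              λ Π′ ag w → bwd conj (bwd (headed-lawful H.allTraces H.allTraces tupleSet clockTrace origin t next-r next-a next-b t₄ ag) satisfied , w tt p)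
        where
        open Built t a b r e
        t₄ = proj₁ predecessor

    from′ : (∃[ T ] H.initial T ⊨ hyper φ) → A.default A.⊨ φ
    from′ (T , C , c , _ , Φ , t₀ , just t₀∈ , game) = conclude (game t₀ (just t₀∈))
      where
      lawful-at : ∀ t → t ∈ᵗ Φ → ∃[ t₁ ] t₁ ∈ᵗ Φ × ∃[ t₂ ] t₂ ∈ᵗ Φ × ∃[ t₃ ] t₃ ∈ᵗ Φ × ∃[ t₄ ] t₄ ∈ᵗ Φ ×
        Lawful (HeaderBits (assign c t₀ t t₁ t₂ t₃ t₄))
      lawful-at t t∈ with game t (just t∈)
      ... | t₁ , just m₁ , t₂ , just m₂ , t₃ , just m₃ , t₄ , just m₄ , h = t₁ , m₁ , t₂ , m₂ , t₃ , m₃ , t₄ , m₄ ,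
        -- With `G = ⊥` only nonemptiness is assumed. If the header traces were unlawful, the kernel
        -- would fail after every continuation, which contradicts the prefix being satisfied.
        lawful-elim _ (stable λ unlawful → forced φ {A.default} {G = ⊥}
          (headed-base T C Φ c t₀ t t₁ t₂ t₃ t₄ t₀∈ (λ ()) (λ ()) (λ ())) env
          (λ Π′ ag _ k → unlawful (fwd (headed-lawful T C Φ c t₀ t t₁ t₂ t₃ t₄ ag) (proj₁ (fwd conj k)))) h)
      open Extraction c t₀ (_∈ᵗ Φ) t₀∈ lawful-at
      conclude : ∃[ t₁ ] Any (t₁ ∈ᵗ_) (just Φ) × ∃[ t₂ ] Any (t₂ ∈ᵗ_) (just Φ) × ∃[ t₃ ] Any (t₃ ∈ᵗ_) (just Φ) ×
        ∃[ t₄ ] Any (t₄ ∈ᵗ_) (just Φ) × (headed T C Φ c t₀ t₀ t₁ t₂ t₃ t₄ ⊨ prefix true tree [] (kernel tree)) → A.default A.⊨ φ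
      -- The clock and the set of tuples are now known to be as intended, so the argument is
      -- repeated with `G = ⊤`, and a false formula would be exposed by the opponent.
      conclude (t₁ , _ , t₂ , _ , t₃ , _ , t₄ , _ , h) = stable λ false-φ → forced φ {A.default} {G = ⊤}
        (headed-base T C Φ c t₀ t₀ t₁ t₂ t₃ t₄ t₀∈ (λ _ → isClock′) (λ _ → all-sound) (λ _ → all-complete)) env
        (λ Π′ ag w k → false-φ (w tt (proj₂ (fwd conj k)))) h

abstract
  leaf-cost : ∀ a → ((1 + (a + 1)) + 1) + (3 * a + 1) ≡ 4 * suc a
  leaf-cost = solve-∀

  node-cost : ∀ a b → 2 + (4 * a + (1 + (4 * b + 1))) ≡ 4 * suc (a + b)
  node-cost = solve-∀

  negate-cost : ∀ a → (2 + (4 * a + 1)) + 1 ≡ 4 * suc a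
  negate-cost = solve-∀

  bind-cost : ∀ x a → (2 + (suc x + (4 * a + (2 + x)))) + (2 * x + 3) ≡ 4 * suc (suc x + a)
  bind-cost = solve-∀

  bind-size : ∀ x c a → suc (suc (x + c)) + a ≡ c + suc (suc x + a)
  bind-size = solve-∀

  total-cost : ∀ a → 1 + (4 * a + (1 + (1 + 4 * a))) ≡ 8 * a + 3
  total-cost = solve-∀

-- A machine for the translation of arithmetic

encodeArith : Arith → A.Token
encodeArith plus  = A.‵⊕
encodeArith times = A.‵⊗

encodeBin : Bin → A.Token
encodeBin (arith k)   = encodeArith k
encodeBin (rel equal) = A.‵≐
encodeBin (rel less)  = A.‵≺
encodeBin (rel mem₁)  = A.‵∈₁
encodeBin (rel mem₂)  = A.‵∈₂
encodeBin or          = A.‵∨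

encodeQuant : Bool → Sort → A.Token
encodeQuant true  = A.‵∃
encodeQuant false = A.‵∀

encodeTree : Tree → List A.Token
encodeTree (leaf s x)      = A.encodeName x
encodeTree (bin k l r)     = encodeBin k ∷ encodeTree l ++ encodeTree r
encodeTree (neg t)         = A.‵¬ ∷ encodeTree t
encodeTree (quant e s x t) = encodeQuant e s ∷ A.encodeName x ++ encodeTree t

encode-term : ∀ t → encodeTree (fromTerm t) ≡ A.encodeTerm t
encode-term (A.var x) = refl
encode-term (t A.⊕ u) = cong₂ (λ a b → A.‵⊕ ∷ a ++ b) (encode-term t) (encode-term u)
encode-term (t A.⊗ u) = cong₂ (λ a b → A.‵⊗ ∷ a ++ b) (encode-term t) (encode-term u)

encode-formula : ∀ φ → encodeTree (fromFormula φ) ≡ A.encode φ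
encode-formula (t A.≐ u)    = cong₂ (λ a b → A.‵≐ ∷ a ++ b) (encode-term t) (encode-term u)
encode-formula (t A.≺ u)    = cong₂ (λ a b → A.‵≺ ∷ a ++ b) (encode-term t) (encode-term u)
encode-formula (t A.∈₁ B)   = cong (λ a → A.‵∈₁ ∷ a ++ A.encodeName B) (encode-term t)
encode-formula (B A.∈₂ C)   = refl
encode-formula (A.¬′ φ)     = cong (A.‵¬ ∷_) (encode-formula φ)
encode-formula (φ A.∨ ψ)    = cong₂ (λ a b → A.‵∨ ∷ a ++ b) (encode-formula φ) (encode-formula ψ)
encode-formula (A.∃′ s x φ) = cong (λ a → A.‵∃ s ∷ A.encodeName x ++ a) (encode-formula φ)
encode-formula (A.∀′ s x φ) = cong (λ a → A.‵∀ s ∷ A.encodeName x ++ a) (encode-formula φ)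

module ArithmeticToHyperMachine (n : ℕ) (p₀ : Fin n) where

  open Translation n p₀
  open H using (‵∃X; ‵∀X; ‵∃π; ‵∀π; ‵¬; ‵∨; ‵X; ‵U; ‵end; ‵bit; ‵prop; encodeQF; encodeName; encodeSOVar)

  Items : Set
  Items = List (Item H.Token)

  items : ∀ {V : Set} → (V → Items) → Template V → Items
  items nm (at′ a)      = emit (‵prop p₀) ∷ nm a
  items nm (not′ φ)     = emit ‵¬ ∷ items nm φ
  items nm (next′ φ)    = emit ‵X ∷ items nm φ
  items nm (or′ φ ψ)    = emit ‵∨ ∷ items nm φ ++ items nm ψ
  items nm (until′ φ ψ) = emit ‵U ∷ items nm φ ++ items nm ψ

  -- What a script prints at a node with the given frames, where x is the name
  -- to the left of the head.
  printed : List Frame → Name → Items → List H.Token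
  printed fs x []            = []
  printed fs x (emit o ∷ is) = o ∷ printed fs x is
  printed fs x (path ∷ is)   = map ‵bit (bits fs) ++ printed fs x is
  printed fs x (res s ∷ is)  = map ‵bit (bits (look s x fs)) ++ printed fs x is
  printed fs x (name ∷ is)   = printed fs x is

  printed-++ : ∀ fs x is js → printed fs x (is ++ js) ≡ printed fs x is ++ printed fs x js
  printed-++ fs x []            js = refl
  printed-++ fs x (emit o ∷ is) js = cong (o ∷_) (printed-++ fs x is js)
  printed-++ fs x (path ∷ is)   js = trans (cong (map ‵bit (bits fs) ++_) (printed-++ fs x is js)) (sym (++-assoc (map ‵bit (bits fs)) _ _))
  printed-++ fs x (res s ∷ is)  js = trans (cong (map ‵bit (bits (look s x fs)) ++_) (printed-++ fs x is js)) (sym (++-assoc (map ‵bit (bits (look s x fs))) _ _))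
  printed-++ fs x (name ∷ is)   js = printed-++ fs x is js

  printed-items : ∀ {V : Set} fs x (nm : V → Items) (σ : V → Name) → (∀ a → printed fs x (nm a) ≡ encodeName (σ a)) →
    ∀ φ → printed fs x (items nm φ) ≡ encodeQF (inst σ φ)
  printed-items fs x nm σ e (at′ a)      = cong (‵prop p₀ ∷_) (e a)
  printed-items fs x nm σ e (not′ φ)     = cong (‵¬ ∷_) (printed-items fs x nm σ e φ)
  printed-items fs x nm σ e (next′ φ)    = cong (‵X ∷_) (printed-items fs x nm σ e φ)
  printed-items fs x nm σ e (or′ φ ψ)    = cong (‵∨ ∷_) (trans (printed-++ fs x (items nm φ) _)
    (cong₂ _++_ (printed-items fs x nm σ e φ) (printed-items fs x nm σ e ψ)))
  printed-items fs x nm σ e (until′ φ ψ) = cong (‵U ∷_) (trans (printed-++ fs x (items nm φ) _)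
    (cong₂ _++_ (printed-items fs x nm σ e φ) (printed-items fs x nm σ e ψ)))

  clockItems valueItems choiceItems setItems tupleItems : Items
  clockItems  = map emit (encodeName (headerName clock))
  valueItems  = emit (‵bit false) ∷ emit (‵bit false) ∷ path ∷ emit ‵end ∷ []
  choiceItems = emit (‵bit false) ∷ emit (‵bit true) ∷ path ∷ emit ‵end ∷ []
  setItems    = emit (‵bit true) ∷ path ∷ emit ‵end ∷ []
  tupleItems  = emit ‵end ∷ []

  childItems : Bool → Items
  childItems c = emit (‵bit false) ∷ emit (‵bit false) ∷ emit (‵bit c) ∷ path ∷ emit ‵end ∷ []

  leafItems : Sort → LeafVar → Items
  leafItems s clock = clockItems
  leafItems s self  = valueItems
  leafItems s ref   = emit (‵bit false) ∷ emit (‵bit true) ∷ res s ∷ emit ‵end ∷ []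

  relItems : RelVar → Items
  relItems clock = clockItems
  relItems lhs   = childItems false
  relItems rhs   = childItems true

  resultItems : ResultVar → Items
  resultItems clock = clockItems
  resultItems self  = valueItems
  resultItems lhs   = childItems false
  resultItems rhs   = childItems true

  printed-leaf : ∀ s fs x a → printed fs x (leafItems s a) ≡ encodeName (leafName (bits fs) (bits (look s x fs)) a)
  printed-leaf s fs x clock = refl
  printed-leaf s fs x self  = refl
  printed-leaf s fs x ref   = refl

  printed-rel : ∀ fs a → printed fs [] (relItems a) ≡ encodeName (relName (bits fs) a)
  printed-rel fs clock = refl
  printed-rel fs lhs   = refl
  printed-rel fs rhs   = refl

  printed-result : ∀ fs a → printed fs [] (resultItems a) ≡ encodeName (resultName (bits fs) a)
  printed-result fs clock = refl
  printed-result fs self  = refl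
  printed-result fs lhs   = refl
  printed-result fs rhs   = refl

  tokenX tokenπ : Bool → H.Token
  tokenX true  = ‵∃X
  tokenX false = ‵∀X
  tokenπ true  = ‵∃π
  tokenπ false = ‵∀π

  chooseItems : Bool → Sort → Items → Items
  chooseItems b number nm = emit (tokenπ b) ∷ nm ++ tupleItems
  chooseItems b _      nm = emit (tokenX b) ∷ setItems ++ emit (tokenπ b) ∷ nm ++ setItems

  -- The first Boolean distinguishes the pass that prints the prefix from the
  -- one that prints the matrix.
  leafScript : Bool → Bool → Sort → Items
  leafScript true  b class  = emit (tokenπ b) ∷ valueItems ++ emit (‵bit true) ∷ res class ∷ emit ‵end ∷ []
  leafScript true  b s      = chooseItems b s valueItems
  leafScript false b s      = items (leafItems s) (differs s)

  nodeScript : Bool → Bool → Bin → Items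
  nodeScript true  b (arith k) = chooseItems b number valueItems
  nodeScript true  b _         = []
  nodeScript false b (arith k) = emit ‵∨ ∷ emit ‵¬ ∷ items resultItems (result k) ++ emit ‵∨ ∷ []
  nodeScript false b (rel k)   = emit ‵¬ ∷ emit ‵∨ ∷ emit ‵¬ ∷ items relItems (related k) ++ emit ‵∨ ∷ []
  nodeScript false b or        = emit ‵∨ ∷ []

  negScript : Bool → Items
  negScript true  = []
  negScript false = emit ‵¬ ∷ []

  bindScript : Bool → Bool → Bool → Sort → Items
  bindScript true  b e s = chooseItems (flip e b) s choiceItems
  bindScript false b e s = []

  text : Bool → Bool → Tree → List Frame → List H.Token
  text g b (leaf s x)      fs = printed fs x (leafScript g b s)
  text g b (bin k l r)     fs = printed fs [] (nodeScript g b k) ++ (text g b l (lf b (rightSort k) ∷ fs) ++ text g b r (rf ∷ fs))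
  text g b (neg t)         fs = printed fs [] (negScript g) ++ text g (not b) t (rf ∷ fs)
  text g b (quant e s x t) fs = printed fs [] (bindScript g b e s) ++ text g b t (bd s x ∷ fs)

  encode-π : ∀ b π Y K → H.encode (quantπ b π Y K) ≡ tokenπ b ∷ encodeName π ++ encodeSOVar Y ++ H.encode K
  encode-π true  π Y K = refl
  encode-π false π Y K = refl

  encode-X : ∀ b Y K → H.encode (quantX b Y K) ≡ tokenX b ∷ encodeSOVar Y ++ H.encode K
  encode-X true  Y K = refl
  encode-X false Y K = refl

  encode-set : ∀ b {fs x} nm π K → printed fs x nm ≡ encodeName π →
    H.encode (quantX b (setName (bits fs)) (quantπ b π (setName (bits fs)) K)) ≡
    printed fs x (emit (tokenX b) ∷ setItems ++ emit (tokenπ b) ∷ nm ++ setItems) ++ H.encode K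
  encode-set b {fs} {x} nm π K e = trans (encode-X b _ _) (cong (tokenX b ∷_) (trans
    (cong (encodeSOVar Y ++_) (trans (encode-π b π _ K) (cong (tokenπ b ∷_)
      (trans (sym (++-assoc (encodeName π) (encodeSOVar Y) (H.encode K)))
        (cong (_++ H.encode K) (trans (cong (_++ encodeSOVar Y) (sym e)) (sym (printed-++ fs x nm setItems))))))))
    (trans (sym (++-assoc (encodeSOVar Y) _ (H.encode K)))
      (cong (_++ H.encode K) (sym (printed-++ fs x setItems (emit (tokenπ b) ∷ nm ++ setItems)))))))
    where Y = setName (bits fs)

  encode-choose : ∀ b s {fs x} nm π K → printed fs x nm ≡ encodeName π →
    H.encode (choose b s π (bits fs) K) ≡ printed fs x (chooseItems b s nm) ++ H.encode K
  encode-choose b number {fs} {x} nm π K e = trans (encode-π b π _ K) (cong (tokenπ b ∷_)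
    (trans (sym (++-assoc (encodeName π) (‵end ∷ []) (H.encode K)))
      (cong (_++ H.encode K) (trans (cong (_++ ‵end ∷ []) (sym e)) (sym (printed-++ fs x nm tupleItems))))))
  encode-choose b set   nm π K e = encode-set b nm π K e
  encode-choose b class nm π K e = encode-set b nm π K e

  encode-prefix : ∀ b t fs K → H.encode (prefix b t fs K) ≡ text true b t fs ++ H.encode K
  encode-prefix b (leaf number x) fs K = encode-choose b number {fs} {x} valueItems _ K refl
  encode-prefix b (leaf set x)    fs K = encode-choose b set {fs} {x} valueItems _ K refl
  encode-prefix b (leaf class x)  fs K = trans (encode-π b _ _ K) (cong (tokenπ b ∷_)
    (trans (sym (++-assoc (encodeName (valueName (bits fs))) (encodeSOVar (setName (bits (look class x fs)))) (H.encode K)))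
      (cong (_++ H.encode K) (sym (printed-++ fs x valueItems (emit (‵bit true) ∷ res class ∷ emit ‵end ∷ []))))))
  encode-prefix b (bin k l r) fs K = trans (node k) (trans
    (cong (printed fs [] (nodeScript true b k) ++_) (trans (encode-prefix b l _ _)
      (trans (cong (text true b l (lf b (rightSort k) ∷ fs) ++_) (encode-prefix b r _ K)) (sym (++-assoc (text true b l (lf b (rightSort k) ∷ fs)) _ _)))))
    (sym (++-assoc (printed fs [] (nodeScript true b k)) _ _)))
    where
    node : ∀ k {K} → H.encode (nodePrefix b k (bits fs) K) ≡ printed fs [] (nodeScript true b k) ++ H.encode K
    node (arith _) = encode-choose b number {fs} {[]} valueItems (valueName (bits fs)) _ refl
    node (rel _)   = refl
    node or        = refl
  encode-prefix b (neg t) fs K = encode-prefix (not b) t (rf ∷ fs) K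
  encode-prefix b (quant e s x t) fs K = trans (encode-choose (flip e b) s {fs} {[]} choiceItems _ _ refl) (trans
    (cong (printed fs [] (bindScript true b e s) ++_) (encode-prefix b t (bd s x ∷ fs) K))
    (sym (++-assoc (printed fs [] (bindScript true b e s)) _ _)))

  encode-matrix : ∀ b t fs → encodeQF (matrix b t fs) ≡ text false b t fs
  encode-matrix b (leaf s x) fs = sym (printed-items fs x (leafItems s) _ (printed-leaf s fs x) (differs s))
  encode-matrix b (bin (arith k) l r) fs = cong (λ l → ‵∨ ∷ ‵¬ ∷ l) (trans
    (cong₂ (λ p q → p ++ ‵∨ ∷ q) (sym (printed-items fs [] resultItems _ (printed-result fs) (result k)))
      (cong₂ _++_ (encode-matrix b l _) (encode-matrix b r _)))
    (trans (sym (++-assoc (printed fs [] (items resultItems (result k))) (‵∨ ∷ []) _))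
      (cong (_++ (text false b l (lf b number ∷ fs) ++ text false b r (rf ∷ fs))) (sym (printed-++ fs [] (items resultItems (result k)) (emit ‵∨ ∷ []))))))
  encode-matrix b (bin (rel k) l r) fs = cong (λ l → ‵¬ ∷ ‵∨ ∷ ‵¬ ∷ l) (trans
    (cong₂ (λ p q → p ++ ‵∨ ∷ q) (sym (printed-items fs [] relItems _ (printed-rel fs) (related k)))
      (cong₂ _++_ (encode-matrix b l _) (encode-matrix b r _)))
    (trans (sym (++-assoc (printed fs [] (items relItems (related k))) (‵∨ ∷ []) _))
      (cong (_++ (text false b l (lf b (rightSort (rel k)) ∷ fs) ++ text false b r (rf ∷ fs))) (sym (printed-++ fs [] (items relItems (related k)) (emit ‵∨ ∷ []))))))
  encode-matrix b (bin or l r) fs = cong (‵∨ ∷_) (cong₂ _++_ (encode-matrix b l _) (encode-matrix b r _))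
  encode-matrix b (neg t) fs = cong (‵¬ ∷_) (encode-matrix (not b) t (rf ∷ fs))
  encode-matrix b (quant e s x t) fs = encode-matrix b t (bd s x ∷ fs)

  abstract
    headerTokens matrixTokens : List H.Token
    headerTokens =
      ‵∃X ∷ encodeSOVar clocks ++ ‵∃π ∷ encodeName (headerName clock) ++ encodeSOVar clocks ++
      ‵∃X ∷ encodeSOVar tuples ++ ‵∃π ∷ encodeName (headerName base) ++ encodeSOVar tuples ++
      ‵∀π ∷ encodeName (headerName current) ++ encodeSOVar tuples ++
      ‵∃π ∷ encodeName (headerName succ₁) ++ encodeSOVar tuples ++ ‵∃π ∷ encodeName (headerName succ₂) ++ encodeSOVar tuples ++
      ‵∃π ∷ encodeName (headerName succ₃) ++ encodeSOVar tuples ++ ‵∃π ∷ encodeName (headerName pred) ++ encodeSOVar tuples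
    matrixTokens = ‵¬ ∷ ‵∨ ∷ ‵¬ ∷ encodeQF lawfulQF ++ ‵¬ ∷ []

    encode-hyper : ∀ φ → H.encode (hyper φ) ≡
      headerTokens ++ (text true true (fromFormula φ) [] ++ (matrixTokens ++ text false true (fromFormula φ) []))
    encode-hyper φ = cong (headerTokens ++_) (trans (encode-prefix true (fromFormula φ) [] (kernel (fromFormula φ))) (cong (text true true (fromFormula φ) [] ++_)
      (cong (λ l → ‵¬ ∷ ‵∨ ∷ ‵¬ ∷ l) (trans (cong (λ l → encodeQF lawfulQF ++ ‵¬ ∷ l) (encode-matrix true (fromFormula φ) []))
        (sym (++-assoc (encodeQF lawfulQF) (‵¬ ∷ []) _))))))

  -- `g` distinguishes the two passes and `b` is the polarity. The sort in the reading states is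
  -- that of a name expected next, because names themselves do not show their sort.
  data K : Set where
    start middle      : K
    read              : (g b : Bool) → Sort → K
    node              : (g b : Bool) → Bin → K
    negate            : (g b : Bool) → K
    bind              : (g b e : Bool) → Sort → K
    bindName skipName : (g b : Bool) → Sort → K
    atLeaf            : (g b : Bool) → Sort → K
    ascending         : Bool → K

  fin-Bin : Finite Bin
  fin-Bin = arith plus ∷ arith times ∷ rel equal ∷ rel less ∷ rel mem₁ ∷ rel mem₂ ∷ or ∷ [] , λ
    { (arith plus) → here refl ; (arith times) → there (here refl)
    ; (rel equal) → there (there (here refl)) ; (rel less) → there (there (there (here refl)))
    ; (rel mem₁) → there (there (there (there (here refl)))) ; (rel mem₂) → there (there (there (there (there (here refl)))))
    ; or → there (there (there (there (there (there (here refl)))))) }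
    where open import Data.List.Relation.Unary.Any using (here; there)

  fin-× : ∀ {A B : Set} → Finite A → Finite B → Finite (A × B)
  fin-× f g = fin-Σ f λ _ → g

  K-finite : Finite K
  K-finite = fin-onto
    (λ { (inj₁ true) → start ; (inj₁ false) → middle
       ; (inj₂ (inj₁ (g , b , s))) → read g b s
       ; (inj₂ (inj₂ (inj₁ (g , b , k)))) → node g b k
       ; (inj₂ (inj₂ (inj₂ (inj₁ (g , b))))) → negate g b
       ; (inj₂ (inj₂ (inj₂ (inj₂ (inj₁ (g , b , e , s)))))) → bind g b e s
       ; (inj₂ (inj₂ (inj₂ (inj₂ (inj₂ (inj₁ (g , b , s))))))) → bindName g b s
       ; (inj₂ (inj₂ (inj₂ (inj₂ (inj₂ (inj₂ (inj₁ (g , b , s)))))))) → skipName g b s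
       ; (inj₂ (inj₂ (inj₂ (inj₂ (inj₂ (inj₂ (inj₂ (inj₁ (g , b , s))))))))) → atLeaf g b s
       ; (inj₂ (inj₂ (inj₂ (inj₂ (inj₂ (inj₂ (inj₂ (inj₂ g)))))))) → ascending g })
    (λ { start → inj₁ true ; middle → inj₁ false
       ; (read g b s) → inj₂ (inj₁ (g , b , s))
       ; (node g b k) → inj₂ (inj₂ (inj₁ (g , b , k)))
       ; (negate g b) → inj₂ (inj₂ (inj₂ (inj₁ (g , b))))
       ; (bind g b e s) → inj₂ (inj₂ (inj₂ (inj₂ (inj₁ (g , b , e , s)))))
       ; (bindName g b s) → inj₂ (inj₂ (inj₂ (inj₂ (inj₂ (inj₁ (g , b , s))))))
       ; (skipName g b s) → inj₂ (inj₂ (inj₂ (inj₂ (inj₂ (inj₂ (inj₁ (g , b , s)))))))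
       ; (atLeaf g b s) → inj₂ (inj₂ (inj₂ (inj₂ (inj₂ (inj₂ (inj₂ (inj₁ (g , b , s))))))))
       ; (ascending g) → inj₂ (inj₂ (inj₂ (inj₂ (inj₂ (inj₂ (inj₂ (inj₂ g))))))) })
    (λ { start → refl ; middle → refl ; (read g b s) → refl ; (node g b k) → refl ; (negate g b) → refl
       ; (bind g b e s) → refl ; (bindName g b s) → refl ; (skipName g b s) → refl ; (atLeaf g b s) → refl
       ; (ascending g) → refl })
    (fin-⊎ fin-Bool (fin-⊎ BBS (fin-⊎ (fin-× fin-Bool (fin-× fin-Bool fin-Bin)) (fin-⊎ (fin-× fin-Bool fin-Bool)
      (fin-⊎ (fin-× fin-Bool (fin-× fin-Bool (fin-× fin-Bool fin-Sort))) (fin-⊎ BBS (fin-⊎ BBS (fin-⊎ BBS fin-Bool))))))))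
    where
    BBS : Finite (Bool × Bool × Sort)
    BBS = fin-× fin-Bool (fin-× fin-Bool fin-Sort)

  script : K → Items
  script start          = map emit headerTokens
  script middle         = map emit matrixTokens
  script (node g b k)   = nodeScript g b k
  script (negate g b)   = negScript g
  script (bind g b e s) = bindScript g b e s
  script (atLeaf g b s) = leafScript g b s
  script _              = []

  dispatch : (g b : Bool) → Sort → A.Token → K
  dispatch g b s A.‵⊕      = node g b (arith plus)
  dispatch g b s A.‵⊗      = node g b (arith times)
  dispatch g b s A.‵≐      = node g b (rel equal)
  dispatch g b s A.‵≺      = node g b (rel less)
  dispatch g b s A.‵∈₁     = node g b (rel mem₁)
  dispatch g b s A.‵∈₂     = node g b (rel mem₂)
  dispatch g b s A.‵∨      = node g b or
  dispatch g b s A.‵¬      = negate g b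
  dispatch g b s (A.‵∃ s′) = bind g b true s′
  dispatch g b s (A.‵∀ s′) = bind g b false s′
  dispatch g b s _         = skipName g b s

  -- `cL` means that a first child is finished: it becomes `cR`, and the second child is read with
  -- the stored polarity and sort. Every other cell is popped, and an empty stack ends the pass.
  climb : Bool → Maybe StackCell → Maybe (Action K)
  climb g     (just (cL b s)) = just (go false (swap cR) (read g b s))
  climb g     (just _)        = just (go false pop (ascending g))
  climb true  nothing         = just (rewind middle)
  climb false nothing         = nothing

  decide : K → Maybe A.Token → Maybe StackCell → Maybe (Action K)
  decide start            _                 _ = just (go false keep (read true true number))
  decide middle           _                 _ = just (go false keep (read false true number))
  decide (read g b s)     (just t)          _ = just (go false keep (dispatch g b s t))
  decide (read g b s)     nothing           _ = nothing
  decide (node g b k)     _                 _ = just (go true (push (cL b (rightSort k))) (read g b (leftSort k)))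
  decide (negate g b)     _                 _ = just (go true (push cR) (read g (not b) number))
  decide (bind g b e s)   _                 _ = just (go true (push cdl) (bindName g b s))
  decide (bindName g b s) (just (A.‵bit c)) _ = just (go true (push (cbit c)) (bindName g b s))
  decide (bindName g b s) _                 _ = just (go true (push (cB s)) (read g b number))
  decide (skipName g b s) (just (A.‵bit _)) _ = just (go true keep (skipName g b s))
  decide (skipName g b s) _                 _ = just (go false keep (atLeaf g b s))
  decide (atLeaf g b s)   _                 _ = just (go true keep (ascending g))
  decide (ascending g)    _                 c = climb g c

  bit? : A.Token → Maybe Bool
  bit? (A.‵bit b) = just b
  bit? _          = nothing

  bit?-bit : ∀ b → bit? (A.‵bit b) ≡ just b
  bit?-bit b = refl

  open Scripted A.‵bit bit? bit?-bit ‵bit K-finite start script decide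

  -- Inner nodes print plain items, which do not consult the input. Resolving a name is reserved for
  -- leaves, where the head stands at the end of a name.
  Plain Printable : Item H.Token → Set
  Plain (emit _) = ⊤
  Plain path     = ⊤
  Plain _        = ⊥
  Printable name = ⊥
  Printable _    = ⊤

  plain-items : ∀ {V : Set} {P : Item H.Token → Set} (nm : V → Items) → (∀ o → P (emit o)) → (∀ a → All P (nm a)) → ∀ φ → All P (items nm φ)
  plain-items nm p q (at′ a)      = p _ ∷ q a
  plain-items nm p q (not′ φ)     = p _ ∷ plain-items nm p q φ
  plain-items nm p q (next′ φ)    = p _ ∷ plain-items nm p q φ
  plain-items nm p q (or′ φ ψ)    = p _ ∷ ++⁺ (plain-items nm p q φ) (plain-items nm p q ψ)
  plain-items nm p q (until′ φ ψ) = p _ ∷ ++⁺ (plain-items nm p q φ) (plain-items nm p q ψ)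

  plain-choose : ∀ b s {nm} → All Plain nm → All Plain (chooseItems b s nm)
  plain-choose b number h = tt ∷ ++⁺ h (tt ∷ [])
  plain-choose b set    h = tt ∷ tt ∷ tt ∷ tt ∷ tt ∷ ++⁺ h (tt ∷ tt ∷ tt ∷ [])
  plain-choose b class  h = tt ∷ tt ∷ tt ∷ tt ∷ tt ∷ ++⁺ h (tt ∷ tt ∷ tt ∷ [])

  plain-node : ∀ g b k → All Plain (nodeScript g b k)
  plain-node true  b (arith k) = plain-choose b number (tt ∷ tt ∷ tt ∷ tt ∷ [])
  plain-node true  b (rel k)   = []
  plain-node true  b or        = []
  plain-node false b (arith k) = tt ∷ tt ∷ ++⁺ (plain-items resultItems (λ _ → tt)
    (λ { clock → tt ∷ tt ∷ [] ; self → tt ∷ tt ∷ tt ∷ tt ∷ [] ; lhs → tt ∷ tt ∷ tt ∷ tt ∷ tt ∷ [] ; rhs → tt ∷ tt ∷ tt ∷ tt ∷ tt ∷ [] }) (result k)) (tt ∷ [])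
  plain-node false b (rel k)   = tt ∷ tt ∷ tt ∷ ++⁺ (plain-items relItems (λ _ → tt)
    (λ { clock → tt ∷ tt ∷ [] ; lhs → tt ∷ tt ∷ tt ∷ tt ∷ tt ∷ [] ; rhs → tt ∷ tt ∷ tt ∷ tt ∷ tt ∷ [] }) (related k)) (tt ∷ [])
  plain-node false b or        = tt ∷ []

  plain-neg : ∀ g → All Plain (negScript g)
  plain-neg true  = []
  plain-neg false = tt ∷ []

  plain-bind : ∀ g b e s → All Plain (bindScript g b e s)
  plain-bind true  b e s = plain-choose (flip e b) s (tt ∷ tt ∷ tt ∷ tt ∷ [])
  plain-bind false b e s = []

  printable-leaf : ∀ g b s → All Printable (leafScript g b s)
  printable-leaf true  b number = tt ∷ tt ∷ tt ∷ tt ∷ tt ∷ tt ∷ []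
  printable-leaf true  b set    = tt ∷ tt ∷ tt ∷ tt ∷ tt ∷ tt ∷ tt ∷ tt ∷ tt ∷ tt ∷ tt ∷ tt ∷ []
  printable-leaf true  b class  = tt ∷ tt ∷ tt ∷ tt ∷ tt ∷ tt ∷ tt ∷ tt ∷ []
  printable-leaf false b s      = plain-items (leafItems s) (λ _ → tt)
    (λ { clock → tt ∷ tt ∷ [] ; self → tt ∷ tt ∷ tt ∷ tt ∷ [] ; ref → tt ∷ tt ∷ tt ∷ tt ∷ [] }) (differs s)

  prints-path : ∀ {N ls rs} fs → length (cells fs) ≤ N → Emits N path ls rs (cells fs) (map ‵bit (bits fs))
  prints-path fs le = subst (λ p → Emits _ path _ _ (cells fs) (map ‵bit p)) (cellBits-cells fs) (path le)

  prints-plain : ∀ {N ls rs is} fs → length (cells fs) ≤ N → All Plain is → EmitsAll N is ls rs (cells fs) (printed fs [] is)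
  prints-plain {is = []}          fs le []      = []
  prints-plain {is = emit o ∷ is} fs le (_ ∷ h) = emit ∷ prints-plain fs le h
  prints-plain {is = path ∷ is}   fs le (_ ∷ h) = prints-path fs le ∷ prints-plain fs le h

  prints-leaf : ∀ {N T ls rs is} fs x → length (cells fs) ≤ N → length x ≤ N → bit? T ≡ nothing → All Printable is →
    EmitsAll N is (map A.‵bit (reverse x) ++ T ∷ ls) (A.‵end ∷ rs) (cells fs) (printed fs x is)
  prints-leaf {is = []}          fs x le le′ nb []      = []
  prints-leaf {is = emit o ∷ is} fs x le le′ nb (_ ∷ h) = emit ∷ prints-leaf fs x le le′ nb h
  prints-leaf {is = path ∷ is}   fs x le le′ nb (_ ∷ h) = prints-path fs le ∷ prints-leaf fs x le le′ nb h
  prints-leaf {is = res s ∷ is}  fs x le le′ nb (_ ∷ h) = res fs x nb refl le le′ ∷ prints-leaf fs x le le′ nb h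

  advanceStay : ∀ {N k ls rs st out o k′} → EmitsAll N (script k) ls rs st o →
    decide k (List.head rs) (List.head st) ≡ just (go false keep k′) →
    N ⊢ ⟨ k , ls , rs , st , out ⟩ ⇒≤[ 1 ] ⟨ k′ , ls , rs , st , o ʳ++ out ⟩
  advanceStay es e = one (goes es e stay keep)

  skipping : ∀ {N} g b s x ls rest st out → N ⊢ ⟨ skipName g b s , ls , A.encodeName x ++ rest , st , out ⟩ ⇒≤[ length x + 1 ]
    ⟨ atLeaf g b s , map A.‵bit x ʳ++ ls , A.‵end ∷ rest , st , out ⟩
  skipping g b s []      ls rest st out = advanceStay [] refl
  skipping g b s (c ∷ x) ls rest st out = one (goes [] refl right keep) then skipping g b s x _ rest st out

  naming : ∀ {N} g b s x ls rest st out → N ⊢ ⟨ bindName g b s , ls , A.encodeName x ++ rest , st , out ⟩ ⇒≤[ suc (length x) ]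
    ⟨ read g b number , A.encodeName x ʳ++ ls , rest , cB s ∷ (map cbit x ʳ++ st) , out ⟩
  naming g b s []      ls rest st out = one (goes [] refl right push)
  naming g b s (c ∷ x) ls rest st out = one (goes [] refl right push) then naming g b s x _ rest _ out

  unnaming : ∀ {N} g x ls rest st out → N ⊢ ⟨ ascending g , ls , rest , map cbit x ++ cdl ∷ st , out ⟩ ⇒≤[ suc (length x) ]
    ⟨ ascending g , ls , rest , st , out ⟩
  unnaming g []      ls rest st out = one (goes [] refl stay pop)
  unnaming g (c ∷ x) ls rest st out = one (goes [] refl stay pop) then unnaming g x ls rest st out

  data Fits (s : Sort) : Kind → Set where
    operand : Fits s (operand s)
    formula : Fits s formula

  -- A name on the input has to be preceded by a token other than a bit, so that a comparison from
  -- right to left notices its beginning. Only a formula can stand at the very start of the input.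
  data Boundary : Kind → List A.Token → Set where
    token : ∀ {k T ls} → bit? T ≡ nothing → Boundary k (T ∷ ls)
    root  : ∀ {ls} → Boundary formula ls

  -- Every encoding closes with a name and hence with `‵end`, which is not a bit and so serves as
  -- the boundary of whatever follows.
  ends : ∀ t ls → ∃[ ls′ ] encodeTree t ʳ++ ls ≡ A.‵end ∷ ls′
  ends (leaf s x) ls = _ , ++-ʳ++ (map A.‵bit x)
  ends (bin k l r) ls = let ls′ , e = ends r (encodeTree l ʳ++ (encodeBin k ∷ ls)) in ls′ , trans (++-ʳ++ (encodeTree l)) e
  ends (neg t) ls = ends t (A.‵¬ ∷ ls)
  ends (quant e s x t) ls = let ls′ , eq = ends t _ in ls′ , trans (++-ʳ++ (A.encodeName x)) eq

  boundary-after : ∀ k t ls → Boundary k (encodeTree t ʳ++ ls)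
  boundary-after k t ls = let ls′ , e = ends t ls in subst (Boundary k) (sym e) (token refl)

  encodeBin-end : ∀ k → bit? (encodeBin k) ≡ nothing
  encodeBin-end (arith plus)  = refl
  encodeBin-end (arith times) = refl
  encodeBin-end (rel equal)   = refl
  encodeBin-end (rel less)    = refl
  encodeBin-end (rel mem₁)    = refl
  encodeBin-end (rel mem₂)    = refl
  encodeBin-end or            = refl

  dispatch-bin : ∀ g b s k → dispatch g b s (encodeBin k) ≡ node g b k
  dispatch-bin g b s (arith plus)  = refl
  dispatch-bin g b s (arith times) = refl
  dispatch-bin g b s (rel equal)   = refl
  dispatch-bin g b s (rel less)    = refl
  dispatch-bin g b s (rel mem₁)    = refl
  dispatch-bin g b s (rel mem₂)    = refl
  dispatch-bin g b s or            = refl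

  dispatch-quant : ∀ g b s e s′ → dispatch g b s (encodeQuant e s′) ≡ bind g b e s′
  dispatch-quant g b s true  s′ = refl
  dispatch-quant g b s false s′ = refl

  dispatch-name : ∀ g b s x rest st → decide (read g b s) (List.head (A.encodeName x ++ rest)) st ≡ just (go false keep (skipName g b s))
  dispatch-name g b s []      rest st = refl
  dispatch-name g b s (_ ∷ x) rest st = refl

  boundary-name : ∀ {k} x ls → Boundary k (A.encodeName x ʳ++ ls)
  boundary-name {k} x ls = boundary-after k (leaf number x) ls

  left-size : ∀ {N} l r fs {b s} → length (cells fs) + suc (length (encodeTree l ++ encodeTree r)) ≤ N →
    length (cells (lf b s ∷ fs)) + length (encodeTree l) ≤ N
  left-size l r fs le = ≤-trans (≤-reflexive (sym (+-suc (length (cells fs)) (length (encodeTree l)))))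
    (≤-trans (+-monoʳ-≤ (length (cells fs)) (s≤s (≤-trans (m≤m+n _ _) (≤-reflexive (sym (length-++ (encodeTree l))))))) le)

  right-size : ∀ {N} l r fs → length (cells fs) + suc (length (encodeTree l ++ encodeTree r)) ≤ N →
    length (cells (rf ∷ fs)) + length (encodeTree r) ≤ N
  right-size l r fs le = ≤-trans (≤-reflexive (sym (+-suc (length (cells fs)) (length (encodeTree r)))))
    (≤-trans (+-monoʳ-≤ (length (cells fs)) (s≤s (≤-trans (m≤n+m _ (length (encodeTree l))) (≤-reflexive (sym (length-++ (encodeTree l))))))) le)

  Runs : (N : ℕ) (g b : Bool) (s : Sort) (t : Tree) → List Frame → List A.Token → Set
  Runs N g b s t fs ls = ∀ rest out → N ⊢ ⟨ read g b s , ls , encodeTree t ++ rest , cells fs , out ⟩ ⇒≤[ 4 * length (encodeTree t) ]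
    ⟨ ascending g , encodeTree t ʳ++ ls , rest , cells fs , text g b t fs ʳ++ out ⟩

  run-bin : ∀ {N} g b s k l r fs ls → length (cells fs) ≤ N →
    Runs N g b (leftSort k) l (lf b (rightSort k) ∷ fs) (encodeBin k ∷ ls) →
    Runs N g b (rightSort k) r (rf ∷ fs) (encodeTree l ʳ++ (encodeBin k ∷ ls)) → Runs N g b s (bin k l r) fs ls
  run-bin g b s k l r fs ls le runL runR rest out =
    source (cong (λ rs → ⟨ read g b s , ls , encodeBin k ∷ rs , cells fs , out ⟩) (++-assoc (encodeTree l) (encodeTree r) rest))
    (target (cong₂ (λ ls o → ⟨ ascending g , ls , rest , cells fs , o ⟩) (sym (++-ʳ++ (encodeTree l)))
        (trans (sym (++-ʳ++ (text g b l (lf b (rightSort k) ∷ fs)))) (sym (++-ʳ++ (printed fs [] (nodeScript g b k))))))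
    (atMost (≤-reflexive (trans (node-cost (length (encodeTree l)) (length (encodeTree r)))
        (cong (λ n → 4 * suc n) (sym (length-++ (encodeTree l))))))
      ((advanceStay [] (cong (λ k′ → just (go false keep k′)) (dispatch-bin g b s k))
        then one (goes (prints-plain fs le (plain-node g b k)) refl right push))
      then runL _ _ then one (goes [] refl stay swap) then runR _ _ then one (goes [] refl stay pop))))

  -- The stack height plus the length of the current subtree never exceeds `N`: each cell that is
  -- pushed is paid for by a token already read. A quantifier with the name `x` meets this exactly,
  -- with |x| + 2 on either side.
  run-tree : ∀ {N} g b {k s} t fs ls → Sorted k t → Fits s k → Boundary k ls → length (cells fs) + length (encodeTree t) ≤ N →
    Runs N g b s t fs ls
  run-tree {N} g b (leaf s x) fs (T ∷ ls) leaf operand (token nb) le rest out =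
    target (cong₂ (λ ls o → ⟨ ascending g , ls , rest , cells fs , o ⟩) (sym (++-ʳ++ (map A.‵bit x))) refl)
    (atMost (≤-trans (≤-by _ (leaf-cost (length x))) (≤-reflexive (cong (4 *_) (sym (length-name A.‵bit A.‵end x)))))
      ((advanceStay [] (dispatch-name g b s x rest (List.head (cells fs)))
        then skipping g b s x (T ∷ ls) rest (cells fs) out)
        then source (cong (λ ls → ⟨ atLeaf g b s , ls , A.‵end ∷ rest , cells fs , out ⟩) (map-ʳ++-++ A.‵bit x {[]} {T ∷ ls}))
          (target (cong (λ l → ⟨ ascending g , A.‵end ∷ l , rest , cells fs , _ ⟩) (sym (map-ʳ++-++ A.‵bit x {[]} {T ∷ ls})))
            (one (goes (prints-leaf fs x (≤-trans (m≤m+n _ _) le) (≤-trans (≤-trans (n≤1+n _) (≤-reflexive (sym (length-name A.‵bit A.‵end x)))) (≤-trans (m≤n+m _ (length (cells fs))) le)) nb (printable-leaf g b s)) refl right keep)))))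
  run-tree g b (bin (arith k) l r) fs ls (arith sl sr) fits boundary le =
    run-bin g b _ (arith k) l r fs ls (≤-trans (m≤m+n _ _) le)
      (run-tree g b l _ _ sl operand (token (encodeBin-end (arith k))) (left-size l r fs {b} {number} le))
      (run-tree g b r _ _ sr operand (boundary-after _ l _) (right-size l r fs le))
  run-tree g b (bin (rel k) l r) fs ls (rel sl sr) fits boundary le =
    run-bin g b _ (rel k) l r fs ls (≤-trans (m≤m+n _ _) le)
      (run-tree g b l _ _ sl operand (token (encodeBin-end (rel k))) (left-size l r fs {b} {number} le))
      (run-tree g b r _ _ sr operand (boundary-after _ l _) (right-size l r fs le))
  run-tree g b (bin or l r) fs ls (or sl sr) fits boundary le =
    run-bin g b _ or l r fs ls (≤-trans (m≤m+n _ _) le)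
      (run-tree g b l _ _ sl formula (token refl) (left-size l r fs {b} {number} le))
      (run-tree g b r _ _ sr formula (boundary-after _ l _) (right-size l r fs le))
  run-tree g b {s = s} (neg t) fs ls (neg st) fits boundary le rest out =
    target (cong (λ o → ⟨ ascending g , _ , rest , cells fs , o ⟩) (sym (++-ʳ++ (printed fs [] (negScript g)))))
    (atMost (≤-by _ (negate-cost (length (encodeTree t))))
      ((advanceStay [] refl then one (goes (prints-plain fs (≤-trans (m≤m+n _ _) le) (plain-neg g)) refl right push))
       then run-tree g (not b) t (rf ∷ fs) _ st formula (token refl) (≤-trans (≤-reflexive (sym (+-suc _ _))) le) rest _
       then one (goes [] refl stay pop)))
  run-tree {N} g b {s = s} (quant e s′ x t) fs ls (quant st) fits boundary le rest out =
    source (cong (λ rs → ⟨ read g b s , ls , encodeQuant e s′ ∷ rs , cells fs , out ⟩) (++-assoc (A.encodeName x) (encodeTree t) rest))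
    (target (cong₂ (λ ls o → ⟨ ascending g , ls , rest , cells fs , o ⟩) (sym (++-ʳ++ (A.encodeName x)))
        (sym (++-ʳ++ (printed fs [] (bindScript g b e s′)))))
    (atMost (≤-trans (≤-by _ (bind-cost (length x) (length (encodeTree t)))) (≤-reflexive (cong (λ n → 4 * suc n)
        (trans (cong (_+ length (encodeTree t)) (sym (length-name A.‵bit A.‵end x))) (sym (length-++ (A.encodeName x)))))))
      ((advanceStay [] (cong (λ k′ → just (go false keep k′)) (dispatch-quant g b s e s′))
        then one (goes (prints-plain fs (≤-trans (m≤m+n _ _) le) (plain-bind g b e s′)) refl right push))
       then target (cong (λ st → ⟨ read g b number , _ , _ , cB s′ ∷ st , _ ⟩) stacked) (naming g b s′ x _ _ (cdl ∷ cells fs) _)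
       then run-tree g b t (bd s′ x ∷ fs) _ st formula (boundary-name x _) size rest _
       then atMost (≤-reflexive (cong (λ n → 2 + n) (length-reverse x)))
         (one (goes [] refl stay pop) then unnaming g (reverse x) _ rest (cells fs) _))))
    where
    stacked : map cbit x ʳ++ (cdl ∷ cells fs) ≡ map cbit (reverse x) ++ cdl ∷ cells fs
    stacked = map-ʳ++-++ cbit x {[]} {cdl ∷ cells fs}
    size : length (cells (bd s′ x ∷ fs)) + length (encodeTree t) ≤ N
    size = ≤-trans (≤-reflexive (trans (cong (λ n → suc n + length (encodeTree t)) (trans (length-++ (map cbit (reverse x)))
        (trans (cong (_+ suc (length (cells fs))) (trans (length-map cbit (reverse x)) (length-reverse x))) (+-suc (length x) _))))
      (trans (bind-size (length x) (length (cells fs)) (length (encodeTree t)))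
        (cong (λ n → length (cells fs) + suc n) (trans (cong (_+ length (encodeTree t)) (sym (length-name A.‵bit A.‵end x)))
          (sym (length-++ (A.encodeName x)))))))) le

  runs-hyper : ∀ φ → length (A.encode φ) ⊢ ⟨ start , [] , A.encode φ , [] , [] ⟩ ⇒≤[ 8 * length (A.encode φ) + 3 ]
    ⟨ ascending false , A.encode φ ʳ++ [] , [] , [] , H.encode (hyper φ) ʳ++ [] ⟩
  runs-hyper φ = subst Claim (encode-formula φ) (atMost (≤-reflexive (total-cost (length w)))
    (advanceStay (emits-map headerTokens) refl
     then source (cong (λ rs → ⟨ read true true number , [] , rs , [] , headerTokens ʳ++ [] ⟩) (sym (++-identityʳ w)))
       (run-tree true true t [] [] (sorted-formula φ) formula root ≤-refl [] (headerTokens ʳ++ []))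
     then target (cong (λ rs → ⟨ middle , [] , rs , [] , prefixed ⟩) (reverse-involutive w))
       (one (rewinds [] (≤-reflexive (length-reverse w)) refl))
     then advanceStay (emits-map matrixTokens) refl
     then source (cong (λ rs → ⟨ read false true number , [] , rs , [] , matrixTokens ʳ++ prefixed ⟩) (sym (++-identityʳ w)))
       (target (cong (λ o → ⟨ ascending false , w ʳ++ [] , [] , [] , o ⟩) whole)
         (run-tree false true t [] [] (sorted-formula φ) formula root ≤-refl [] (matrixTokens ʳ++ prefixed)))))
    where
    t = fromFormula φ
    w = encodeTree t
    prefixed = text true true t [] ʳ++ (headerTokens ʳ++ [])
    Claim : List A.Token → Set
    Claim w = length w ⊢ ⟨ start , [] , w , [] , [] ⟩ ⇒≤[ 8 * length w + 3 ]
      ⟨ ascending false , w ʳ++ [] , [] , [] , H.encode (hyper φ) ʳ++ [] ⟩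
    whole : text false true t [] ʳ++ (matrixTokens ʳ++ (text true true t [] ʳ++ (headerTokens ʳ++ []))) ≡ H.encode (hyper φ) ʳ++ []
    whole = sym (trans (cong (_ʳ++ []) (encode-hyper φ)) (trans (++-ʳ++ headerTokens)
      (trans (++-ʳ++ (text true true t [])) (++-ʳ++ matrixTokens))))

  arithmetic≤hyper : ExcludedMiddle 0ℓ → ThirdOrderTruth ≤ₚ XaFree-Hyper²LTL-SAT n
  arithmetic≤hyper em = record
    { reduce   = λ (φ , closed) → (hyper φ , hyper-sentence φ closed) , hyper-XaFree φ
    ; correct  = λ (φ , closed) → HeaderCorrectness.hyper-correct n p₀ em φ closed
    ; machine  = machine
    ; c        = coefficient 3
    ; k        = 3
    ; computes = λ (φ , _) → let t , t≤ , h = computesIn 3 (runs-hyper φ) refl refl in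
        t , t≤ , subst (Run.HaltsIn_On_With_ machine t (A.encode φ)) (reverse-involutive (H.encode (hyper φ))) h
    }

theorem4p2 : ExcludedMiddle 0ℓ → (n : ℕ) → .{{_ : NonZero n}} →
    (Hyper²LTL-SAT n ≡ₚ ThirdOrderTruth) × (ThirdOrderTruth ≤ₚ XaFree-Hyper²LTL-SAT n)
theorem4p2 em n = (HyperToArithmeticMachine.hyper≤arithmetic n em , forget hard) , hard
  where
  hard : ThirdOrderTruth ≤ₚ XaFree-Hyper²LTL-SAT n
  -- One proposition is enough for the translation, and the first one exists because `n` is nonzero.
  hard = ArithmeticToHyperMachine.arithmetic≤hyper n (fromℕ< (>-nonZero⁻¹ n)) em

  forget : ThirdOrderTruth ≤ₚ XaFree-Hyper²LTL-SAT n → ThirdOrderTruth ≤ₚ Hyper²LTL-SAT n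
  forget r = record
    { reduce = proj₁ ∘ reduce ; correct = correct ; machine = machine ; c = c ; k = k ; computes = computes }
    where open _≤ₚ_ r
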